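{- For every $\varepsilon>0$ there exists $k_0$ such that for every integer $k\ge k_0$ and every $\Delta \le (1-\varepsilon)k\ln k$ the following holds. Suppose $G$ is a graph on $n$ vertices with maximum degree $\Delta$ and girth at least $\ln\ln n$, and let $\boldsymbol{\sigma}$ be a uniformly random proper $k$-colouring of $G$. Then there is a function $r(n)=O((\ln n)^2)$ such that, with probability tending to $1$ as $n\to\infty$, every vertex $v\in V(G)$ satisfies: (1) in $\boldsymbol{\sigma}$, $v$ is $r(n)$-loose; (2) in $\boldsymbol{\sigma}$, $v$ is thawed (i.e. $1$-thawed).
   Context: For proper $k$-colourings $\sigma,\tau$ of $G$ let $\mathrm{dist}(\tau,\sigma)\coloneqq\#\{v: \sigma(v)\ne\tau(v)\}$ (Hamming distance). For $t\in\mathbb{N}$, the distance-$t$ $k$-colouring graph $\mathcal{H}(G,k,t)$ has as vertices the proper $k$-colourings of $G$, two distinct colourings $\tau,\sigma$ being adjacent if $\mathrm{dist}(\tau,\sigma)\le t$; its connected components are called $t$-clusters. Given a proper $k$-colouring $\tau$ and a vertex $v$: $v$ is $t$-loose in $\tau$ if for every $j\in[k]$ there exists a neighbour $\sigma$ of $\tau$ in $\mathcal{H}(G,k,t)$ with $\sigma(v)=j$; $v$ is $t$-thawed in $\tau$ if for every $j\in[k]$ there exists $\sigma$ in the same $t$-cluster as $\tau$ with $\sigma(v)=j$. "Thawed" means $1$-thawed. The implicit constant in $O((\ln n)^2)$ may depend on $\varepsilon,k,\Delta$ but not on $n$. -}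

module Defs where

open import Data.Nat as ℕ using (ℕ; zero; suc)
open import Data.Integer using (+_)
open import Data.Rational as ℚ using (ℚ; _/_)
open import Data.Bool using (Bool; true; false; if_then_else_; _∧_; not)
open import Data.Fin using (Fin; _≟_)
open import Data.Vec using (Vec; []; _∷_; lookup)
open import Data.List as List using (List; []; _∷_; _++_; [_]; allFin; concatMap; filterᵇ)
open import Data.Nat.ListAction using (sum)
open import Data.Bool.ListAction using (and)
open import Data.List.Relation.Unary.Linked using (Linked)
open import Data.List.Relation.Unary.Unique.Propositional using (Unique)
open import Data.Product using (Σ; ∃; ∃-syntax; _×_)
open import Relation.Nullary using (¬_; does)
open import Relation.Binary.PropositionalEquality using (_≡_; _≢_)
open import Relation.Binary.Construct.Closure.ReflexiveTransitive using (Star)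

ℕtoℚ : ℕ → ℚ
ℕtoℚ n = (+ n) / 1

expTerm : ℚ → ℕ → ℚ
expTerm x zero    = ℚ.1ℚ
expTerm x (suc i) = (expTerm x i ℚ.* x) ℚ.* ((+ 1) / suc i)

expPartial : ℚ → ℕ → ℚ
expPartial x zero    = ℚ.0ℚ
expPartial x (suc M) = expPartial x M ℚ.+ expTerm x M

-- Δ ≤ (1-ε) k ln k, encoded as exp(Δ / ((1-ε)k)) ≤ k, i.e.
-- for every rational y ≥ 0 with y·(1-ε)k ≤ Δ, every partial sum of exp(y) is ≤ k.
DeltaBound : ℚ → ℕ → ℕ → Set
DeltaBound ε k Δ =
  ∀ (y : ℚ) → ℚ.0ℚ ℚ.≤ y → (y ℚ.* ((ℚ.1ℚ ℚ.- ε) ℚ.* ℕtoℚ k)) ℚ.≤ ℕtoℚ Δ →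
  ∀ (M : ℕ) → expPartial y M ℚ.≤ ℕtoℚ k

-- ln ln n ≤ ℓ, encoded as n ≤ exp(exp ℓ) = sup_{N,M} expPartial (expPartial ℓ N) M
LnLnLe : ℕ → ℕ → Set
LnLnLe n ℓ = ∀ (j : ℕ) → ∃[ N ] ∃[ M ]
  (ℕtoℚ n ℚ.- ((+ 1) / suc j)) ℚ.< expPartial (expPartial (ℕtoℚ ℓ) N) M

record Graph (n : ℕ) : Set where
  field
    adj    : Fin n → Fin n → Bool
    sym    : ∀ i j → adj i j ≡ adj j i
    irrefl : ∀ i → adj i i ≡ false
open Graph public

Edge : ∀ {n} → Graph n → Fin n → Fin n → Set
Edge G i j = adj G i j ≡ true

degree : ∀ {n} → Graph n → Fin n → ℕ
degree {n} G v = sum (List.map (λ j → if adj G v j then 1 else 0) (allFin n))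

MaxDegree : ∀ {n} → Graph n → ℕ → Set
MaxDegree G Δ = (∀ v → degree G v ℕ.≤ Δ) × (∃[ v ] degree G v ≡ Δ)

IsCycle : ∀ {n} → Graph n → List (Fin n) → Set
IsCycle G []       = Data.Empty.⊥ where import Data.Empty
IsCycle G (v ∷ vs) =
  3 ℕ.≤ List.length (v ∷ vs) × Unique (v ∷ vs) × Linked (Edge G) ((v ∷ vs) ++ [ v ])

GirthAtLeastLnLn : ∀ {n} → Graph n → Set
GirthAtLeastLnLn {n} G = ∀ (c : List (Fin n)) → IsCycle G c → LnLnLe n (List.length c)

Colouring : ℕ → ℕ → Set
Colouring n k = Vec (Fin k) n

Proper : ∀ {n k} → Graph n → Colouring n k → Set
Proper G σ = ∀ i j → Edge G i j → lookup σ i ≢ lookup σ j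

dist : ∀ {n k} → Colouring n k → Colouring n k → ℕ
dist {n} σ τ = sum (List.map (λ i → if does (lookup σ i ≟ lookup τ i) then 0 else 1) (allFin n))

HAdj : ∀ {n k} → Graph n → ℕ → Colouring n k → Colouring n k → Set
HAdj G t τ σ = Proper G τ × Proper G σ × τ ≢ σ × dist τ σ ℕ.≤ t

SameCluster : ∀ {n k} → Graph n → ℕ → Colouring n k → Colouring n k → Set
SameCluster G t = Star (HAdj G t)

Loose : ∀ {n k} → Graph n → ℕ → Colouring n k → Fin n → Set
Loose {k = k} G t τ v = ∀ (j : Fin k) → ∃[ σ ] (HAdj G t τ σ × lookup σ v ≡ j)

Thawed : ∀ {n k} → Graph n → ℕ → Colouring n k → Fin n → Set
Thawed {k = k} G t τ v = ∀ (j : Fin k) → ∃[ σ ] (SameCluster G t τ σ × lookup σ v ≡ j)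

allColourings : ∀ n k → List (Colouring n k)
allColourings zero    k = [ [] ]
allColourings (suc n) k = concatMap (λ c → List.map (c ∷_) (allColourings n k)) (allFin k)

properᵇ : ∀ {n k} → Graph n → Colouring n k → Bool
properᵇ {n} G σ = and (List.map (λ i → and (List.map
  (λ j → not (adj G i j ∧ does (lookup σ i ≟ lookup σ j))) (allFin n))) (allFin n))

numProper : ∀ {n} → Graph n → ℕ → ℕ
numProper {n} G k = List.length (filterᵇ (properᵇ G) (allColourings n k))

-- "with probability ≥ m/(m+1), a uniformly random proper k-colouring σ satisfies P σ":
-- there are at least m/(m+1) · numProper many distinct proper colourings satisfying P
ProbAtLeast : ∀ {n} → Graph n → (k m : ℕ) → (Colouring n k → Set) → Set
ProbAtLeast {n} G k m P = ∃[ L ]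
  (Unique L × Data.List.Relation.Unary.All.All (λ σ → Proper G σ × P σ) L
   × m ℕ.* numProper G k ℕ.≤ suc m ℕ.* List.length L)
  where import Data.List.Relation.Unary.All

{-# OPTIONS --safe #-}
module Submission where

-- Call a vertex frozen if its own colour is the only one missing from its neighbourhood.
--
-- Counting. In every induced subgraph, adding back a vertex v multiplies the number of proper
-- colourings by at least ℓ, a constant multiple of (Δ/k + 1)²: resample the colours of the
-- neighbours of v given everything else. By AM-GM over the colours, about k e ^ (- Δ/k) ≥ k ^ ε of
-- them remain free for v on average, as long as few neighbours have fewer than t colours available,
-- and that follows from the same bound in a smaller graph. Consequently the vertices of an
-- independent set S are all frozen with probability at most ℓ ^ (- |S|).
--
-- Recolouring. A vertex u can leave its colour as soon as all its children of some other colour can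
-- leave theirs. So u is stuck only if at least b = k - 2 children are stuck, and stuck at depth d only
-- if some b-ary tree of depth d below u has frozen leaves throughout. There are at most
-- (16 (Δ/k + 1)) ^ (2 b ^ d) such trees, so by the union bound no vertex is stuck once b ^ d exceeds
-- 4 log n. At that depth balls are still trees, by the girth condition, and since Δ < b² they contain
-- O(b ^ (2 d)) = O((log n)²) vertices.

-- Probabilities occur only as counts. A deleted vertex keeps an arbitrary colour, so conditioning
-- becomes an exact identity with one factor k per resampled vertex, and "v has at least ℓ free
-- colours on average" reads `ℓ * #proper (v ∷ R) ≤ k * #proper R`. The induction ranges over
-- induced subgraphs because short lists at a neighbour of v are rare by the same bound in the graph
-- without v. The number e does not occur either. With 1/p ≤ ε, t = p² and τ = t - 1 = (p - 1)(p +
-- 1), the hypothesis on Δ is used only as (t/τ)^s ≤ k, and gives (1 - 1/t)^(t Δ/k) ≥ k^(-p/(p + 1))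
-- up to a constant factor. Half of the remaining exponent 1/(p + 1) pays for the colours spoilt by
-- neighbours with short lists. The other half beats any fixed power of Δ/k + 1, since Δ/k is at
-- most logarithmic in k. That ℓ is quadratic in Δ/k + 1 comes from the number of trees, (16 (Δ/k +
-- 1))² per leaf. That b is k - 2 comes from the new colour of a vertex, which must avoid its own
-- colour, that of its parent and those of at most b - 1 stuck children.

open import Defs hiding (sym)

-- Partial sums of the exponential, turned into inequalities between natural numbers.

module Exponential where

  open import Data.Nat as ℕ using (ℕ; zero; suc; s≤s; z≤n)
  import Data.Nat.Properties as ℕ
  open import Data.Integer as ℤ using (+_; -[1+_])
  import Data.Integer.Properties as ℤ
  open import Data.Rational
  open import Data.Rational.Properties
  open import Data.Rational.Solver using (module +-*-Solver)
  open import Data.Rational.Unnormalised as ℚᵘ using (mkℚᵘ)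
  import Data.Rational.Unnormalised.Properties as ℚᵘ
  open import Data.Product using (∃-syntax; _,_)
  open import Relation.Binary.PropositionalEquality
  open +-*-Solver

  -- Fractions built by `_/_` are normalised, so identities between `ℕtoℚ` and `recip` are checked
  -- on unnormalised fractions, where they are integer identities, and carried over by `fromℚᵘ`.
  fromℚᵘ-homo-+ : ∀ x y → fromℚᵘ (x ℚᵘ.+ y) ≡ fromℚᵘ x + fromℚᵘ y
  fromℚᵘ-homo-+ x y = toℚᵘ-injective (begin
    toℚᵘ (fromℚᵘ (x ℚᵘ.+ y))                  ≈⟨ toℚᵘ-fromℚᵘ (x ℚᵘ.+ y) ⟩
    x ℚᵘ.+ y                                  ≈⟨ ℚᵘ.+-cong (toℚᵘ-fromℚᵘ x) (toℚᵘ-fromℚᵘ y) ⟨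
    toℚᵘ (fromℚᵘ x) ℚᵘ.+ toℚᵘ (fromℚᵘ y)      ≈⟨ toℚᵘ-homo-+ (fromℚᵘ x) (fromℚᵘ y) ⟨
    toℚᵘ (fromℚᵘ x + fromℚᵘ y)                ∎)
    where open ℚᵘ.≃-Reasoning

  fromℚᵘ-homo-* : ∀ x y → fromℚᵘ (x ℚᵘ.* y) ≡ fromℚᵘ x * fromℚᵘ y
  fromℚᵘ-homo-* x y = toℚᵘ-injective (begin
    toℚᵘ (fromℚᵘ (x ℚᵘ.* y))                  ≈⟨ toℚᵘ-fromℚᵘ (x ℚᵘ.* y) ⟩
    x ℚᵘ.* y                                  ≈⟨ ℚᵘ.*-cong (toℚᵘ-fromℚᵘ x) (toℚᵘ-fromℚᵘ y) ⟨
    toℚᵘ (fromℚᵘ x) ℚᵘ.* toℚᵘ (fromℚᵘ y)      ≈⟨ toℚᵘ-homo-* (fromℚᵘ x) (fromℚᵘ y) ⟨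
    toℚᵘ (fromℚᵘ x * fromℚᵘ y)                ∎)
    where open ℚᵘ.≃-Reasoning

  fromℚᵘ-mono-≤ : ∀ {x y} → x ℚᵘ.≤ y → fromℚᵘ x ≤ fromℚᵘ y
  fromℚᵘ-mono-≤ {x} {y} x≤y = toℚᵘ-cancel-≤
    (ℚᵘ.≤-respʳ-≃ (ℚᵘ.≃-sym (toℚᵘ-fromℚᵘ y)) (ℚᵘ.≤-respˡ-≃ (ℚᵘ.≃-sym (toℚᵘ-fromℚᵘ x)) x≤y))

  fromℚᵘ-cancel-≤ : ∀ {x y} → fromℚᵘ x ≤ fromℚᵘ y → x ℚᵘ.≤ y
  fromℚᵘ-cancel-≤ {x} {y} x≤y =
    ℚᵘ.≤-respʳ-≃ (toℚᵘ-fromℚᵘ y) (ℚᵘ.≤-respˡ-≃ (toℚᵘ-fromℚᵘ x) (toℚᵘ-mono-≤ x≤y))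

  ℕtoℚ-+ : ∀ a b → ℕtoℚ (a ℕ.+ b) ≡ ℕtoℚ a + ℕtoℚ b
  ℕtoℚ-+ a b = trans (fromℚᵘ-cong {mkℚᵘ (+ (a ℕ.+ b)) 0} {mkℚᵘ (+ a) 0 ℚᵘ.+ mkℚᵘ (+ b) 0} (ℚᵘ.*≡* eq)) (fromℚᵘ-homo-+ (mkℚᵘ (+ a) 0) (mkℚᵘ (+ b) 0))
    where
    eq : + (a ℕ.+ b) ℤ.* + 1 ≡ (+ a ℤ.* + 1 ℤ.+ + b ℤ.* + 1) ℤ.* + 1
    eq = cong (ℤ._* + 1) (sym (cong₂ ℤ._+_ (ℤ.*-identityʳ (+ a)) (ℤ.*-identityʳ (+ b))))

  ℕtoℚ-* : ∀ a b → ℕtoℚ (a ℕ.* b) ≡ ℕtoℚ a * ℕtoℚ b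
  ℕtoℚ-* a b = trans (fromℚᵘ-cong {mkℚᵘ (+ (a ℕ.* b)) 0} {mkℚᵘ (+ a) 0 ℚᵘ.* mkℚᵘ (+ b) 0} (ℚᵘ.*≡* (cong (ℤ._* + 1) (ℤ.pos-* a b))))
    (fromℚᵘ-homo-* (mkℚᵘ (+ a) 0) (mkℚᵘ (+ b) 0))

  ℕtoℚ-mono : ∀ {a b} → a ℕ.≤ b → ℕtoℚ a ≤ ℕtoℚ b
  ℕtoℚ-mono {a} {b} a≤b = fromℚᵘ-mono-≤ {mkℚᵘ (+ a) 0} {mkℚᵘ (+ b) 0} (ℚᵘ.*≤* (ℤ.*-monoʳ-≤-nonNeg (+ 1) (ℤ.+≤+ a≤b)))

  ℕtoℚ-cancel : ∀ {a b} → ℕtoℚ a ≤ ℕtoℚ b → a ℕ.≤ b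
  ℕtoℚ-cancel {a} {b} h with fromℚᵘ-cancel-≤ {mkℚᵘ (+ a) 0} {mkℚᵘ (+ b) 0} h
  ... | ℚᵘ.*≤* le = ℤ.drop‿+≤+ (subst₂ ℤ._≤_ (ℤ.*-identityʳ (+ a)) (ℤ.*-identityʳ (+ b)) le)

  0≤ℕtoℚ : ∀ a → 0ℚ ≤ ℕtoℚ a
  0≤ℕtoℚ a = ℕtoℚ-mono {0} {a} z≤n

  recip : ℕ → ℚ
  recip d = (+ 1) / suc d

  recip-inverse : ∀ d → ℕtoℚ (suc d) * recip d ≡ 1ℚ
  recip-inverse d = trans (sym (fromℚᵘ-homo-* (mkℚᵘ (+ suc d) 0) (mkℚᵘ (+ 1) d)))
    (fromℚᵘ-cong {mkℚᵘ (+ suc d) 0 ℚᵘ.* mkℚᵘ (+ 1) d} {mkℚᵘ (+ 1) 0} (ℚᵘ.*≡* eq))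
    where
    eq : (+ suc d ℤ.* + 1) ℤ.* + 1 ≡ + 1 ℤ.* + suc (d ℕ.+ 0 ℕ.* suc d)
    eq = trans (cong (ℤ._* + 1) (ℤ.*-identityʳ (+ suc d))) (trans (ℤ.*-identityʳ (+ suc d))
      (sym (trans (ℤ.*-identityˡ _) (cong (λ z → + suc z) (ℕ.+-identityʳ d)))))

  0≤recip : ∀ d → 0ℚ ≤ recip d
  0≤recip d = fromℚᵘ-mono-≤ {mkℚᵘ (+ 0) 0} {mkℚᵘ (+ 1) d} (ℚᵘ.*≤* (ℤ.+≤+ z≤n))

  *-monoʳ : ∀ {r p q} → 0ℚ ≤ r → p ≤ q → r * p ≤ r * q
  *-monoʳ {r} 0≤r p≤q = *-monoˡ-≤-nonNeg r {{nonNegative 0≤r}} p≤q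

  *-monoˡ : ∀ {r p q} → 0ℚ ≤ r → p ≤ q → p * r ≤ q * r
  *-monoˡ {r} 0≤r p≤q = *-monoʳ-≤-nonNeg r {{nonNegative 0≤r}} p≤q

  0≤* : ∀ {p q} → 0ℚ ≤ p → 0ℚ ≤ q → 0ℚ ≤ p * q
  0≤* {p} {q} 0≤p 0≤q = ≤-trans (≤-reflexive (sym (*-zeroʳ p))) (*-monoʳ 0≤p 0≤q)

  0≤+ : ∀ {p q} → 0ℚ ≤ p → 0ℚ ≤ q → 0ℚ ≤ p + q
  0≤+ 0≤p 0≤q = +-mono-≤ 0≤p 0≤q

  *-mono : ∀ {p q r s} → 0ℚ ≤ p → 0ℚ ≤ s → p ≤ q → r ≤ s → p * r ≤ q * s
  *-mono 0≤p 0≤s p≤q r≤s = ≤-trans (*-monoʳ 0≤p r≤s) (*-monoˡ 0≤s p≤q)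

  0≤1 : 0ℚ ≤ 1ℚ
  0≤1 = 0≤ℕtoℚ 1

  0≤expTerm : ∀ {x} → 0ℚ ≤ x → ∀ i → 0ℚ ≤ expTerm x i
  0≤expTerm 0≤x zero    = 0≤1
  0≤expTerm 0≤x (suc i) = 0≤* (0≤* (0≤expTerm 0≤x i) 0≤x) (0≤recip i)

  0≤expPartial : ∀ {x} → 0ℚ ≤ x → ∀ N → 0ℚ ≤ expPartial x N
  0≤expPartial 0≤x zero    = ≤-refl
  0≤expPartial 0≤x (suc N) = 0≤+ (0≤expPartial 0≤x N) (0≤expTerm 0≤x N)

  expTerm-mono : ∀ {x y} → 0ℚ ≤ x → x ≤ y → ∀ i → expTerm x i ≤ expTerm y i
  expTerm-mono 0≤x x≤y zero    = ≤-refl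
  expTerm-mono 0≤x x≤y (suc i) = *-monoˡ (0≤recip i)
    (*-mono (0≤expTerm 0≤x i) (≤-trans 0≤x x≤y) (expTerm-mono 0≤x x≤y i) x≤y)

  expPartial-mono : ∀ {x y} → 0ℚ ≤ x → x ≤ y → ∀ N → expPartial x N ≤ expPartial y N
  expPartial-mono 0≤x x≤y zero    = ≤-refl
  expPartial-mono 0≤x x≤y (suc N) = +-mono-≤ (expPartial-mono 0≤x x≤y N) (expTerm-mono 0≤x x≤y N)

  partialSum : (ℕ → ℚ) → ℕ → ℚ
  partialSum f zero    = 0ℚ
  partialSum f (suc N) = partialSum f N + f N

  -- Binomial terms (s choose i) z ^ i.
  module Binomial (z : ℚ) (0≤z : 0ℚ ≤ z) where

    U : ℕ → ℕ → ℚ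
    U s       zero    = 1ℚ
    U zero    (suc i) = 0ℚ
    U (suc s) (suc i) = U s (suc i) + z * U s i

    0≤U : ∀ s i → 0ℚ ≤ U s i
    0≤U zero    zero    = 0≤1
    0≤U (suc s) zero    = 0≤1
    0≤U zero    (suc i) = ≤-refl
    0≤U (suc s) (suc i) = 0≤+ (0≤U s (suc i)) (0≤* 0≤z (0≤U s i))

    -- (i + 1) (s choose i + 1) = (s - i) (s choose i), with s - i weakened to s. Iterated, this
    -- bounds `U s i` by (s z)^i / i!.
    U-ratio : ∀ s i → ℕtoℚ (suc i) * U s (suc i) ≤ ℕtoℚ s * z * U s i
    U-ratio zero i = ≤-reflexive (solve 3 (λ a z u → a :* con 0ℚ := con 0ℚ :* z :* u) refl (ℕtoℚ (suc i)) z (U zero i))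
    U-ratio (suc s) zero = begin
      1ℚ * (U s 1 + z * U s 0)       ≡⟨ solve 3 (λ a z u → con 1ℚ :* (a :+ z :* u) := con 1ℚ :* a :+ z :* u) refl (U s 1) z (U s 0) ⟩
      1ℚ * U s 1 + z * U s 0         ≤⟨ +-monoˡ-≤ (z * U s 0) (U-ratio s 0) ⟩
      ℕtoℚ s * z * U s 0 + z * U s 0 ≡⟨ cong (λ u → ℕtoℚ s * z * u + z * u) (U0 s) ⟩
      ℕtoℚ s * z * 1ℚ + z * 1ℚ       ≡⟨ solve 2 (λ s z → s :* z :* con 1ℚ :+ z :* con 1ℚ := (con 1ℚ :+ s) :* z :* con 1ℚ) refl (ℕtoℚ s) z ⟩
      (1ℚ + ℕtoℚ s) * z * 1ℚ         ≡⟨ cong (λ u → u * z * 1ℚ) (ℕtoℚ-+ 1 s) ⟨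
      ℕtoℚ (suc s) * z * 1ℚ          ∎
      where
      open ≤-Reasoning
      U0 : ∀ s → U s 0 ≡ 1ℚ
      U0 zero    = refl
      U0 (suc s) = refl
    U-ratio (suc s) (suc i) = begin
      ℕtoℚ (suc (suc i)) * (a + z * b)
        ≡⟨ cong (_* (a + z * b)) (ℕtoℚ-+ 1 (suc i)) ⟩
      (1ℚ + I) * (a + z * b)
        ≡⟨ solve 4 (λ I a z b → (con 1ℚ :+ I) :* (a :+ z :* b) := (con 1ℚ :+ I) :* a :+ (z :* b :+ z :* (I :* b))) refl I a z b ⟩
      (1ℚ + I) * a + (z * b + z * (I * b))
        ≡⟨ cong (λ u → u * a + (z * b + z * (I * b))) (ℕtoℚ-+ 1 (suc i)) ⟨
      ℕtoℚ (suc (suc i)) * a + (z * b + z * (I * b))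
        ≤⟨ +-mono-≤ (U-ratio s (suc i)) (+-monoʳ-≤ (z * b) (*-monoʳ 0≤z (U-ratio s i))) ⟩
      S * z * b + (z * b + z * (S * z * c))
        ≤⟨ +-monoʳ-≤ (S * z * b) (+-monoʳ-≤ (z * b) (*-monoʳ 0≤z
             (≤-trans (≤-reflexive (sym (+-identityˡ _))) (+-monoˡ-≤ (S * z * c) (0≤* 0≤z (0≤U s i)))))) ⟩
      S * z * b + (z * b + z * (z * c + S * z * c))
        ≡⟨ solve 4 (λ S z b c → S :* z :* b :+ (z :* b :+ z :* (z :* c :+ S :* z :* c)) := (con 1ℚ :+ S) :* z :* (b :+ z :* c)) refl S z b c ⟩
      (1ℚ + S) * z * (b + z * c)
        ≡⟨ cong (λ u → u * z * (b + z * c)) (ℕtoℚ-+ 1 s) ⟨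
      ℕtoℚ (suc s) * z * (b + z * c) ∎
      where
      open ≤-Reasoning
      I = ℕtoℚ (suc i)
      S = ℕtoℚ s
      a = U s (suc (suc i))
      b = U s (suc i)
      c = U s i

    U≤expTerm : ∀ s i → U s i ≤ expTerm (ℕtoℚ s * z) i
    U≤expTerm zero    zero = ≤-refl
    U≤expTerm (suc s) zero = ≤-refl
    U≤expTerm s (suc i) = begin
      U s (suc i)                                  ≡⟨ *-identityʳ (U s (suc i)) ⟨
      U s (suc i) * 1ℚ                             ≡⟨ cong (U s (suc i) *_) (recip-inverse i) ⟨
      U s (suc i) * (ℕtoℚ (suc i) * recip i)       ≡⟨ solve 3 (λ u a r → u :* (a :* r) := a :* u :* r) refl (U s (suc i)) (ℕtoℚ (suc i)) (recip i) ⟩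
      ℕtoℚ (suc i) * U s (suc i) * recip i         ≤⟨ *-monoˡ (0≤recip i) (U-ratio s i) ⟩
      ℕtoℚ s * z * U s i * recip i                 ≤⟨ *-monoˡ (0≤recip i) (*-monoʳ (0≤* (0≤ℕtoℚ s) 0≤z) (U≤expTerm s i)) ⟩
      ℕtoℚ s * z * expTerm (ℕtoℚ s * z) i * recip i ≡⟨ cong (_* recip i) (*-comm (ℕtoℚ s * z) _) ⟩
      expTerm (ℕtoℚ s * z) i * (ℕtoℚ s * z) * recip i ∎
      where open ≤-Reasoning

    power : ℕ → ℚ
    power zero    = 1ℚ
    power (suc s) = (1ℚ + z) * power s

    sum-suc : ∀ s N → partialSum (U (suc s)) (suc N) ≡ partialSum (U s) (suc N) + z * partialSum (U s) N
    sum-suc zero    zero = solve 1 (λ z → con 0ℚ :+ con 1ℚ := con 0ℚ :+ con 1ℚ :+ z :* con 0ℚ) refl z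
    sum-suc (suc s) zero = solve 1 (λ z → con 0ℚ :+ con 1ℚ := con 0ℚ :+ con 1ℚ :+ z :* con 0ℚ) refl z
    sum-suc s (suc N) = trans (cong (_+ U (suc s) (suc N)) (sum-suc s N))
      (solve 5 (λ p z q u v → p :+ z :* q :+ (u :+ z :* v) := p :+ u :+ z :* (q :+ v)) refl
        (partialSum (U s) (suc N)) z (partialSum (U s) N) (U s (suc N)) (U s N))

    power≤sum : ∀ s N → s ℕ.< N → power s ≤ partialSum (U s) N
    power≤sum zero (suc N) _ = go N
      where
      go : ∀ N → 1ℚ ≤ partialSum (U zero) (suc N)
      go zero    = ≤-reflexive (sym (+-identityˡ 1ℚ))
      go (suc N) = ≤-trans (go N) (≤-reflexive (sym (+-identityʳ _)))
    power≤sum (suc s) (suc N) (s≤s s<N) = begin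
      (1ℚ + z) * power s           ≡⟨ solve 2 (λ z p → (con 1ℚ :+ z) :* p := p :+ z :* p) refl z (power s) ⟩
      power s + z * power s        ≤⟨ +-mono-≤ (power≤sum s (suc N) (ℕ.m≤n⇒m≤1+n s<N)) (*-monoʳ 0≤z (power≤sum s N s<N)) ⟩
      partialSum (U s) (suc N) + z * partialSum (U s) N ≡⟨ sum-suc s N ⟨
      partialSum (U (suc s)) (suc N) ∎
      where open ≤-Reasoning

    power≤exp : ∀ s → power s ≤ expPartial (ℕtoℚ s * z) (suc s)
    power≤exp s = ≤-trans (power≤sum s (suc s) ℕ.≤-refl) (compare (suc s))
      where
      compare : ∀ N → partialSum (U s) N ≤ expPartial (ℕtoℚ s * z) N
      compare zero    = ≤-refl
      compare (suc N) = +-mono-≤ (compare N) (U≤expTerm s N)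

  power-recip : ∀ t′ s → let open Binomial (recip t′) (0≤recip t′) in
    ℕtoℚ (suc (suc t′) ℕ.^ s) ≡ ℕtoℚ (suc t′ ℕ.^ s) * power s
  power-recip t′ zero    = refl
  power-recip t′ (suc s) = begin
    ℕtoℚ (suc (suc t′) ℕ.* suc (suc t′) ℕ.^ s)  ≡⟨ ℕtoℚ-* (suc (suc t′)) (suc (suc t′) ℕ.^ s) ⟩
    ℕtoℚ (suc (suc t′)) * ℕtoℚ (suc (suc t′) ℕ.^ s) ≡⟨ cong₂ _*_ (ℕtoℚ-+ 1 (suc t′)) (power-recip t′ s) ⟩
    (1ℚ + T) * (Y * power s)                    ≡⟨ cong (λ u → (u + T) * (Y * power s)) (recip-inverse t′) ⟨
    (T * z + T) * (Y * power s)                 ≡⟨ solve 4 (λ T z Y p → (T :* z :+ T) :* (Y :* p) := T :* Y :* ((con 1ℚ :+ z) :* p)) refl T z Y (power s) ⟩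
    T * Y * ((1ℚ + z) * power s)                ≡⟨ cong (_* ((1ℚ + z) * power s)) (ℕtoℚ-* (suc t′) (suc t′ ℕ.^ s)) ⟨
    ℕtoℚ (suc t′ ℕ.* suc t′ ℕ.^ s) * ((1ℚ + z) * power s) ∎
    where
    open ≡-Reasoning
    z = recip t′
    open Binomial z (0≤recip t′)
    T = ℕtoℚ (suc t′)
    Y = ℕtoℚ (suc t′ ℕ.^ s)

  -- The hypothesis e ^ (Δ / ((1 - ε) k)) ≤ k, through (1 + 1/t) ^ s ≤ e ^ (s/t).
  DeltaBound⇒ : ∀ {ε k Δ} p′ → recip p′ ≤ ε → DeltaBound ε k Δ →
    ∀ s t′ → s ℕ.* (p′ ℕ.* k) ℕ.≤ suc p′ ℕ.* (Δ ℕ.* suc t′) → suc (suc t′) ℕ.^ s ℕ.≤ k ℕ.* suc t′ ℕ.^ s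
  DeltaBound⇒ {ε} {k} {Δ} p′ w≤ε bound s t′ h = ℕtoℚ-cancel (begin
    ℕtoℚ (suc (suc t′) ℕ.^ s)                 ≡⟨ power-recip t′ s ⟩
    ℕtoℚ (suc t′ ℕ.^ s) * power s             ≤⟨ *-monoʳ (0≤ℕtoℚ (suc t′ ℕ.^ s)) (≤-trans (power≤exp s) (bound y 0≤y y-small (suc s))) ⟩
    ℕtoℚ (suc t′ ℕ.^ s) * ℕtoℚ k              ≡⟨ *-comm (ℕtoℚ (suc t′ ℕ.^ s)) (ℕtoℚ k) ⟩
    ℕtoℚ k * ℕtoℚ (suc t′ ℕ.^ s)              ≡⟨ ℕtoℚ-* k (suc t′ ℕ.^ s) ⟨
    ℕtoℚ (k ℕ.* suc t′ ℕ.^ s)                 ∎)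
    where
    open ≤-Reasoning
    z = recip t′
    open Binomial z (0≤recip t′)
    w = recip p′
    y = ℕtoℚ s * z
    0≤y : 0ℚ ≤ y
    0≤y = 0≤* (0≤ℕtoℚ s) (0≤recip t′)
    P′ = ℕtoℚ p′
    1-ε≤ : 1ℚ - ε ≤ P′ * w
    1-ε≤ = begin
      1ℚ - ε                     ≤⟨ +-monoʳ-≤ 1ℚ (neg-antimono-≤ w≤ε) ⟩
      1ℚ - w                     ≡⟨ cong (_- w) (recip-inverse p′) ⟨
      ℕtoℚ (suc p′) * w - w      ≡⟨ cong (λ u → u * w - w) (ℕtoℚ-+ 1 p′) ⟩
      (1ℚ + P′) * w - w          ≡⟨ solve 2 (λ P w → (con 1ℚ :+ P) :* w :- w := P :* w) refl P′ w ⟩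
      P′ * w                     ∎
    h′ : ℕtoℚ s * (P′ * ℕtoℚ k) ≤ ℕtoℚ (suc p′) * (ℕtoℚ Δ * ℕtoℚ (suc t′))
    h′ = subst₂ _≤_ (trans (ℕtoℚ-* s (p′ ℕ.* k)) (cong (ℕtoℚ s *_) (ℕtoℚ-* p′ k)))
      (trans (ℕtoℚ-* (suc p′) (Δ ℕ.* suc t′)) (cong (ℕtoℚ (suc p′) *_) (ℕtoℚ-* Δ (suc t′)))) (ℕtoℚ-mono h)
    y-small : y * ((1ℚ - ε) * ℕtoℚ k) ≤ ℕtoℚ Δ
    y-small = begin
      y * ((1ℚ - ε) * ℕtoℚ k)             ≤⟨ *-monoʳ 0≤y (*-monoˡ (0≤ℕtoℚ k) 1-ε≤) ⟩
      ℕtoℚ s * z * (P′ * w * ℕtoℚ k)      ≡⟨ solve 5 (λ s z P w k → s :* z :* (P :* w :* k) := z :* w :* (s :* (P :* k))) refl (ℕtoℚ s) z P′ w (ℕtoℚ k) ⟩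
      z * w * (ℕtoℚ s * (P′ * ℕtoℚ k))    ≤⟨ *-monoʳ (0≤* (0≤recip t′) (0≤recip p′)) h′ ⟩
      z * w * (ℕtoℚ (suc p′) * (ℕtoℚ Δ * ℕtoℚ (suc t′)))
        ≡⟨ solve 5 (λ z w p d t → z :* w :* (p :* (d :* t)) := p :* w :* (t :* z) :* d) refl z w (ℕtoℚ (suc p′)) (ℕtoℚ Δ) (ℕtoℚ (suc t′)) ⟩
      ℕtoℚ (suc p′) * w * (ℕtoℚ (suc t′) * z) * ℕtoℚ Δ ≡⟨ cong₂ (λ a b → a * b * ℕtoℚ Δ) (recip-inverse p′) (recip-inverse t′) ⟩
      1ℚ * 1ℚ * ℕtoℚ Δ                    ≡⟨ *-identityˡ (ℕtoℚ Δ) ⟩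
      ℕtoℚ Δ                              ∎

  -- A positive ε has numerator at least 1, so enlarging its denominator by one suffices. Only this
  -- reciprocal is used later, which keeps all other constants integral. The `suc` makes its
  -- denominator at least 2, so that p² - 1 will be positive.
  recip≤ : ∀ ε → 0ℚ < ε → ∃[ p ] recip (suc p) ≤ ε
  recip≤ ε@(mkℚ (+ suc a) d _) _ = d , subst (recip (suc d) ≤_) (fromℚᵘ-toℚᵘ ε)
    (fromℚᵘ-mono-≤ {mkℚᵘ (+ 1) (suc d)} {mkℚᵘ (+ suc a) d} (ℚᵘ.*≤* (subst₂ ℤ._≤_ (ℤ.pos-* 1 (suc d)) (ℤ.pos-* (suc a) (suc (suc d)))
      (ℤ.+≤+ (ℕ.*-mono-≤ {1} {suc a} (s≤s z≤n) (ℕ.n≤1+n (suc d)))))))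
  recip≤ (mkℚ (+ 0) d _) (*<* (ℤ.+<+ ()))
  recip≤ (mkℚ -[1+ a ] d _) (*<* ())

  -- Terms of the expansion of (1 - 1/2) ^ (- m) = 2 ^ m, which dominate those of e ^ (m/2).
  T : ℕ → ℕ → ℚ
  T m       zero    = 1ℚ
  T zero    (suc i) = 0ℚ
  T (suc m) (suc i) = ½ * T (suc m) i + T m (suc i)

  0≤½ : 0ℚ ≤ ½
  0≤½ = 0≤recip 1

  0≤T : ∀ m i → 0ℚ ≤ T m i
  0≤T zero    zero    = 0≤1
  0≤T (suc m) zero    = 0≤1
  0≤T zero    (suc i) = ≤-refl
  0≤T (suc m) (suc i) = 0≤+ (0≤* 0≤½ (0≤T (suc m) i)) (0≤T m (suc i))

  -- `T m i` is (m + i - 1 choose i) / 2^i, so consecutive terms have ratio (m + i) / (2 (i + 1)).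
  T-ratio : ∀ m i → ℕtoℚ (suc i) * T m (suc i) ≡ ½ * (ℕtoℚ (m ℕ.+ i) * T m i)
  T-ratio zero zero    = refl
  T-ratio zero (suc i) = solve 2 (λ a b → a :* con 0ℚ := con ½ :* (b :* con 0ℚ)) refl (ℕtoℚ (suc (suc i))) (ℕtoℚ (suc i))
  T-ratio (suc m) zero = begin
    1ℚ * (½ * 1ℚ + T m 1)                  ≡⟨ solve 1 (λ t → con 1ℚ :* (con ½ :* con 1ℚ :+ t) := con ½ :+ con 1ℚ :* t) refl (T m 1) ⟩
    ½ + 1ℚ * T m 1                         ≡⟨ cong (λ u → ½ + u) (T-ratio m 0) ⟩
    ½ + ½ * (ℕtoℚ (m ℕ.+ 0) * T m 0)       ≡⟨ cong (λ u → ½ + ½ * (ℕtoℚ (m ℕ.+ 0) * u)) (T0 m) ⟩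
    ½ + ½ * (ℕtoℚ (m ℕ.+ 0) * 1ℚ)          ≡⟨ solve 1 (λ a → con ½ :+ con ½ :* (a :* con 1ℚ) := con ½ :* ((con 1ℚ :+ a) :* con 1ℚ)) refl (ℕtoℚ (m ℕ.+ 0)) ⟩
    ½ * ((1ℚ + ℕtoℚ (m ℕ.+ 0)) * 1ℚ)       ≡⟨ cong (λ u → ½ * (u * 1ℚ)) (ℕtoℚ-+ 1 (m ℕ.+ 0)) ⟨
    ½ * (ℕtoℚ (suc m ℕ.+ 0) * 1ℚ)          ∎
    where
    open ≡-Reasoning
    T0 : ∀ m → T m 0 ≡ 1ℚ
    T0 zero    = refl
    T0 (suc m) = refl
  T-ratio (suc m) (suc i) = begin
    ℕtoℚ (suc (suc i)) * (½ * b + c)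
      ≡⟨ *-distribˡ-+ (ℕtoℚ (suc (suc i))) (½ * b) c ⟩
    ℕtoℚ (suc (suc i)) * (½ * b) + ℕtoℚ (suc (suc i)) * c
      ≡⟨ cong₂ (λ u v → u * (½ * b) + v) (ℕtoℚ-+ 1 (suc i)) (T-ratio m (suc i)) ⟩
    (1ℚ + I) * (½ * b) + ½ * (ℕtoℚ (m ℕ.+ suc i) * e)
      ≡⟨ cong (λ u → (1ℚ + I) * (½ * b) + ½ * (ℕtoℚ u * e)) (ℕ.+-suc m i) ⟩
    (1ℚ + I) * (½ * b) + ½ * (Q * e)
      ≡⟨ solve 4 (λ I b Q e → (con 1ℚ :+ I) :* (con ½ :* b) :+ con ½ :* (Q :* e) := con ½ :* (I :* b) :+ con ½ :* b :+ con ½ :* (Q :* e)) refl I b Q e ⟩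
    ½ * (I * b) + ½ * b + ½ * (Q * e)
      ≡⟨ cong (λ u → ½ * u + ½ * b + ½ * (Q * e)) (T-ratio (suc m) i) ⟩
    ½ * (½ * (Q * f)) + ½ * b + ½ * (Q * e)
      ≡⟨ solve 4 (λ Q f b e → con ½ :* (con ½ :* (Q :* f)) :+ con ½ :* b :+ con ½ :* (Q :* e) := con ½ :* (Q :* (con ½ :* f :+ e) :+ b)) refl Q f b e ⟩
    ½ * (Q * b + b)
      ≡⟨ solve 2 (λ Q b → con ½ :* (Q :* b :+ b) := con ½ :* ((con 1ℚ :+ Q) :* b)) refl Q b ⟩
    ½ * ((1ℚ + Q) * b)
      ≡⟨ cong (λ u → ½ * (u * b)) (trans (cong (λ v → ℕtoℚ (suc v)) (ℕ.+-suc m i)) (ℕtoℚ-+ 1 (suc m ℕ.+ i))) ⟨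
    ½ * (ℕtoℚ (suc m ℕ.+ suc i) * b) ∎
    where
    open ≡-Reasoning
    I = ℕtoℚ (suc i)
    Q = ℕtoℚ (suc m ℕ.+ i)
    b = T (suc m) (suc i)
    c = T m (suc (suc i))
    e = T m (suc i)
    f = T (suc m) i

  -- For m = 2 x the ratio of consecutive terms of `T` is at least x / (i + 1), which is the ratio
  -- for e^x.
  expTerm≤T : ∀ x i → expTerm (ℕtoℚ x) i ≤ T (2 ℕ.* x) i
  expTerm≤T zero    zero = ≤-refl
  expTerm≤T (suc x) zero = ≤-refl
  expTerm≤T x (suc i) = begin
    expTerm X i * X * recip i                        ≤⟨ *-monoˡ (0≤recip i) (*-monoˡ (0≤ℕtoℚ x) (expTerm≤T x i)) ⟩
    t * X * recip i                                  ≡⟨ cong (λ u → u * recip i) (halve t) ⟩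
    ½ * (ℕtoℚ (2 ℕ.* x) * t) * recip i               ≤⟨ *-monoˡ (0≤recip i) (*-monoʳ 0≤½ (*-monoˡ (0≤T (2 ℕ.* x) i) (ℕtoℚ-mono (ℕ.m≤m+n (2 ℕ.* x) i)))) ⟩
    ½ * (ℕtoℚ (2 ℕ.* x ℕ.+ i) * t) * recip i         ≡⟨ cong (_* recip i) (T-ratio (2 ℕ.* x) i) ⟨
    ℕtoℚ (suc i) * t′ * recip i                      ≡⟨ solve 3 (λ a t r → a :* t :* r := t :* (a :* r)) refl (ℕtoℚ (suc i)) t′ (recip i) ⟩
    t′ * (ℕtoℚ (suc i) * recip i)                    ≡⟨ cong (t′ *_) (recip-inverse i) ⟩
    t′ * 1ℚ                                          ≡⟨ *-identityʳ t′ ⟩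
    t′                                               ∎
    where
    open ≤-Reasoning
    X = ℕtoℚ x
    t = T (2 ℕ.* x) i
    t′ = T (2 ℕ.* x) (suc i)
    halve : ∀ t → t * X ≡ ½ * (ℕtoℚ (2 ℕ.* x) * t)
    halve t = trans (solve 2 (λ t x → t :* x := con ½ :* (con (ℕtoℚ 2) :* x :* t)) refl t X)
      (cong (λ u → ½ * (u * t)) (sym (ℕtoℚ-* 2 x)))

  sum-T-suc : ∀ m N → partialSum (T (suc m)) (suc N) ≡ ½ * partialSum (T (suc m)) N + partialSum (T m) (suc N)
  sum-T-suc zero    zero    = refl
  sum-T-suc (suc m) zero    = refl
  sum-T-suc m (suc N) = trans (cong (_+ T (suc m) (suc N)) (sum-T-suc m N))
    (solve 4 (λ p q u v → con ½ :* p :+ q :+ (con ½ :* u :+ v) := con ½ :* (p :+ u) :+ (q :+ v)) refl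
      (partialSum (T (suc m)) N) (partialSum (T m) (suc N)) (T (suc m) N) (T m (suc N)))

  -- An infinite sum would satisfy S(m + 1) = S(m + 1)/2 + S(m), hence S(m + 1) = 2 S(m). For
  -- partial sums the first summand on the right is one term shorter, and induction on both
  -- arguments applies.
  sum-T≤ : ∀ m N → partialSum (T m) N ≤ ℕtoℚ (2 ℕ.^ m)
  sum-T≤ m zero = 0≤ℕtoℚ (2 ℕ.^ m)
  sum-T≤ zero (suc N) = go N
    where
    go : ∀ N → partialSum (T zero) (suc N) ≤ 1ℚ
    go zero    = ≤-reflexive (+-identityˡ 1ℚ)
    go (suc N) = ≤-trans (≤-reflexive (+-identityʳ _)) (go N)
  sum-T≤ (suc m) (suc N) = begin
    partialSum (T (suc m)) (suc N)                             ≡⟨ sum-T-suc m N ⟩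
    ½ * partialSum (T (suc m)) N + partialSum (T m) (suc N)    ≤⟨ +-mono-≤ (*-monoʳ 0≤½ (sum-T≤ (suc m) N)) (sum-T≤ m (suc N)) ⟩
    ½ * ℕtoℚ (2 ℕ.* 2 ℕ.^ m) + ℕtoℚ (2 ℕ.^ m)                  ≡⟨ cong (λ u → ½ * u + ℕtoℚ (2 ℕ.^ m)) (ℕtoℚ-* 2 (2 ℕ.^ m)) ⟩
    ½ * (ℕtoℚ 2 * ℕtoℚ (2 ℕ.^ m)) + ℕtoℚ (2 ℕ.^ m)             ≡⟨ solve 1 (λ x → con ½ :* (con (ℕtoℚ 2) :* x) :+ x := con (ℕtoℚ 2) :* x) refl (ℕtoℚ (2 ℕ.^ m)) ⟩
    ℕtoℚ 2 * ℕtoℚ (2 ℕ.^ m)                                    ≡⟨ ℕtoℚ-* 2 (2 ℕ.^ m) ⟨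
    ℕtoℚ (2 ℕ.^ suc m)                                         ∎
    where open ≤-Reasoning

  expPartial≤4^ : ∀ x N → expPartial (ℕtoℚ x) N ≤ ℕtoℚ (4 ℕ.^ x)
  expPartial≤4^ x N = ≤-trans (compare N) (≤-trans (sum-T≤ (2 ℕ.* x) N) (≤-reflexive (cong ℕtoℚ (sym (ℕ.^-*-assoc 2 2 x)))))
    where
    compare : ∀ N → expPartial (ℕtoℚ x) N ≤ partialSum (T (2 ℕ.* x)) N
    compare zero    = ≤-refl
    compare (suc N) = +-mono-≤ (compare N) (expTerm≤T x N)

  LnLnLe⇒ : ∀ {n l} → LnLnLe n l → n ℕ.≤ suc (4 ℕ.^ (4 ℕ.^ l))
  -- At `j = 0` the slack is 1, whence the additive 1. Then e^x ≤ 4^x is applied at x = l and, after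
  -- monotonicity has replaced the inner partial sum, at x = 4^l.
  LnLnLe⇒ {n} {l} h with h 0
  ... | N , M , lt = ℕtoℚ-cancel (begin
    ℕtoℚ n                                       ≡⟨ solve 1 (λ x → x := con 1ℚ :+ (x :- con 1ℚ)) refl (ℕtoℚ n) ⟩
    1ℚ + (ℕtoℚ n - 1ℚ)                           ≤⟨ +-monoʳ-≤ 1ℚ (<⇒≤ lt) ⟩
    1ℚ + expPartial (expPartial (ℕtoℚ l) N) M    ≤⟨ +-monoʳ-≤ 1ℚ (expPartial-mono (0≤expPartial (0≤ℕtoℚ l) N) (expPartial≤4^ l N) M) ⟩
    1ℚ + expPartial (ℕtoℚ (4 ℕ.^ l)) M           ≤⟨ +-monoʳ-≤ 1ℚ (expPartial≤4^ (4 ℕ.^ l) M) ⟩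
    1ℚ + ℕtoℚ (4 ℕ.^ (4 ℕ.^ l))                  ≡⟨ ℕtoℚ-+ 1 (4 ℕ.^ (4 ℕ.^ l)) ⟨
    ℕtoℚ (suc (4 ℕ.^ (4 ℕ.^ l)))                 ∎)
    where open ≤-Reasoning

open import Data.Bool using (Bool; true; false; if_then_else_; _∧_; not) renaming (_≟_ to _≟ᵇ_)
open import Data.Bool.ListAction using (and)
open import Data.Fin using (Fin; zero; suc) renaming (_≟_ to _≟ᶠ_)
open import Data.Fin.Properties using (all?; any?; injective⇒≤)
open import Data.List as List using (List; []; _∷_; _++_; [_]; length; map; allFin; concatMap; filter; filterᵇ; cartesianProductWith)
open import Data.List.Membership.Propositional using (_∈_; _∉_; find; lose)
open import Data.List.Membership.Propositional.Properties
open import Data.List.Properties using (++-identityʳ; length-++; length-filter; length-map; length-tabulate; map-++; map-cong; map-tabulate; map-∘)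
open import Data.List.Relation.Unary.All as All using (All; []; _∷_)
import Data.List.Relation.Unary.All.Properties as All
open import Data.List.Relation.Unary.AllPairs as AllPairs using (AllPairs; []; _∷_)
import Data.List.Relation.Unary.AllPairs.Properties as AllPairs
open import Data.List.Relation.Unary.Any as Any using (Any; here; there)
import Data.List.Relation.Unary.Any.Properties as Any
open import Data.List.Relation.Unary.Linked using (Linked; [-]; _∷_)
open import Data.List.Relation.Unary.Unique.Propositional using (Unique)
import Data.List.Relation.Unary.Unique.Propositional.Properties as Unique
open import Data.Nat
open import Data.Nat.DivMod using (m/n*n≤m; m≡m%n+[m/n]*n; m%n<n; /-monoˡ-≤; m*n/n≡m)
open import Data.Nat.ListAction using (sum; product)
open import Data.Nat.ListAction.Properties using (sum-++)
open import Data.Nat.Logarithm using (⌊log₂_⌋; ⌊log₂⌋-mono-≤; ⌊log₂[2^n]⌋≡n)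
open import Data.Nat.Properties
open import Data.Nat.Tactic.RingSolver using (solve-∀)
open import Data.Product using (Σ; ∃; ∃₂; _×_; _,_; proj₁; proj₂; ∃-syntax; Σ-syntax)
open import Data.Rational as ℚ using (ℚ; 0ℚ; 1ℚ)
open import Data.Sum using (inj₁; inj₂; [_,_]′)
open import Data.Vec as Vec using ([]; _∷_; lookup; _[_]≔_)
open import Data.Vec.Properties using (lookup∘updateAt; lookup∘updateAt′; ∷-injective; []≔-lookup)
open import Function using (_∘_)
open import Relation.Binary.Construct.Closure.ReflexiveTransitive using (_◅_; _◅◅_) renaming (ε to done)
open import Relation.Binary.PropositionalEquality hiding ([_])
open import Relation.Nullary using (Dec; yes; no; does; ¬_; contradiction)
open import Relation.Nullary.Decidable using (_×-dec_; ¬?; _→-dec_)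
open Exponential using (recip; recip≤; DeltaBound⇒; LnLnLe⇒)

-- Inequalities between powers

^-distribʳ-* : ∀ a b n → (a * b) ^ n ≡ a ^ n * b ^ n
^-distribʳ-* a b zero    = refl
^-distribʳ-* a b (suc n) = trans (cong (a * b *_) (^-distribʳ-* a b n)) (eq a b (a ^ n) (b ^ n))
  where
  eq : ∀ a b x y → a * b * (x * y) ≡ a * x * (b * y)
  eq = solve-∀

^-cancelʳ-≤ : ∀ n .{{_ : NonZero n}} {a b} → a ^ n ≤ b ^ n → a ≤ b
^-cancelʳ-≤ n {a} {b} h with <-≤-connex b a
... | inj₁ b<a = contradiction (^-monoˡ-< n b<a) (≤⇒≯ h)
... | inj₂ a≤b = a≤b

2ab≤a²+b² : ∀ a b → 2 * (a * b) ≤ a * a + b * b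
2ab≤a²+b² a b with ≤-total a b
... | inj₁ a≤b with m≤n⇒∃[o]m+o≡n a≤b
...   | d , refl = ≤-trans (m≤m+n _ (d * d)) (≤-reflexive (sym (eq a d)))
  where
  eq : ∀ a d → a * a + (a + d) * (a + d) ≡ 2 * (a * (a + d)) + d * d
  eq = solve-∀
2ab≤a²+b² a b | inj₂ b≤a with m≤n⇒∃[o]m+o≡n b≤a
... | d , refl = ≤-trans (m≤m+n _ (d * d)) (≤-reflexive (sym (eq b d)))
  where
  eq : ∀ b d → (b + d) * (b + d) + b * b ≡ 2 * ((b + d) * b) + d * d
  eq = solve-∀

-- `y ^ suc m` lies above its tangent at `A`; the negative term of the tangent stands on the right
-- to stay in ℕ. Each step of the induction adds a multiple of 2 A y ≤ A² + y².
bernoulli : ∀ m A y → suc m * (A ^ m * y) ≤ y ^ suc m + m * A ^ suc m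
bernoulli zero A y = ≤-reflexive (eq y)
  where
  eq : ∀ y → 1 * (1 * y) ≡ y * 1 + 0
  eq = solve-∀
bernoulli (suc m) A y = +-cancelʳ-≤ (m * (A * a * y)) _ _ (begin
  suc (suc m) * (A * a * y) + m * (A * a * y)        ≡⟨ e₁ m A a y ⟩
  suc m * a * (2 * (A * y))                          ≤⟨ *-monoʳ-≤ (suc m * a) (2ab≤a²+b² A y) ⟩
  suc m * a * (A * A + y * y)                        ≡⟨ e₂ m A a y ⟩
  y * (suc m * (a * y)) + suc m * (A * (A * a))      ≤⟨ +-monoˡ-≤ _ (*-monoʳ-≤ y (bernoulli m A y)) ⟩
  y * (y * b + m * (A * a)) + suc m * (A * (A * a))  ≡⟨ e₃ m A a y b ⟩
  y * (y * b) + suc m * (A * (A * a)) + m * (A * a * y) ∎)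
  where
  open ≤-Reasoning
  a = A ^ m
  b = y ^ m
  e₁ : ∀ m A a y → suc (suc m) * (A * a * y) + m * (A * a * y) ≡ suc m * a * (2 * (A * y))
  e₁ = solve-∀
  e₂ : ∀ m A a y → suc m * a * (A * A + y * y) ≡ y * (suc m * (a * y)) + suc m * (A * (A * a))
  e₂ = solve-∀
  e₃ : ∀ m A a y b → y * (y * b + m * (A * a)) + suc m * (A * (A * a)) ≡ y * (y * b) + suc m * (A * (A * a)) + m * (A * a * y)
  e₃ = solve-∀

-- AM-GM for K copies of S / K and one x. It is the tangent inequality between the old mean S / K
-- and the new mean (S + x) / (K + 1), both multiplied by K (K + 1).
amgm-step : ∀ K S x → suc K ^ suc K * (S ^ K * x) ≤ K ^ K * (S + x) ^ suc K
amgm-step zero S x = ≤-trans (m≤n+m _ S) (≤-reflexive (eq S x))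
  where
  eq : ∀ S x → S + 1 * (1 * x) ≡ 1 * ((S + x) * 1)
  eq = solve-∀
amgm-step K@(suc K′) S x = *-cancelˡ-≤ K (+-cancelʳ-≤ (K * A ^ suc K) _ _ (begin
  K * (suc K ^ suc K * (S ^ K * x)) + K * A ^ suc K   ≡⟨ cong (λ z → K * (suc K ^ suc K * (S ^ K * x)) + K * (A * z)) A^K ⟩
  K * (suc K * c * (s * x)) + K * (S * suc K * (s * c)) ≡⟨ e₁ K S x c s ⟩
  suc K * (s * c * (K * (S + x)))                     ≡⟨ cong (λ z → suc K * (z * (K * (S + x)))) A^K ⟨
  suc K * (A ^ K * y)                                 ≤⟨ bernoulli K A y ⟩
  y ^ suc K + K * A ^ suc K                           ≡⟨ cong (_+ K * A ^ suc K) (^-distribʳ-* K (S + x) (suc K)) ⟩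
  K * K ^ K * (S + x) ^ suc K + K * A ^ suc K         ≡⟨ cong (_+ K * A ^ suc K) (*-assoc K (K ^ K) _) ⟩
  K * (K ^ K * (S + x) ^ suc K) + K * A ^ suc K       ∎))
  where
  open ≤-Reasoning
  A = S * suc K
  y = K * (S + x)
  c = suc K ^ K
  s = S ^ K
  A^K : A ^ K ≡ s * c
  A^K = ^-distribʳ-* S (suc K) K
  e₁ : ∀ K S x c s → K * (suc K * c * (s * x)) + K * (S * suc K * (s * c)) ≡ suc K * (s * c * (K * (S + x)))
  e₁ = solve-∀

amgm : ∀ xs → length xs ^ length xs * product xs ≤ sum xs ^ length xs
amgm [] = ≤-refl
amgm (x ∷ xs) with length xs in eq | amgm xs
... | zero | _ with xs | eq
...   | [] | _ = ≤-reflexive (e x)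
  where
  e : ∀ x → 1 * (x * 1) ≡ (x + 0) * 1
  e = solve-∀
amgm (x ∷ xs) | K@(suc _) | ih = *-cancelˡ-≤ (K ^ K) {{m^n≢0 K K}} (begin
  K ^ K * (suc K ^ suc K * (x * product xs)) ≡⟨ e₁ (K ^ K) (suc K ^ suc K) x (product xs) ⟩
  suc K ^ suc K * (K ^ K * product xs * x)   ≤⟨ *-monoʳ-≤ (suc K ^ suc K) (*-monoˡ-≤ x ih) ⟩
  suc K ^ suc K * (sum xs ^ K * x)           ≤⟨ amgm-step K (sum xs) x ⟩
  K ^ K * (sum xs + x) ^ suc K               ≡⟨ cong (λ z → K ^ K * z ^ suc K) (+-comm (sum xs) x) ⟩
  K ^ K * (x + sum xs) ^ suc K               ∎)
  where
  open ≤-Reasoning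
  e₁ : ∀ k c x p → k * (c * (x * p)) ≡ c * (k * p * x)
  e₁ = solve-∀

-- (1 - 1/l)^l increases with l.
ratio-step : ∀ l′ → let l = suc l′ in l′ ^ l * suc l ^ suc l ≤ l ^ l * l ^ suc l
ratio-step l′ = *-cancelˡ-≤ l (*-cancelˡ-≤ (l ^ l) {{m^n≢0 l l}} (begin
  l ^ l * (l * (l′ ^ l * suc l ^ suc l))    ≡⟨ e₁ (l ^ l) l (l′ ^ l) (suc l ^ suc l) ⟩
  suc l ^ suc l * (l ^ l * l′ ^ l * l)      ≡⟨ cong (λ z → suc l ^ suc l * (z * l)) (^-distribʳ-* l l′ l) ⟨
  -- AM-GM for l copies of l - 1 and one l, whose sum is l * l.
  suc l ^ suc l * ((l * l′) ^ l * l)        ≤⟨ amgm-step l (l * l′) l ⟩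
  l ^ l * (l * l′ + l) ^ suc l              ≡⟨ cong (λ z → l ^ l * z ^ suc l) (e₂ l′) ⟩
  l ^ l * (l * l) ^ suc l                   ≡⟨ cong (l ^ l *_) (^-distribʳ-* l l (suc l)) ⟩
  l ^ l * (l * l ^ l * (l * l ^ l))         ≡⟨ cong (l ^ l *_) (*-assoc l (l ^ l) _) ⟩
  l ^ l * (l * (l ^ l * l ^ suc l))         ∎))
  where
  open ≤-Reasoning
  l = suc l′
  e₁ : ∀ a l b c → a * (l * (b * c)) ≡ c * (a * b * l)
  e₁ = solve-∀
  e₂ : ∀ l′ → suc l′ * l′ + suc l′ ≡ suc l′ * suc l′
  e₂ = solve-∀

ratio-mono : ∀ {t′ l′} → t′ ≤ l′ → t′ ^ suc t′ * suc l′ ^ suc l′ ≤ l′ ^ suc l′ * suc t′ ^ suc t′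
ratio-mono {t′} t′≤l′ = go (≤⇒≤′ t′≤l′)
  where
  open ≤-Reasoning
  e₁ : ∀ a b c → a * (b * c) ≡ b * a * c
  e₁ = solve-∀
  e₂ : ∀ a b c → a * b * c ≡ a * c * b
  e₂ = solve-∀
  go : ∀ {l′} → t′ ≤′ l′ → t′ ^ suc t′ * suc l′ ^ suc l′ ≤ l′ ^ suc l′ * suc t′ ^ suc t′
  go ≤′-refl = ≤-refl
  go (≤′-step {l′} h) = *-cancelˡ-≤ (l ^ l) {{m^n≢0 l l}} (begin
    l ^ l * (t′ ^ suc t′ * suc l ^ suc l)      ≡⟨ e₁ (l ^ l) (t′ ^ suc t′) _ ⟩
    t′ ^ suc t′ * l ^ l * suc l ^ suc l        ≤⟨ *-monoˡ-≤ _ (go h) ⟩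
    l′ ^ l * suc t′ ^ suc t′ * suc l ^ suc l   ≡⟨ e₂ (l′ ^ l) (suc t′ ^ suc t′) _ ⟩
    l′ ^ l * suc l ^ suc l * suc t′ ^ suc t′   ≤⟨ *-monoˡ-≤ _ (ratio-step l′) ⟩
    l ^ l * l ^ suc l * suc t′ ^ suc t′        ≡⟨ *-assoc (l ^ l) _ _ ⟩
    l ^ l * (l ^ suc l * suc t′ ^ suc t′)      ∎)
    where
    l = suc l′

-- The increasing sequence (1 - 1/j)^j has the value 1/4 at j = 2, and is taken here at j = l + 2.
[1+1/l]^[1+l]≤4 : ∀ l → suc (suc l) ^ suc (suc l) ≤ 4 * suc l ^ suc (suc l)
[1+1/l]^[1+l]≤4 l = begin
  suc (suc l) ^ suc (suc l)       ≡⟨ *-identityˡ _ ⟨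
  1 * suc (suc l) ^ suc (suc l)   ≤⟨ ratio-mono {1} {suc l} (s≤s z≤n) ⟩
  suc l ^ suc (suc l) * 4         ≡⟨ *-comm (suc l ^ suc (suc l)) 4 ⟩
  4 * suc l ^ suc (suc l)         ∎
  where open ≤-Reasoning

2l^l≤[1+l]^l : ∀ l → 2 * suc l ^ suc l ≤ suc (suc l) ^ suc l
2l^l≤[1+l]^l l = *-cancelˡ-≤ (suc l) (+-cancelʳ-≤ (l * suc l ^ suc l * suc l) _ _ (begin
  suc l * (2 * c) + l * c * suc l  ≡⟨ e l c ⟩
  suc l * (c * suc (suc l))        ≤⟨ go ⟩
  suc l * d + l * c * suc l        ∎))
  where
  open ≤-Reasoning
  c = suc l ^ suc l
  d = suc (suc l) ^ suc l
  e : ∀ l c → suc l * (2 * c) + l * c * suc l ≡ suc l * (c * suc (suc l))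
  e = solve-∀
  b : suc l * (suc l ^ l * suc (suc l)) ≤ d + l * c
  b = bernoulli l (suc l) (suc (suc l))
  e₂ : ∀ l d c → (d + l * c) * suc l ≡ suc l * d + l * c * suc l
  e₂ = solve-∀
  e₃ : ∀ l y → suc l * (suc l * y * suc (suc l)) ≡ suc l * (y * suc (suc l)) * suc l
  e₃ = solve-∀
  go : suc l * (c * suc (suc l)) ≤ suc l * d + l * c * suc l
  go = begin
    suc l * (c * suc (suc l)) ≡⟨ e₃ l (suc l ^ l) ⟩
    suc l * (suc l ^ l * suc (suc l)) * suc l ≤⟨ *-monoˡ-≤ (suc l) b ⟩
    (d + l * c) * suc l ≡⟨ e₂ l d c ⟩
    suc l * d + l * c * suc l ∎

n<2^n : ∀ n → suc n ≤ 2 ^ n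
n<2^n zero = ≤-refl
n<2^n (suc n) = begin
  suc (suc n)     ≤⟨ s≤s (n<2^n n) ⟩
  suc (2 ^ n)     ≤⟨ +-monoˡ-≤ (2 ^ n) (m^n>0 2 n) ⟩
  2 ^ n + 2 ^ n   ≡⟨ cong (2 ^ n +_) (+-identityʳ (2 ^ n)) ⟨
  2 ^ suc n       ∎
  where open ≤-Reasoning

-- Sums over colourings

private
  variable
    I I′ : Set

∑ : List I → (I → ℕ) → ℕ
∑ xs f = sum (map f xs)

∏ : List I → (I → ℕ) → ℕ
∏ xs f = product (map f xs)

∑-cong : ∀ (xs : List I) {f g : I → ℕ} → (∀ x → f x ≡ g x) → ∑ xs f ≡ ∑ xs g
∑-cong xs f≗g = cong sum (map-cong f≗g xs)

∑-cong-∈ : ∀ (xs : List I) {f g : I → ℕ} → (∀ {x} → x ∈ xs → f x ≡ g x) → ∑ xs f ≡ ∑ xs g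
∑-cong-∈ []       f≗g = refl
∑-cong-∈ (x ∷ xs) f≗g = cong₂ _+_ (f≗g (here refl)) (∑-cong-∈ xs (f≗g ∘ there))

∑-mono : ∀ (xs : List I) {f g : I → ℕ} → (∀ x → f x ≤ g x) → ∑ xs f ≤ ∑ xs g
∑-mono []       f≤g = z≤n
∑-mono (x ∷ xs) f≤g = +-mono-≤ (f≤g x) (∑-mono xs f≤g)

∑-distrib-+ : ∀ (xs : List I) (f g : I → ℕ) → ∑ xs (λ x → f x + g x) ≡ ∑ xs f + ∑ xs g
∑-distrib-+ []       f g = refl
∑-distrib-+ (x ∷ xs) f g = trans (cong (f x + g x +_) (∑-distrib-+ xs f g)) (eq (f x) (g x) _ _)
  where
  eq : ∀ a b c d → a + b + (c + d) ≡ a + c + (b + d)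
  eq = solve-∀

*-distribˡ-∑ : ∀ c (xs : List I) (f : I → ℕ) → c * ∑ xs f ≡ ∑ xs (λ x → c * f x)
*-distribˡ-∑ c []       f = *-zeroʳ c
*-distribˡ-∑ c (x ∷ xs) f = trans (*-distribˡ-+ c (f x) _) (cong (c * f x +_) (*-distribˡ-∑ c xs f))

*-distribʳ-∑ : ∀ c (xs : List I) (f : I → ℕ) → ∑ xs f * c ≡ ∑ xs (λ x → f x * c)
*-distribʳ-∑ c []       f = refl
*-distribʳ-∑ c (x ∷ xs) f = trans (*-distribʳ-+ c (f x) _) (cong (f x * c +_) (*-distribʳ-∑ c xs f))

∑-const : ∀ c (xs : List I) → ∑ xs (λ _ → c) ≡ length xs * c
∑-const c []       = refl
∑-const c (x ∷ xs) = cong (c +_) (∑-const c xs)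

∑-bound : ∀ (xs : List I) (f : I → ℕ) c → (∀ {x} → x ∈ xs → f x ≤ c) → ∑ xs f ≤ length xs * c
∑-bound []       f c f≤c = z≤n
∑-bound (x ∷ xs) f c f≤c = +-mono-≤ (f≤c (here refl)) (∑-bound xs f c (f≤c ∘ there))

term≤∑ : ∀ {xs : List I} (f : I → ℕ) {x} → x ∈ xs → f x ≤ ∑ xs f
term≤∑ f (here refl) = m≤m+n _ _
term≤∑ f (there x∈)  = ≤-trans (term≤∑ f x∈) (m≤n+m _ _)

∑-swap : ∀ (xs : List I) (ys : List I′) (f : I → I′ → ℕ) →
         ∑ xs (λ x → ∑ ys (f x)) ≡ ∑ ys (λ y → ∑ xs (λ x → f x y))
∑-swap []       ys f = sym (trans (∑-const 0 ys) (*-zeroʳ (length ys)))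
∑-swap (x ∷ xs) ys f = trans (cong (∑ ys (f x) +_) (∑-swap xs ys f))
  (sym (∑-distrib-+ ys (f x) (λ y → ∑ xs (λ x → f x y))))

∑-++ : ∀ (xs ys : List I) (f : I → ℕ) → ∑ (xs ++ ys) f ≡ ∑ xs f + ∑ ys f
∑-++ xs ys f = trans (cong sum (map-++ f xs ys)) (sum-++ (map f xs) (map f ys))

∑-concatMap : ∀ (xs : List I′) (g : I′ → List I) (f : I → ℕ) →
              ∑ (concatMap g xs) f ≡ ∑ xs (λ x → ∑ (g x) f)
∑-concatMap []       g f = refl
∑-concatMap (x ∷ xs) g f = trans (∑-++ (g x) _ f) (cong (∑ (g x) f +_) (∑-concatMap xs g f))

∑-map : ∀ (xs : List I′) (g : I′ → I) (f : I → ℕ) → ∑ (map g xs) f ≡ ∑ xs (f ∘ g)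
∑-map xs g f = cong sum (sym (map-∘ xs))

∏-cong-∈ : ∀ (xs : List I) {f g : I → ℕ} → (∀ {x} → x ∈ xs → f x ≡ g x) → ∏ xs f ≡ ∏ xs g
∏-cong-∈ []       f≗g = refl
∏-cong-∈ (x ∷ xs) f≗g = cong₂ _*_ (f≗g (here refl)) (∏-cong-∈ xs (f≗g ∘ there))

∏-mono-∈ : ∀ (xs : List I) {f g : I → ℕ} → (∀ {x} → x ∈ xs → f x ≤ g x) → ∏ xs f ≤ ∏ xs g
∏-mono-∈ []       f≤g = ≤-refl
∏-mono-∈ (x ∷ xs) f≤g = *-mono-≤ (f≤g (here refl)) (∏-mono-∈ xs (f≤g ∘ there))

∏-distrib-* : ∀ (xs : List I) (f g : I → ℕ) → ∏ xs (λ x → f x * g x) ≡ ∏ xs f * ∏ xs g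
∏-distrib-* []       f g = refl
∏-distrib-* (x ∷ xs) f g = trans (cong (f x * g x *_) (∏-distrib-* xs f g)) (eq (f x) (g x) _ _)
  where
  eq : ∀ a b c d → a * b * (c * d) ≡ a * c * (b * d)
  eq = solve-∀

∏-const : ∀ c (xs : List I) → ∏ xs (λ _ → c) ≡ c ^ length xs
∏-const c []       = refl
∏-const c (x ∷ xs) = cong (c *_) (∏-const c xs)

∏-swap : ∀ (xs : List I) (ys : List I′) (f : I → I′ → ℕ) →
         ∏ xs (λ x → ∏ ys (f x)) ≡ ∏ ys (λ y → ∏ xs (λ x → f x y))
∏-swap []       ys f = sym (trans (∏-const 1 ys) (^-zeroˡ (length ys)))
∏-swap (x ∷ xs) ys f = trans (cong (∏ ys (f x) *_) (∏-swap xs ys f))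
  (sym (∏-distrib-* ys (f x) (λ y → ∏ xs (λ x → f x y))))

∏-^ : ∀ (xs : List I) (f : I → ℕ) n → ∏ xs (λ x → f x ^ n) ≡ ∏ xs f ^ n
∏-^ []       f n = sym (^-zeroˡ n)
∏-^ (x ∷ xs) f n = trans (cong (f x ^ n *_) (∏-^ xs f n)) (sym (^-distribʳ-* (f x) _ n))

𝟙 : {P : Set} → Dec P → ℕ
𝟙 P? = if does P? then 1 else 0

𝟙-cong : {P Q : Set} (P? : Dec P) (Q? : Dec Q) → (P → Q) → (Q → P) → 𝟙 P? ≡ 𝟙 Q?
𝟙-cong (yes p) (yes q) f g = refl
𝟙-cong (yes p) (no ¬q) f g = contradiction (f p) ¬q
𝟙-cong (no ¬p) (yes q) f g = contradiction (g q) ¬p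
𝟙-cong (no ¬p) (no ¬q) f g = refl

𝟙-mono : {P Q : Set} (P? : Dec P) (Q? : Dec Q) → (P → Q) → 𝟙 P? ≤ 𝟙 Q?
𝟙-mono (yes p) (yes q) f = ≤-refl
𝟙-mono (yes p) (no ¬q) f = contradiction (f p) ¬q
𝟙-mono (no ¬p) Q?      f = z≤n

𝟙≤1 : {P : Set} (P? : Dec P) → 𝟙 P? ≤ 1
𝟙≤1 (yes p) = ≤-refl
𝟙≤1 (no ¬p) = z≤n

𝟙-yes : {P : Set} (P? : Dec P) → P → 𝟙 P? ≡ 1
𝟙-yes (yes p) _ = refl
𝟙-yes (no ¬p) p = contradiction p ¬p

𝟙-no : {P : Set} (P? : Dec P) → ¬ P → 𝟙 P? ≡ 0
𝟙-no (yes p) ¬p = contradiction p ¬p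
𝟙-no (no ¬p) _  = refl

𝟙-× : {P Q : Set} (P? : Dec P) (Q? : Dec Q) → 𝟙 (P? ×-dec Q?) ≡ 𝟙 P? * 𝟙 Q?
𝟙-× (yes p) (yes q) = refl
𝟙-× (yes p) (no ¬q) = refl
𝟙-× (no ¬p) Q?      = refl

𝟙-¬ : {P : Set} (P? : Dec P) → 𝟙 (¬? P?) + 𝟙 P? ≡ 1
𝟙-¬ (yes p) = refl
𝟙-¬ (no ¬p) = refl

𝟙-all : {P : I → Set} (P? : ∀ x → Dec (P x)) (xs : List I) → 𝟙 (All.all? P? xs) ≡ ∏ xs (λ x → 𝟙 (P? x))
𝟙-all P? []       = refl
𝟙-all P? (x ∷ xs) with P? x | 𝟙-all P? xs
... | yes p | eq = trans eq (sym (+-identityʳ _))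
... | no ¬p | eq = refl

𝟙-any : {P : I → Set} (P? : ∀ x → Dec (P x)) (xs : List I) → 𝟙 (Any.any? P? xs) ≤ ∑ xs (λ x → 𝟙 (P? x))
𝟙-any P? [] = z≤n
𝟙-any P? (x ∷ xs) with P? x
... | yes _ = s≤s z≤n
... | no  _ = 𝟙-any P? xs

length-filter-𝟙 : {P : I → Set} (P? : ∀ x → Dec (P x)) (xs : List I) → length (filter P? xs) ≡ ∑ xs (λ x → 𝟙 (P? x))
length-filter-𝟙 P? [] = refl
length-filter-𝟙 P? (x ∷ xs) with does (P? x)
... | true  = cong suc (length-filter-𝟙 P? xs)
... | false = length-filter-𝟙 P? xs

lookup-update : ∀ {n k} (σ : Colouring n k) u x → lookup (σ [ u ]≔ x) u ≡ x
lookup-update σ u x = lookup∘updateAt u σ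

lookup-update′ : ∀ {n k} (σ : Colouring n k) {u w} x → w ≢ u → lookup (σ [ u ]≔ x) w ≡ lookup σ w
lookup-update′ σ {u} {w} x w≢u = lookup∘updateAt′ w u w≢u σ

length-allFin : ∀ k → length (allFin k) ≡ k
length-allFin k = length-tabulate (λ i → i)

-- Each colouring is `σ [ u ]≔ x` for exactly k pairs (σ, x). Conditioning on the colours of all
-- other vertices thus becomes an identity of sums.
∑-resample : ∀ {n k} (u : Fin n) (F : Colouring n k → ℕ) →
             k * ∑ (allColourings n k) F ≡ ∑ (allColourings n k) (λ σ → ∑ (allFin k) (λ x → F (σ [ u ]≔ x)))
∑-resample {suc n} {k} zero F = begin
  k * ∑ (allColourings (suc n) k) F
    ≡⟨ cong (k *_) (split F) ⟩
  k * ∑ (allFin k) (λ c → ∑ (allColourings n k) (λ σ → F (c ∷ σ)))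
    ≡⟨ cong (k *_) (∑-swap (allFin k) (allColourings n k) _) ⟩
  k * S                    ≡⟨ cong (_* S) (length-allFin k) ⟨
  length (allFin k) * S    ≡⟨ ∑-const S (allFin k) ⟨
  ∑ (allFin k) (λ _ → S)   ≡⟨ split _ ⟨
  ∑ (allColourings (suc n) k) (λ σ → ∑ (allFin k) (λ x → F (σ [ zero ]≔ x))) ∎
  where
  open ≡-Reasoning
  S = ∑ (allColourings n k) (λ σ → ∑ (allFin k) (λ x → F (x ∷ σ)))
  split : ∀ H → ∑ (allColourings (suc n) k) H ≡ ∑ (allFin k) (λ c → ∑ (allColourings n k) (λ σ → H (c ∷ σ)))
  split H = trans (∑-concatMap (allFin k) _ H) (∑-cong (allFin k) (λ c → ∑-map (allColourings n k) (c ∷_) H))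
∑-resample {suc n} {k} (suc u) F = begin
  k * ∑ (allColourings (suc n) k) F
    ≡⟨ cong (k *_) (split F) ⟩
  k * ∑ (allFin k) (λ c → ∑ (allColourings n k) (λ σ → F (c ∷ σ)))
    ≡⟨ *-distribˡ-∑ k (allFin k) _ ⟩
  ∑ (allFin k) (λ c → k * ∑ (allColourings n k) (λ σ → F (c ∷ σ)))
    ≡⟨ ∑-cong (allFin k) (λ c → ∑-resample u (λ σ → F (c ∷ σ))) ⟩
  ∑ (allFin k) (λ c → ∑ (allColourings n k) (λ σ → ∑ (allFin k) (λ x → F (c ∷ (σ [ u ]≔ x)))))
    ≡⟨ split _ ⟨
  ∑ (allColourings (suc n) k) (λ σ → ∑ (allFin k) (λ x → F (σ [ suc u ]≔ x))) ∎
  where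
  open ≡-Reasoning
  split : ∀ H → ∑ (allColourings (suc n) k) H ≡ ∑ (allFin k) (λ c → ∑ (allColourings n k) (λ σ → H (c ∷ σ)))
  split H = trans (∑-concatMap (allFin k) _ H) (∑-cong (allFin k) (λ c → ∑-map (allColourings n k) (c ∷_) H))

module _ {n k : ℕ} where

  IndepOf : List (Fin n) → (Colouring n k → ℕ) → Set
  IndepOf N h = ∀ {u} → u ∈ N → ∀ σ x → h (σ [ u ]≔ x) ≡ h σ

  -- Fubini: if the colours on `N` influence the summand only through one factor per vertex, the sum
  -- over all choices on `N` splits into a product of sums. This is why `h`, and `g u x` for a fixed
  -- colour x, must be constant in the colours on `N`.
  ∑-resample-list : ∀ (N : List (Fin n)) → Unique N →
    (h : Colouring n k → ℕ) → IndepOf N h →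
    (g : Fin n → Fin k → Colouring n k → ℕ) → (∀ {u} → u ∈ N → ∀ x → IndepOf N (g u x)) →
    k ^ length N * ∑ (allColourings n k) (λ σ → h σ * ∏ N (λ u → g u (lookup σ u) σ))
      ≡ ∑ (allColourings n k) (λ σ → h σ * ∏ N (λ u → ∑ (allFin k) (λ x → g u x σ)))
  ∑-resample-list [] _ h _ g _ = +-identityʳ _
  ∑-resample-list (u ∷ N) (u∉N ∷ uN) h ih g ig = begin
    k * k ^ length N * ∑ (allColourings n k) F
      ≡⟨ e₁ k (k ^ length N) _ ⟩
    k ^ length N * (k * ∑ (allColourings n k) F)
      ≡⟨ cong (k ^ length N *_) (∑-resample u F) ⟩
    k ^ length N * ∑ (allColourings n k) (λ σ → ∑ (allFin k) (λ x → F (σ [ u ]≔ x)))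
      ≡⟨ cong (k ^ length N *_) (∑-cong (allColourings n k) inner) ⟩
    k ^ length N * ∑ (allColourings n k) (λ σ → h′ σ * ∏ N (λ w → g w (lookup σ w) σ))
      ≡⟨ ∑-resample-list N uN h′ ih′ g (λ w∈N x y∈N → ig (there w∈N) x (there y∈N)) ⟩
    ∑ (allColourings n k) (λ σ → h′ σ * ∏ N (λ w → ∑ (allFin k) (λ x → g w x σ)))
      ≡⟨ ∑-cong (allColourings n k) (λ σ → *-assoc (h σ) _ _) ⟩
    ∑ (allColourings n k) (λ σ → h σ * ∏ (u ∷ N) (λ w → ∑ (allFin k) (λ x → g w x σ))) ∎
    where
    open ≡-Reasoning
    F : Colouring n k → ℕ
    F σ = h σ * ∏ (u ∷ N) (λ w → g w (lookup σ w) σ)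
    h′ : Colouring n k → ℕ
    h′ σ = h σ * ∑ (allFin k) (λ x → g u x σ)
    ih′ : IndepOf N h′
    ih′ w∈N σ y = cong₂ _*_ (ih (there w∈N) σ y) (∑-cong (allFin k) (λ x → ig (here refl) x (there w∈N) σ y))
    e₁ : ∀ a b c → a * b * c ≡ b * (a * c)
    e₁ = solve-∀
    inner : ∀ σ → ∑ (allFin k) (λ x → F (σ [ u ]≔ x)) ≡ h′ σ * ∏ N (λ w → g w (lookup σ w) σ)
    inner σ = begin
      ∑ (allFin k) (λ x → F (σ [ u ]≔ x))
        ≡⟨ ∑-cong (allFin k) (λ x → cong₂ _*_ (ih (here refl) σ x) (cong₂ _*_
             (trans (cong (λ c → g u c (σ [ u ]≔ x)) (lookup-update σ u x)) (ig (here refl) x (here refl) σ x))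
             (∏-cong-∈ N λ {w} w∈N → trans
               (cong (λ c → g w c (σ [ u ]≔ x)) (lookup-update′ σ x (λ w≡u → All.lookup u∉N w∈N (sym w≡u))))
               (ig (there w∈N) _ (here refl) σ x)))) ⟩
      ∑ (allFin k) (λ x → h σ * (g u x σ * P))
        ≡⟨ ∑-cong (allFin k) (λ x → sym (*-assoc (h σ) (g u x σ) P)) ⟩
      ∑ (allFin k) (λ x → h σ * g u x σ * P)
        ≡⟨ *-distribʳ-∑ P (allFin k) _ ⟨
      ∑ (allFin k) (λ x → h σ * g u x σ) * P
        ≡⟨ cong (_* P) (*-distribˡ-∑ (h σ) (allFin k) _) ⟨
      h′ σ * P ∎
      where
      P = ∏ N (λ w → g w (lookup σ w) σ)

-- Colours left over by the neighbours of a vertex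

∑-filter-≤ : {A : Set} {P : A → Set} (P? : ∀ x → Dec (P x)) (xs : List A) (f : A → ℕ) →
             ∑ (filter P? xs) f ≤ ∑ xs f
∑-filter-≤ P? [] f = z≤n
∑-filter-≤ P? (x ∷ xs) f with P? x
... | yes _ = +-monoʳ-≤ (f x) (∑-filter-≤ P? xs f)
... | no  _ = ≤-trans (∑-filter-≤ P? xs f) (m≤n+m _ (f x))

∑-allFin-suc : ∀ {k} (g : Fin (suc k) → ℕ) → ∑ (allFin (suc k)) g ≡ g zero + ∑ (allFin k) (g ∘ suc)
∑-allFin-suc {k} g = cong (λ l → g zero + sum l) (trans (map-tabulate suc g) (sym (map-tabulate (λ i → i) (g ∘ suc))))

∑-single : ∀ {k} (c : Fin k) (f : Fin k → ℕ) → ∑ (allFin k) (λ x → f x * 𝟙 (x ≟ᶠ c)) ≡ f c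
∑-single {suc k} zero f = begin
  ∑ (allFin (suc k)) (λ x → f x * 𝟙 (x ≟ᶠ zero)) ≡⟨ ∑-allFin-suc {k} _ ⟩
  f zero * 1 + ∑ (allFin k) (λ x → f (suc x) * 0)
    ≡⟨ cong₂ _+_ (*-identityʳ (f zero)) (trans (∑-cong (allFin k) (λ x → *-zeroʳ (f (suc x))))
         (trans (∑-const 0 (allFin k)) (*-zeroʳ (length (allFin k))))) ⟩
  f zero + 0 ≡⟨ +-identityʳ (f zero) ⟩
  f zero ∎
  where open ≡-Reasoning
∑-single {suc k} (suc c) f = begin
  ∑ (allFin (suc k)) (λ x → f x * 𝟙 (x ≟ᶠ suc c)) ≡⟨ ∑-allFin-suc {k} _ ⟩
  f zero * 0 + ∑ (allFin k) (λ x → f (suc x) * 𝟙 (suc x ≟ᶠ suc c))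
    ≡⟨ cong₂ _+_ (*-zeroʳ (f zero)) (∑-cong (allFin k) (λ x → cong (f (suc x) *_)
         (𝟙-cong (suc x ≟ᶠ suc c) (x ≟ᶠ c) (λ { refl → refl }) (cong suc)))) ⟩
  ∑ (allFin k) (λ x → f (suc x) * 𝟙 (x ≟ᶠ c)) ≡⟨ ∑-single c (f ∘ suc) ⟩
  f (suc c) ∎
  where open ≡-Reasoning

∑-Fin-≢ : ∀ {k} (c : Fin k) (f : Fin k → ℕ) → ∑ (allFin k) (λ x → f x * 𝟙 (¬? (x ≟ᶠ c))) + f c ≡ ∑ (allFin k) f
∑-Fin-≢ {k} c f = begin
  ∑ (allFin k) (λ x → f x * 𝟙 (¬? (x ≟ᶠ c))) + f c
    ≡⟨ cong (∑ (allFin k) (λ x → f x * 𝟙 (¬? (x ≟ᶠ c))) +_) (∑-single c f) ⟨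
  ∑ (allFin k) (λ x → f x * 𝟙 (¬? (x ≟ᶠ c))) + ∑ (allFin k) (λ x → f x * 𝟙 (x ≟ᶠ c))
    ≡⟨ ∑-distrib-+ (allFin k) _ _ ⟨
  ∑ (allFin k) (λ x → f x * 𝟙 (¬? (x ≟ᶠ c)) + f x * 𝟙 (x ≟ᶠ c))
    ≡⟨ ∑-cong (allFin k) (λ x → trans (sym (*-distribˡ-+ (f x) _ _))
         (trans (cong (f x *_) (𝟙-¬ (x ≟ᶠ c))) (*-identityʳ (f x)))) ⟩
  ∑ (allFin k) f ∎
  where open ≡-Reasoning

𝟙-avoid : {A : Set} {S P : A → Set} (S? : ∀ u → Dec (S u)) (P? : ∀ u → Dec (P u)) (N : List A) →
  1 ≤ 𝟙 (All.all? (λ u → S? u →-dec ¬? (P? u)) N) + ∑ N (λ u → 𝟙 (S? u) * 𝟙 (P? u))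
𝟙-avoid S? P? [] = ≤-refl
𝟙-avoid S? P? (u ∷ N) with S? u | P? u | 𝟙-avoid S? P? N
... | yes _ | yes _ | _  = s≤s z≤n
... | yes _ | no  _ | ih = ih
... | no  _ | yes _ | ih = ih
... | no  _ | no  _ | ih = ih

𝟙-<-* : ∀ {a b} (a<b? : Dec (a < b)) → 𝟙 a<b? * a ≤ b * 𝟙 a<b?
𝟙-<-* {a} {b} (yes a<b) = ≤-trans (≤-reflexive (*-identityˡ a)) (≤-trans (<⇒≤ a<b) (≤-reflexive (sym (*-identityʳ b))))
𝟙-<-* {a} {b} (no  _)   = z≤n

-- Conditions under which at most Δ neighbours, each choosing from its own list of colours, leave 2 ℓ
-- of the k colours unused on average: ((t - 1) / t) ^ t plays the role of 1/e, and b₀ bounds the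
-- number of neighbours with fewer than t colours.
record Parameters (k Δ ℓ t′ b₀ : ℕ) : Set where
  t : ℕ
  t = suc t′
  field
    t′>0     : 0 < t′
    b₀>0     : 0 < b₀
    tb₀<k    : t * b₀ < k
    2Δt≤ℓb₀  : 2 * (Δ * t) ≤ ℓ * b₀
    spread   : ∀ m K → m ≤ Δ → k ≤ K + t * b₀ → K ≤ k →
               t ^ (t * m) * (2 * ℓ) ^ K ≤ K ^ K * t′ ^ (t * m)

module Pointwise {k Δ ℓ t′ b₀ : ℕ} (par : Parameters k Δ ℓ t′ b₀) {A : Set} (N : List A) (|N|≤Δ : length N ≤ Δ)
  {P : A → Fin k → Set} (P? : ∀ u c → Dec (P u c)) where

  open Parameters par

  size : A → ℕ
  size u = ∑ (allFin k) (λ c → 𝟙 (P? u c))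

  sizeWithout : A → Fin k → ℕ
  sizeWithout u c = ∑ (allFin k) (λ x → 𝟙 (P? u x) * 𝟙 (¬? (x ≟ᶠ c)))

  sizeWithout+𝟙 : ∀ u c → sizeWithout u c + 𝟙 (P? u c) ≡ size u
  sizeWithout+𝟙 u c = ∑-Fin-≢ c (λ x → 𝟙 (P? u x))

  small? : ∀ u → Dec (size u < t)
  small? u = size u <? t

  #small : ℕ
  #small = ∑ N (λ u → 𝟙 (small? u))

  Good : Fin k → Set
  Good c = All (λ u → size u < t → ¬ P u c) N

  good? : ∀ c → Dec (Good c)
  good? c = All.all? (λ u → small? u →-dec ¬? (P? u c)) N

  Cs : List (Fin k)
  Cs = filter good? (allFin k)

  K : ℕ
  K = length Cs

  K≤k : K ≤ k
  K≤k = ≤-trans (length-filter good? (allFin k)) (≤-reflexive (length-allFin k))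

  -- A colour that is not good lies in the list of a small neighbour, and such a list has fewer than
  -- t colours.
  k≤K+t#small : k ≤ K + t * #small
  k≤K+t#small = begin
    k                                       ≡⟨ length-allFin k ⟨
    length (allFin k)                       ≡⟨ *-identityʳ _ ⟨
    length (allFin k) * 1                   ≡⟨ ∑-const 1 (allFin k) ⟨
    ∑ (allFin k) (λ _ → 1)                  ≤⟨ ∑-mono (allFin k) (λ c → 𝟙-avoid small? (λ u → P? u c) N) ⟩
    ∑ (allFin k) (λ c → 𝟙 (good? c) + ∑ N (λ u → 𝟙 (small? u) * 𝟙 (P? u c)))
      ≡⟨ ∑-distrib-+ (allFin k) _ _ ⟩
    ∑ (allFin k) (λ c → 𝟙 (good? c)) + ∑ (allFin k) (λ c → ∑ N (λ u → 𝟙 (small? u) * 𝟙 (P? u c)))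
      ≡⟨ cong₂ _+_ (length-filter-𝟙 good? (allFin k)) (trans
           (∑-cong N (λ u → *-distribˡ-∑ (𝟙 (small? u)) (allFin k) (λ c → 𝟙 (P? u c))))
           (sym (∑-swap (allFin k) N (λ c u → 𝟙 (small? u) * 𝟙 (P? u c))))) ⟨
    K + ∑ N (λ u → 𝟙 (small? u) * size u)   ≤⟨ +-monoʳ-≤ K (∑-mono N (λ u → 𝟙-<-* (small? u))) ⟩
    K + ∑ N (λ u → t * 𝟙 (small? u))        ≡⟨ cong (K +_) (*-distribˡ-∑ t N _) ⟨
    K + t * #small                          ∎
    where
    open ≤-Reasoning

  -- Forbidding c shortens the list of u from l to l - 1 exactly when c belongs to it. The powers of
  -- l on both sides avoid a subtraction in the exponent.
  factor : ∀ {l l′} u → size u ≡ l → l ≡ suc l′ → ∀ cs →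
    ∏ cs (sizeWithout u) * l ^ ∑ cs (λ c → 𝟙 (P? u c)) ≡ l ^ length cs * l′ ^ ∑ cs (λ c → 𝟙 (P? u c))
  factor u _ refl [] = refl
  factor {l} {l′} u sz refl (c ∷ cs) with P? u c | sizeWithout+𝟙 u c | factor u sz refl cs
  ... | yes _ | eq | ih = begin
    w * p * (l * l ^ j)         ≡⟨ e₁ w p l (l ^ j) ⟩
    w * l * (p * l ^ j)         ≡⟨ cong₂ (λ a b → a * l * b) (suc-injective (trans (+-comm 1 w) (trans eq sz))) ih ⟩
    l′ * l * (l ^ length cs * l′ ^ j) ≡⟨ e₂ l′ l (l ^ length cs) (l′ ^ j) ⟩
    l * l ^ length cs * (l′ * l′ ^ j) ∎
    where
    open ≡-Reasoning
    w = sizeWithout u c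
    p = ∏ cs (sizeWithout u)
    j = ∑ cs (λ c → 𝟙 (P? u c))
    e₁ : ∀ a b c d → a * b * (c * d) ≡ a * c * (b * d)
    e₁ = solve-∀
    e₂ : ∀ a b c d → a * b * (c * d) ≡ b * c * (a * d)
    e₂ = solve-∀
  ... | no _ | eq | ih = trans (*-assoc (sizeWithout u c) _ _)
    (trans (cong₂ _*_ (trans (sym (+-identityʳ _)) (trans eq sz)) ih) (sym (*-assoc l (l ^ length cs) (l′ ^ ∑ cs (λ c → 𝟙 (P? u c))))))

  -- A small list contains no good colour, so forbidding one costs nothing. A list of l ≥ t colours
  -- contains at most l good ones, so the product over good colours loses at most the factor (1 -
  -- 1/l)^l ≥ (1 - 1/t)^t. That bound no longer depends on u.
  colourwise : ∀ {u} → u ∈ N → size u ^ K * t′ ^ t ≤ ∏ Cs (sizeWithout u) * t ^ t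
  colourwise {u} u∈N with size u <? t
  ... | yes sm = *-mono-≤ (≤-reflexive (sym (trans (∏-cong-∈ Cs eq) (∏-const (size u) Cs)))) (^-monoˡ-≤ t (n≤1+n t′))
    where
    eq : ∀ {c} → c ∈ Cs → sizeWithout u c ≡ size u
    eq {c} c∈Cs = trans (sym (+-identityʳ _))
      (trans (cong (sizeWithout u c +_) (sym (𝟙-no (P? u c) (All.lookup (proj₂ (∈-filter⁻ good? {xs = allFin k} c∈Cs)) u∈N sm))))
        (sizeWithout+𝟙 u c))
  ... | no ¬sm = go (size u) refl (≮⇒≥ ¬sm)
    where
    open ≤-Reasoning
    go : ∀ l → size u ≡ l → t ≤ l → size u ^ K * t′ ^ t ≤ ∏ Cs (sizeWithout u) * t ^ t
    go l@(suc l′) sz (s≤s t′≤l′) = *-cancelʳ-≤ _ _ (l ^ l) {{m^n≢0 l l}} (begin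
      size u ^ K * t′ ^ t * l ^ l       ≡⟨ cong (λ z → z ^ K * t′ ^ t * l ^ l) sz ⟩
      l ^ K * t′ ^ t * l ^ l            ≡⟨ *-assoc (l ^ K) _ _ ⟩
      l ^ K * (t′ ^ t * l ^ l)          ≤⟨ *-monoʳ-≤ (l ^ K) (ratio-mono t′≤l′) ⟩
      l ^ K * (l′ ^ l * t ^ t)          ≡⟨ *-assoc (l ^ K) _ _ ⟨
      l ^ K * l′ ^ l * t ^ t            ≤⟨ *-monoˡ-≤ (t ^ t) few ⟩
      p * l ^ l * t ^ t                 ≡⟨ e p (l ^ l) (t ^ t) ⟩
      p * t ^ t * l ^ l                 ∎)
      where
      p = ∏ Cs (sizeWithout u)
      j = ∑ Cs (λ c → 𝟙 (P? u c))
      e : ∀ a b c → a * b * c ≡ a * c * b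
      e = solve-∀
      j≤l : j ≤ l
      j≤l = ≤-trans (∑-filter-≤ good? (allFin k) _) (≤-reflexive sz)
      few : l ^ K * l′ ^ l ≤ p * l ^ l
      few with m≤n⇒∃[o]m+o≡n j≤l
      ... | o , j+o≡l = begin
        l ^ K * l′ ^ l                ≡⟨ cong (λ z → l ^ K * l′ ^ z) j+o≡l ⟨
        l ^ K * l′ ^ (j + o)          ≡⟨ cong (l ^ K *_) (^-distribˡ-+-* l′ j o) ⟩
        l ^ K * (l′ ^ j * l′ ^ o)     ≡⟨ *-assoc (l ^ K) _ _ ⟨
        l ^ K * l′ ^ j * l′ ^ o       ≡⟨ cong (_* l′ ^ o) (factor u sz refl Cs) ⟨
        p * l ^ j * l′ ^ o            ≤⟨ *-monoʳ-≤ (p * l ^ j) (^-monoˡ-≤ o (n≤1+n l′)) ⟩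
        p * l ^ j * l ^ o             ≡⟨ *-assoc p _ _ ⟩
        p * (l ^ j * l ^ o)           ≡⟨ cong (p *_) (^-distribˡ-+-* l j o) ⟨
        p * l ^ (j + o)               ≡⟨ cong (λ z → p * l ^ z) j+o≡l ⟩
        p * l ^ l                     ∎

  -- AM-GM over the good colours: their arithmetic mean of ∏ `sizeWithout` is at least the geometric
  -- mean, which after swapping the products is at least (1 - 1/t)^(t m / K) ∏ `size`. `spread` says
  -- that K times this factor is at least 2 ℓ. Everything is raised to the power K to avoid roots.
  few-small : #small < b₀ → 2 * ℓ * ∏ N size ≤ ∑ (allFin k) (λ c → ∏ N (λ u → sizeWithout u c))
  few-small #small<b₀ = ^-cancelʳ-≤ K {{>-nonZero K>0}} (*-cancelʳ-≤ _ _ (T * T′) {{m*n≢0 T T′ {{m^n≢0 t (t * m)}} {{T′≢0}}}} (begin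
    (2 * ℓ * Λ) ^ K * (T * T′)            ≡⟨ cong (_* (T * T′)) (^-distribʳ-* (2 * ℓ) Λ K) ⟩
    (2 * ℓ) ^ K * Λ ^ K * (T * T′)        ≡⟨ e₁ ((2 * ℓ) ^ K) (Λ ^ K) T T′ ⟩
    T * (2 * ℓ) ^ K * (Λ ^ K * T′)        ≤⟨ *-monoˡ-≤ _ (spread m K |N|≤Δ k≤K+tb₀ K≤k) ⟩
    K ^ K * T′ * (Λ ^ K * T′)             ≤⟨ *-monoʳ-≤ (K ^ K * T′) total ⟩
    K ^ K * T′ * (Π * T)                  ≡⟨ e₂ (K ^ K) T′ Π T ⟩
    K ^ K * Π * (T * T′)                  ≤⟨ *-monoˡ-≤ (T * T′) mean ⟩
    ∑ Cs a ^ K * (T * T′)                 ≤⟨ *-monoˡ-≤ (T * T′) (^-monoˡ-≤ K (∑-filter-≤ good? (allFin k) a)) ⟩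
    ∑ (allFin k) a ^ K * (T * T′)         ∎))
    where
    open ≤-Reasoning
    m = length N
    T = t ^ (t * m)
    T′ = t′ ^ (t * m)
    T′≢0 : NonZero T′
    T′≢0 = m^n≢0 t′ (t * m) {{>-nonZero t′>0}}
    Λ = ∏ N size
    a : Fin k → ℕ
    a c = ∏ N (λ u → sizeWithout u c)
    Π = ∏ Cs a
    k≤K+tb₀ : k ≤ K + t * b₀
    k≤K+tb₀ = ≤-trans k≤K+t#small (+-monoʳ-≤ K (*-monoʳ-≤ t (<⇒≤ #small<b₀)))
    K>0 : 0 < K
    K>0 = +-cancelʳ-< (t * b₀) 0 K (≤-trans tb₀<k k≤K+tb₀)
    e₁ : ∀ a b c d → a * b * (c * d) ≡ c * a * (b * d)
    e₁ = solve-∀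
    e₂ : ∀ a b c d → a * b * (c * d) ≡ a * c * (d * b)
    e₂ = solve-∀
    total : Λ ^ K * T′ ≤ Π * T
    total = begin
      Λ ^ K * T′                                ≡⟨ cong₂ _*_ (∏-^ N size K) (trans (∏-const (t′ ^ t) N) (^-*-assoc t′ t m)) ⟨
      ∏ N (λ u → size u ^ K) * ∏ N (λ _ → t′ ^ t) ≡⟨ ∏-distrib-* N _ _ ⟨
      ∏ N (λ u → size u ^ K * t′ ^ t)           ≤⟨ ∏-mono-∈ N colourwise ⟩
      ∏ N (λ u → ∏ Cs (sizeWithout u) * t ^ t)  ≡⟨ ∏-distrib-* N _ _ ⟩
      ∏ N (λ u → ∏ Cs (sizeWithout u)) * ∏ N (λ _ → t ^ t)
        ≡⟨ cong₂ _*_ (∏-swap N Cs sizeWithout) (trans (∏-const (t ^ t) N) (^-*-assoc t t m)) ⟩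
      Π * T                                     ∎
    mean : K ^ K * Π ≤ ∑ Cs a ^ K
    mean = subst (λ z → z ^ z * Π ≤ ∑ Cs a ^ z) (length-map a Cs) (amgm (map a Cs))

  -- Markov's inequality built in: the estimate is linear in `#small`, so that it can be averaged
  -- over σ. If `#small` reaches b₀, the last summand alone suffices.
  unused-colours : 2 * ℓ * b₀ * ∏ N size ≤
    b₀ * ∑ (allFin k) (λ c → ∏ N (λ u → sizeWithout u c)) + 2 * ℓ * #small * ∏ N size
  unused-colours with <-≤-connex #small b₀
  ... | inj₁ #small<b₀ = ≤-trans (≤-reflexive (e (2 * ℓ) b₀ (∏ N size)))
          (≤-trans (*-monoʳ-≤ b₀ (few-small #small<b₀)) (m≤m+n _ _))
    where
    e : ∀ a b c → a * b * c ≡ b * (a * c)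
    e = solve-∀
  ... | inj₂ b₀≤#small = ≤-trans (*-monoˡ-≤ (∏ N size) (*-monoʳ-≤ (2 * ℓ) b₀≤#small)) (m≤n+m _ _)

-- Counting proper colourings

Unique-length≤ : ∀ {n} {xs : List (Fin n)} → Unique xs → length xs ≤ n
Unique-length≤ u = injective⇒≤ (lookup-inj u)
  where
  lookup-inj : ∀ {A : Set} {xs : List A} → Unique xs → ∀ {i j} → List.lookup xs i ≡ List.lookup xs j → i ≡ j
  lookup-inj (_ ∷ _) {zero} {zero} eq = refl
  lookup-inj (x∉ ∷ _) {zero} {suc j} eq = contradiction eq (All.lookup x∉ (∈-lookup j))
  lookup-inj (x∉ ∷ _) {suc i} {zero} eq = contradiction (sym eq) (All.lookup x∉ (∈-lookup i))
  lookup-inj (_ ∷ u) {suc i} {suc j} eq = cong suc (lookup-inj u eq)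

module Counting {n : ℕ} (k : ℕ) (G : Graph n) where

  open import Data.List.Membership.DecPropositional (_≟ᶠ_ {n}) using (_∈?_)

  Edge-sym : ∀ {i j} → Edge G i j → Edge G j i
  Edge-sym {i} {j} e = trans (Graph.sym G j i) e

  Edge-irrefl : ∀ {i} → ¬ Edge G i i
  Edge-irrefl {i} e = contradiction (trans (sym e) (irrefl G i)) λ ()

  edge? : ∀ i j → Dec (Edge G i j)
  edge? i j = adj G i j ≟ᵇ true

  nbrs : Fin n → List (Fin n)
  nbrs v = filter (edge? v) (allFin n)

  ∈-nbrs⁻ : ∀ {v w} → w ∈ nbrs v → Edge G v w
  ∈-nbrs⁻ {v} w∈ = proj₂ (∈-filter⁻ (edge? v) {xs = allFin n} w∈)

  ∈-nbrs⁺ : ∀ {v w} → Edge G v w → w ∈ nbrs v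
  ∈-nbrs⁺ {v} {w} e = ∈-filter⁺ (edge? v) (∈-allFin w) e

  nbrs-unique : ∀ v → Unique (nbrs v)
  nbrs-unique v = Unique.filter⁺ (edge? v) (Unique.allFin⁺ n)

  Cols : List (Colouring n k)
  Cols = allColourings n k

  -- The vertices in R count as deleted. They still carry an arbitrary colour, so that each of them
  -- contributes a factor k to #proper R.
  ProperOff : List (Fin n) → Colouring n k → Set
  ProperOff R σ = ∀ i j → i ∉ R → j ∉ R → Edge G i j → lookup σ i ≢ lookup σ j

  Free : List (Fin n) → Fin n → Fin k → Colouring n k → Set
  Free R u x σ = ∀ w → w ∉ R → Edge G u w → lookup σ w ≢ x

  abstract
    properOff? : ∀ R σ → Dec (ProperOff R σ)
    properOff? R σ = all? λ i → all? λ j → ¬? (i ∈? R) →-dec (¬? (j ∈? R) →-dec (edge? i j →-dec ¬? (lookup σ i ≟ᶠ lookup σ j)))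

    free? : ∀ R u x σ → Dec (Free R u x σ)
    free? R u x σ = all? λ w → ¬? (w ∈? R) →-dec (edge? u w →-dec ¬? (lookup σ w ≟ᶠ x))

  #proper : List (Fin n) → ℕ
  #proper R = ∑ Cols (λ σ → 𝟙 (properOff? R σ))

  #free : List (Fin n) → Fin n → Colouring n k → ℕ
  #free R u σ = ∑ (allFin k) (λ x → 𝟙 (free? R u x σ))

  Frozen : Colouring n k → Fin n → Set
  Frozen σ u = #free [] u σ ≤ 1

  frozen? : ∀ σ u → Dec (Frozen σ u)
  frozen? σ u = #free [] u σ ≤? 1

  proper-split : ∀ (N R : List (Fin n)) → (∀ {u} → u ∈ N → u ∉ R) → ∀ σ →
    𝟙 (properOff? R σ) ≡ 𝟙 (properOff? (N ++ R) σ) * ∏ N (λ u → 𝟙 (free? R u (lookup σ u) σ))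
  proper-split N R N∩R σ = trans
    (𝟙-cong (properOff? R σ) (properOff? (N ++ R) σ ×-dec All.all? (λ u → free? R u (lookup σ u) σ) N) to from)
    (trans (𝟙-× (properOff? (N ++ R) σ) (All.all? (λ u → free? R u (lookup σ u) σ) N)) (cong (𝟙 (properOff? (N ++ R) σ) *_) (𝟙-all (λ u → free? R u (lookup σ u) σ) N)))
    where
    to : ProperOff R σ → ProperOff (N ++ R) σ × All (λ u → Free R u (lookup σ u) σ) N
    to p = (λ i j i∉ j∉ → p i j (i∉ ∘ ∈-++⁺ʳ N) (j∉ ∘ ∈-++⁺ʳ N))
         , All.tabulate (λ {u} u∈N w w∉R e → p w u w∉R (N∩R u∈N) (Edge-sym e))
    from : ProperOff (N ++ R) σ × All (λ u → Free R u (lookup σ u) σ) N → ProperOff R σ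
    from (p , fs) i j i∉R j∉R e with i ∈? N | j ∈? N
    ... | yes i∈N | _       = ≢-sym (All.lookup fs i∈N j j∉R e)
    ... | no  _   | yes j∈N = All.lookup fs j∈N i i∉R (Edge-sym e)
    ... | no i∉N  | no j∉N  = p i j ([ i∉N , i∉R ]′ ∘ ∈-++⁻ N) ([ j∉N , j∉R ]′ ∘ ∈-++⁻ N) e

  proper-indep : ∀ {R u} → u ∈ R → ∀ σ x → 𝟙 (properOff? R (σ [ u ]≔ x)) ≡ 𝟙 (properOff? R σ)
  proper-indep {R} {u} u∈R σ x = 𝟙-cong (properOff? R (σ [ u ]≔ x)) (properOff? R σ)
    (λ p i j i∉R j∉R e eq → p i j i∉R j∉R e (trans (same i∉R) (trans eq (sym (same j∉R)))))
    (λ p i j i∉R j∉R e eq → p i j i∉R j∉R e (trans (sym (same i∉R)) (trans eq (same j∉R))))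
    where
    same : ∀ {i} → i ∉ R → lookup (σ [ u ]≔ x) i ≡ lookup σ i
    same i∉R = lookup-update′ σ x λ { refl → i∉R u∈R }

  free-indep : ∀ {R u w} → ¬ Edge G u w → ∀ c σ x → 𝟙 (free? R u c (σ [ w ]≔ x)) ≡ 𝟙 (free? R u c σ)
  free-indep {R} {u} {w} ¬e c σ x = 𝟙-cong (free? R u c (σ [ w ]≔ x)) (free? R u c σ)
    (λ f y y∉R e eq → f y y∉R e (trans (same e) eq))
    (λ f y y∉R e eq → f y y∉R e (trans (sym (same e)) eq))
    where
    same : ∀ {y} → Edge G u y → lookup (σ [ w ]≔ x) y ≡ lookup σ y
    same e = lookup-update′ σ x λ { refl → ¬e e }

  #free-indep : ∀ {R u w} → ¬ Edge G u w → ∀ σ x → #free R u (σ [ w ]≔ x) ≡ #free R u σ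
  #free-indep ¬e σ x = ∑-cong (allFin k) (λ c → free-indep ¬e c σ x)

  -- As `N` is independent, the lists of its vertices depend only on the other colours. Given those,
  -- each vertex of `N` ranges over its own list independently. `φ` weighs the chosen colours, for
  -- instance to exclude one of them.
  resample-independent : ∀ (N R : List (Fin n)) → Unique N → (∀ {u} → u ∈ N → u ∉ R) →
    (∀ {u w} → u ∈ N → w ∈ N → ¬ Edge G u w) →
    (h : Colouring n k → ℕ) → IndepOf N h → (φ : Fin k → ℕ) →
    k ^ length N * ∑ Cols (λ σ → 𝟙 (properOff? R σ) * (h σ * ∏ N (λ u → φ (lookup σ u))))
      ≡ ∑ Cols (λ σ → 𝟙 (properOff? (N ++ R) σ) * (h σ * ∏ N (λ u → ∑ (allFin k) (λ x → 𝟙 (free? R u x σ) * φ x))))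
  resample-independent N R uN N∩R indep h ih φ = begin
    k ^ length N * ∑ Cols (λ σ → 𝟙 (properOff? R σ) * (h σ * ∏ N (λ u → φ (lookup σ u))))
      ≡⟨ cong (k ^ length N *_) (∑-cong Cols λ σ → trans
           (cong (_* (h σ * ∏ N (λ u → φ (lookup σ u)))) (proper-split N R N∩R σ))
           (trans (e (𝟙 (properOff? (N ++ R) σ)) _ (h σ) _)
             (cong (h′ σ *_) (sym (∏-distrib-* N _ _))))) ⟩
    k ^ length N * ∑ Cols (λ σ → h′ σ * ∏ N (λ u → g u (lookup σ u) σ))
      ≡⟨ ∑-resample-list N uN h′
           (λ u∈N σ x → cong₂ _*_ (proper-indep (∈-++⁺ˡ u∈N) σ x) (ih u∈N σ x)) g
           (λ u∈N x w∈N σ y → cong (_* φ x) (free-indep (indep u∈N w∈N) x σ y)) ⟩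
    ∑ Cols (λ σ → h′ σ * ∏ N (λ u → ∑ (allFin k) (λ x → g u x σ)))
      ≡⟨ ∑-cong Cols (λ σ → *-assoc (𝟙 (properOff? (N ++ R) σ)) (h σ) _) ⟩
    _ ∎
    where
    open ≡-Reasoning
    h′ : Colouring n k → ℕ
    h′ σ = 𝟙 (properOff? (N ++ R) σ) * h σ
    g : Fin n → Fin k → Colouring n k → ℕ
    g u x σ = 𝟙 (free? R u x σ) * φ x
    e : ∀ a b c d → a * b * (c * d) ≡ a * c * (b * d)
    e = solve-∀

  resample-sizes : ∀ (N R : List (Fin n)) → Unique N → (∀ {u} → u ∈ N → u ∉ R) →
    (∀ {u w} → u ∈ N → w ∈ N → ¬ Edge G u w) →
    (h : Colouring n k → ℕ) → IndepOf N h →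
    k ^ length N * ∑ Cols (λ σ → 𝟙 (properOff? R σ) * h σ)
      ≡ ∑ Cols (λ σ → 𝟙 (properOff? (N ++ R) σ) * (h σ * ∏ N (λ u → #free R u σ)))
  resample-sizes N R uN N∩R indep h ih = trans
    (cong (k ^ length N *_) (∑-cong Cols λ σ → cong (𝟙 (properOff? R σ) *_)
      (sym (trans (cong (h σ *_) (trans (∏-const 1 N) (^-zeroˡ (length N)))) (*-identityʳ (h σ))))))
    (trans (resample-independent N R uN N∩R indep h ih (λ _ → 1))
      (∑-cong Cols λ σ → cong (λ z → 𝟙 (properOff? (N ++ R) σ) * (h σ * z))
        (∏-cong-∈ N λ _ → ∑-cong (allFin k) λ _ → *-identityʳ _)))

  module _ {Δ ℓ t′ b₀ : ℕ} (par : Parameters k Δ ℓ t′ b₀)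
    (deg≤Δ : ∀ v → length (nbrs v) ≤ Δ)
    (triangle-free : ∀ {v u w} → Edge G v u → Edge G v w → ¬ Edge G u w) where

    open Parameters par

    private
      k≢0 : NonZero k
      k≢0 = >-nonZero (≤-trans (s≤s z≤n) tb₀<k)

    module Step (R : List (Fin n)) {v : Fin n} (v∉R : v ∉ R)
      (IH : ∀ {u} → u ∉ v ∷ R → ℓ * #proper (u ∷ v ∷ R) ≤ k * #proper (v ∷ R)) where

      N : List (Fin n)
      N = filter (λ w → ¬? (w ∈? R)) (nbrs v)

      N-edge : ∀ {u} → u ∈ N → Edge G v u
      N-edge u∈N = ∈-nbrs⁻ (proj₁ (∈-filter⁻ (λ w → ¬? (w ∈? R)) {xs = nbrs v} u∈N))

      N∩R′ : ∀ {u} → u ∈ N → u ∉ v ∷ R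
      N∩R′ u∈N (here refl) = Edge-irrefl (N-edge u∈N)
      N∩R′ u∈N (there u∈R) = proj₂ (∈-filter⁻ (λ w → ¬? (w ∈? R)) {xs = nbrs v} u∈N) u∈R

      N-unique : Unique N
      N-unique = Unique.filter⁺ (λ w → ¬? (w ∈? R)) (nbrs-unique v)

      N-indep : ∀ {u w} → u ∈ N → w ∈ N → ¬ Edge G u w
      N-indep u∈N w∈N = triangle-free (N-edge u∈N) (N-edge w∈N)

      |N|≤Δ : length N ≤ Δ
      |N|≤Δ = ≤-trans (length-filter (λ w → ¬? (w ∈? R)) (nbrs v)) (deg≤Δ v)

      R′ : List (Fin n)
      R′ = v ∷ R

      module At (σ : Colouring n k) = Pointwise par N |N|≤Δ {λ u c → Free R′ u c σ} (λ u c → free? R′ u c σ)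

      unused : Fin k → Colouring n k → ℕ
      unused c σ = ∏ N (λ u → 𝟙 (¬? (lookup σ u ≟ᶠ c)))

      free-unused : ∀ c σ → 𝟙 (free? R v c σ) ≡ unused c σ
      free-unused c σ = trans
        (𝟙-cong (free? R v c σ) (All.all? (λ u → ¬? (lookup σ u ≟ᶠ c)) N)
          (λ f → All.tabulate λ u∈N → f _ (λ u∈R → N∩R′ u∈N (there u∈R)) (N-edge u∈N))
          (λ a w w∉R e → All.lookup a (∈-filter⁺ (λ w → ¬? (w ∈? R)) (∈-nbrs⁺ e) w∉R)))
        (𝟙-all (λ u → ¬? (lookup σ u ≟ᶠ c)) N)

      -- Resampling v counts its free colours. They are listed by colour so that, for each fixed c,
      -- "no neighbour has colour c" is a product over `N` and can be resampled there.
      k#proper : k * #proper R ≡ ∑ (allFin k) (λ c → ∑ Cols (λ σ → 𝟙 (properOff? R′ σ) * unused c σ))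
      k#proper = begin
        k * #proper R
          ≡⟨ cong₂ _*_ (sym (*-identityʳ k)) (∑-cong Cols λ σ → sym (*-identityʳ _)) ⟩
        k ^ 1 * ∑ Cols (λ σ → 𝟙 (properOff? R σ) * 1)
          ≡⟨ resample-sizes (v ∷ []) R ([] ∷ []) (λ { (here refl) → v∉R })
               (λ { (here refl) (here refl) → Edge-irrefl }) (λ _ → 1) (λ _ _ _ → refl) ⟩
        ∑ Cols (λ σ → 𝟙 (properOff? R′ σ) * (1 * (#free R v σ * 1)))
          ≡⟨ ∑-cong Cols (λ σ → cong (𝟙 (properOff? R′ σ) *_)
               (trans (trans (*-identityˡ _) (*-identityʳ _)) (∑-cong (allFin k) λ c → free-unused c σ))) ⟩
        ∑ Cols (λ σ → 𝟙 (properOff? R′ σ) * ∑ (allFin k) (λ c → unused c σ))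
          ≡⟨ ∑-cong Cols (λ σ → *-distribˡ-∑ (𝟙 (properOff? R′ σ)) (allFin k) _) ⟩
        ∑ Cols (λ σ → ∑ (allFin k) (λ c → 𝟙 (properOff? R′ σ) * unused c σ))
          ≡⟨ ∑-swap Cols (allFin k) _ ⟩
        ∑ (allFin k) (λ c → ∑ Cols (λ σ → 𝟙 (properOff? R′ σ) * unused c σ)) ∎
        where open ≡-Reasoning

      w : Colouring n k → ℕ
      w σ = 𝟙 (properOff? (N ++ R′) σ)

      km : ℕ
      km = k ^ length N

      avoiding : km * (k * #proper R) ≡ ∑ Cols (λ σ → w σ * ∑ (allFin k) (λ c → ∏ N (λ u → At.sizeWithout σ u c)))
      avoiding = begin
        km * (k * #proper R)
          ≡⟨ cong (km *_) k#proper ⟩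
        km * ∑ (allFin k) (λ c → ∑ Cols (λ σ → 𝟙 (properOff? R′ σ) * unused c σ))
          ≡⟨ *-distribˡ-∑ km (allFin k) _ ⟩
        ∑ (allFin k) (λ c → km * ∑ Cols (λ σ → 𝟙 (properOff? R′ σ) * unused c σ))
          ≡⟨ ∑-cong (allFin k) (λ c → trans
               (cong (km *_) (∑-cong Cols λ σ → cong (𝟙 (properOff? R′ σ) *_) (sym (*-identityˡ _))))
               (trans (resample-independent N R′ N-unique N∩R′ N-indep (λ _ → 1) (λ _ _ _ → refl) (λ x → 𝟙 (¬? (x ≟ᶠ c))))
                 (∑-cong Cols λ σ → cong (w σ *_) (*-identityˡ _)))) ⟩
        ∑ (allFin k) (λ c → ∑ Cols (λ σ → w σ * ∏ N (λ u → At.sizeWithout σ u c)))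
          ≡⟨ ∑-swap (allFin k) Cols _ ⟩
        ∑ Cols (λ σ → ∑ (allFin k) (λ c → w σ * ∏ N (λ u → At.sizeWithout σ u c)))
          ≡⟨ ∑-cong Cols (λ σ → *-distribˡ-∑ (w σ) (allFin k) _) ⟨
        ∑ Cols (λ σ → w σ * ∑ (allFin k) (λ c → ∏ N (λ u → At.sizeWithout σ u c))) ∎
        where open ≡-Reasoning

      all-colourings : km * #proper R′ ≡ ∑ Cols (λ σ → w σ * ∏ N (At.size σ))
      all-colourings = trans (cong (km *_) (∑-cong Cols λ σ → sym (*-identityʳ _)))
        (trans (resample-sizes N R′ N-unique N∩R′ N-indep (λ _ → 1) (λ _ _ _ → refl))
          (∑-cong Cols λ σ → cong (w σ *_) (*-identityˡ _)))

      small-indep : ∀ {u} x → u ∈ N → ¬ Edge G x u → ∀ σ y → 𝟙 (At.small? (σ [ u ]≔ y) x) ≡ 𝟙 (At.small? σ x)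
      small-indep x u∈N ¬e σ y = 𝟙-cong (At.small? (σ [ _ ]≔ y) x) (At.small? σ x)
        (subst (_< t) (#free-indep ¬e σ y)) (subst (_< t) (sym (#free-indep ¬e σ y)))

      #small-indep : IndepOf N At.#small
      #small-indep u∈N σ y = ∑-cong-∈ N λ {x} x∈N → small-indep x u∈N (N-indep x∈N u∈N) σ y

      smalls : ℕ
      smalls = ∑ Cols (λ σ → 𝟙 (properOff? R′ σ) * At.#small σ)

      small-total : km * smalls ≡ ∑ Cols (λ σ → w σ * (At.#small σ * ∏ N (At.size σ)))
      small-total = resample-sizes N R′ N-unique N∩R′ N-indep At.#small #small-indep

      -- In terms of means, for a random proper colouring of the graph without v: v has at least 2 ℓ
      -- (1 - E[`#small`] / b₀) free colours.
      averaged : 2 * ℓ * b₀ * #proper R′ ≤ b₀ * (k * #proper R) + 2 * ℓ * smalls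
      averaged = *-cancelˡ-≤ km {{m^n≢0 k (length N) {{k≢0}}}} (begin
        km * (2 * ℓ * b₀ * #proper R′)
          ≡⟨ e₁ km (2 * ℓ * b₀) (#proper R′) ⟩
        2 * ℓ * b₀ * (km * #proper R′)
          ≡⟨ cong (2 * ℓ * b₀ *_) all-colourings ⟩
        2 * ℓ * b₀ * ∑ Cols (λ σ → w σ * ∏ N (At.size σ))
          ≡⟨ *-distribˡ-∑ (2 * ℓ * b₀) Cols _ ⟩
        ∑ Cols (λ σ → 2 * ℓ * b₀ * (w σ * ∏ N (At.size σ)))
          ≤⟨ ∑-mono Cols (λ σ → ≤-trans (≤-reflexive (e₁ (2 * ℓ * b₀) (w σ) _))
               (≤-trans (*-monoʳ-≤ (w σ) (At.unused-colours σ)) (≤-reflexive (e₂ (w σ) b₀ _ (2 * ℓ) _ _)))) ⟩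
        ∑ Cols (λ σ → b₀ * (w σ * S σ) + 2 * ℓ * (w σ * (At.#small σ * ∏ N (At.size σ))))
          ≡⟨ ∑-distrib-+ Cols _ _ ⟩
        ∑ Cols (λ σ → b₀ * (w σ * S σ)) + ∑ Cols (λ σ → 2 * ℓ * (w σ * (At.#small σ * ∏ N (At.size σ))))
          ≡⟨ cong₂ _+_ (*-distribˡ-∑ b₀ Cols _) (*-distribˡ-∑ (2 * ℓ) Cols _) ⟨
        b₀ * ∑ Cols (λ σ → w σ * S σ) + 2 * ℓ * ∑ Cols (λ σ → w σ * (At.#small σ * ∏ N (At.size σ)))
          ≡⟨ cong₂ (λ a b → b₀ * a + 2 * ℓ * b) avoiding small-total ⟨
        b₀ * (km * (k * #proper R)) + 2 * ℓ * (km * smalls)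
          ≡⟨ e₃ b₀ km (k * #proper R) (2 * ℓ) smalls ⟩
        km * (b₀ * (k * #proper R) + 2 * ℓ * smalls) ∎)
        where
        open ≤-Reasoning
        S : Colouring n k → ℕ
        S σ = ∑ (allFin k) (λ c → ∏ N (λ u → At.sizeWithout σ u c))
        e₁ : ∀ a b c → a * (b * c) ≡ b * (a * c)
        e₁ = solve-∀
        e₂ : ∀ w b s l m p → w * (b * s + l * m * p) ≡ b * (w * s) + l * (w * (m * p))
        e₂ = solve-∀
        e₃ : ∀ b a c l s → b * (a * c) + l * (a * s) ≡ a * (b * c + l * s)
        e₃ = solve-∀

      -- Resample u. A small list leaves fewer than t choices, whereas by `IH`, in the graph without
      -- v, the list of u has mean size at least ℓ. Hence u is small with probability at most t / ℓ.
      small-at : ∀ {u} → u ∈ N → ℓ * ∑ Cols (λ σ → 𝟙 (properOff? R′ σ) * 𝟙 (At.small? σ u)) ≤ t * #proper R′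
      small-at {u} u∈N = *-cancelˡ-≤ k {{k≢0}} (begin
        k * (ℓ * ∑ Cols (λ σ → 𝟙 (properOff? R′ σ) * 𝟙 (At.small? σ u)))
          ≡⟨ e k ℓ _ ⟩
        ℓ * (k * 1 * ∑ Cols (λ σ → 𝟙 (properOff? R′ σ) * 𝟙 (At.small? σ u)))
          ≡⟨ cong (ℓ *_) (resample-sizes (u ∷ []) R′ ([] ∷ []) (λ { (here refl) → N∩R′ u∈N })
               (λ { (here refl) (here refl) → Edge-irrefl }) (λ σ → 𝟙 (At.small? σ u))
               (λ { (here refl) σ y → small-indep u u∈N Edge-irrefl σ y })) ⟩
        ℓ * ∑ Cols (λ σ → 𝟙 (properOff? (u ∷ R′) σ) * (𝟙 (At.small? σ u) * (#free R′ u σ * 1)))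
          ≤⟨ *-monoʳ-≤ ℓ (∑-mono Cols (λ σ → *-monoʳ-≤ (𝟙 (properOff? (u ∷ R′) σ)) (bound σ))) ⟩
        ℓ * ∑ Cols (λ σ → 𝟙 (properOff? (u ∷ R′) σ) * t)
          ≡⟨ cong (ℓ *_) (*-distribʳ-∑ t Cols _) ⟨
        ℓ * (#proper (u ∷ R′) * t)      ≡⟨ *-assoc ℓ _ t ⟨
        ℓ * #proper (u ∷ R′) * t        ≤⟨ *-monoˡ-≤ t (IH (N∩R′ u∈N)) ⟩
        k * #proper R′ * t              ≡⟨ e′ k _ t ⟩
        k * (t * #proper R′)            ∎)
        where
        open ≤-Reasoning
        e : ∀ k l s → k * (l * s) ≡ l * (k * 1 * s)
        e = solve-∀
        e′ : ∀ k l s → k * l * s ≡ k * (s * l)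
        e′ = solve-∀
        bound : ∀ σ → 𝟙 (At.small? σ u) * (#free R′ u σ * 1) ≤ t
        bound σ = begin
          𝟙 (At.small? σ u) * (#free R′ u σ * 1) ≡⟨ cong (𝟙 (At.small? σ u) *_) (*-identityʳ _) ⟩
          𝟙 (At.small? σ u) * #free R′ u σ       ≤⟨ 𝟙-<-* (At.small? σ u) ⟩
          t * 𝟙 (At.small? σ u)                  ≤⟨ *-monoʳ-≤ t (𝟙≤1 (At.small? σ u)) ⟩
          t * 1                                  ≡⟨ *-identityʳ t ⟩
          t ∎

      smalls-bound : ℓ * smalls ≤ Δ * t * #proper R′
      smalls-bound = begin
        ℓ * smalls
          ≡⟨ cong (ℓ *_) (trans (∑-cong Cols λ σ → *-distribˡ-∑ (𝟙 (properOff? R′ σ)) N _) (∑-swap Cols N _)) ⟩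
        ℓ * ∑ N (λ u → ∑ Cols (λ σ → 𝟙 (properOff? R′ σ) * 𝟙 (At.small? σ u)))
          ≡⟨ *-distribˡ-∑ ℓ N _ ⟩
        ∑ N (λ u → ℓ * ∑ Cols (λ σ → 𝟙 (properOff? R′ σ) * 𝟙 (At.small? σ u)))
          ≤⟨ ∑-bound N _ (t * #proper R′) small-at ⟩
        length N * (t * #proper R′)   ≤⟨ *-monoˡ-≤ (t * #proper R′) |N|≤Δ ⟩
        Δ * (t * #proper R′)          ≡⟨ *-assoc Δ t _ ⟨
        Δ * t * #proper R′            ∎
        where open ≤-Reasoning

      -- The mean of `#small` is at most Δ t / ℓ ≤ b₀ / 2, so half of the 2 ℓ in `averaged`
      -- survives.
      step : ℓ * #proper R′ ≤ k * #proper R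
      step = *-cancelˡ-≤ b₀ {{>-nonZero b₀>0}} (+-cancelʳ-≤ (ℓ * b₀ * #proper R′) _ _ (begin
        b₀ * (ℓ * #proper R′) + ℓ * b₀ * #proper R′     ≡⟨ e₁ b₀ ℓ (#proper R′) ⟩
        2 * ℓ * b₀ * #proper R′                         ≤⟨ averaged ⟩
        b₀ * (k * #proper R) + 2 * ℓ * smalls           ≡⟨ cong (b₀ * (k * #proper R) +_) (*-assoc 2 ℓ smalls) ⟩
        b₀ * (k * #proper R) + 2 * (ℓ * smalls)         ≤⟨ +-monoʳ-≤ (b₀ * (k * #proper R)) (*-monoʳ-≤ 2 smalls-bound) ⟩
        b₀ * (k * #proper R) + 2 * (Δ * t * #proper R′) ≡⟨ cong (b₀ * (k * #proper R) +_) (*-assoc 2 (Δ * t) _) ⟨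
        b₀ * (k * #proper R) + 2 * (Δ * t) * #proper R′ ≤⟨ +-monoʳ-≤ (b₀ * (k * #proper R)) (*-monoˡ-≤ (#proper R′) 2Δt≤ℓb₀) ⟩
        b₀ * (k * #proper R) + ℓ * b₀ * #proper R′      ∎))
        where
        open ≤-Reasoning
        e₁ : ∀ b l p → b * (l * p) + l * b * p ≡ 2 * l * b * p
        e₁ = solve-∀

    -- Induction on the number of vertices outside `R`, bounded by f: the estimate for v uses the
    -- one for its neighbours after v has been deleted too. At f = 0 the list `v ∷ R` would have
    -- more than n distinct entries.
    #proper-grows : ∀ R → Unique R → ∀ {v} → v ∉ R → ℓ * #proper (v ∷ R) ≤ k * #proper R
    #proper-grows R uR = go n R uR (m≤m+n n (length R))
      where
      go : ∀ f R → Unique R → n ≤ f + length R → ∀ {v} → v ∉ R → ℓ * #proper (v ∷ R) ≤ k * #proper R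
      go zero R uR n≤ {v} v∉R = contradiction (≤-trans (Unique-length≤ (fresh v∉R ∷ uR)) n≤) (<-irrefl refl)
        where
        fresh : v ∉ R → All (v ≢_) R
        fresh v∉R = All.tabulate λ { x∈R refl → v∉R x∈R }
      go (suc f) R uR n≤ {v} v∉R = Step.step R v∉R
        (go f (v ∷ R) (All.tabulate (λ { x∈R refl → v∉R x∈R }) ∷ uR) (≤-trans n≤ (≤-reflexive (sym (+-suc f (length R))))))

    #proper-grows* : ∀ S R → Unique (S ++ R) → ℓ ^ length S * #proper (S ++ R) ≤ k ^ length S * #proper R
    #proper-grows* [] R _ = ≤-refl
    #proper-grows* (s ∷ S) R u@(_ ∷ uSR) = begin
      ℓ * ℓ ^ length S * #proper (s ∷ S ++ R)    ≡⟨ e ℓ (ℓ ^ length S) _ ⟩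
      ℓ ^ length S * (ℓ * #proper (s ∷ S ++ R))  ≤⟨ *-monoʳ-≤ (ℓ ^ length S) (#proper-grows (S ++ R) uSR (Unique.Unique[x∷xs]⇒x∉xs u)) ⟩
      ℓ ^ length S * (k * #proper (S ++ R))      ≡⟨ e′ (ℓ ^ length S) k _ ⟩
      k * (ℓ ^ length S * #proper (S ++ R))      ≤⟨ *-monoʳ-≤ k (#proper-grows* S R uSR) ⟩
      k * (k ^ length S * #proper R)             ≡⟨ *-assoc k _ _ ⟨
      k * k ^ length S * #proper R               ∎
      where
      open ≤-Reasoning
      e : ∀ a b c → a * b * c ≡ b * (a * c)
      e = solve-∀
      e′ : ∀ a b c → a * (b * c) ≡ b * (a * c)
      e′ = solve-∀

    -- As `S` is independent, whether its vertices are frozen does not depend on their own colours.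
    -- Given the other colours, a frozen vertex has at most one choice, so resampling bounds the
    -- count by that of proper colourings with `S` deleted, and each deletion gains a factor ℓ by
    -- `#proper-grows*`.
    frozen-set : ∀ S → Unique S → (∀ {u w} → u ∈ S → w ∈ S → ¬ Edge G u w) →
      ℓ ^ length S * ∑ Cols (λ σ → 𝟙 (properOff? [] σ) * 𝟙 (All.all? (frozen? σ) S)) ≤ #proper []
    frozen-set S uS indep = *-cancelˡ-≤ (k ^ length S) {{m^n≢0 k (length S) {{k≢0}}}} (begin
      k ^ length S * (ℓ ^ length S * F)   ≡⟨ e (k ^ length S) (ℓ ^ length S) F ⟩
      ℓ ^ length S * (k ^ length S * F)   ≡⟨ cong (ℓ ^ length S *_) (resample-sizes S [] uS (λ _ ()) indep h h-indep) ⟩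
      ℓ ^ length S * ∑ Cols (λ σ → 𝟙 (properOff? (S ++ []) σ) * (h σ * ∏ S (λ u → #free [] u σ)))
        ≤⟨ *-monoʳ-≤ (ℓ ^ length S) (∑-mono Cols λ σ →
             ≤-trans (*-monoʳ-≤ (𝟙 (properOff? (S ++ []) σ)) (bound σ)) (≤-reflexive (*-identityʳ _))) ⟩
      ℓ ^ length S * #proper (S ++ [])    ≤⟨ #proper-grows* S [] (subst Unique (sym (++-identityʳ S)) uS) ⟩
      k ^ length S * #proper []           ∎)
      where
      open ≤-Reasoning
      h : Colouring n k → ℕ
      h σ = 𝟙 (All.all? (frozen? σ) S)
      F : ℕ
      F = ∑ Cols (λ σ → 𝟙 (properOff? [] σ) * h σ)
      e : ∀ a b c → a * (b * c) ≡ b * (a * c)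
      e = solve-∀
      h-indep : IndepOf S h
      h-indep {u} u∈S σ x = 𝟙-cong (All.all? (frozen? (σ [ u ]≔ x)) S) (All.all? (frozen? σ) S)
        (λ a → All.tabulate λ w∈S → subst (_≤ 1) (#free-indep (indep w∈S u∈S) σ x) (All.lookup a w∈S))
        (λ a → All.tabulate λ w∈S → subst (_≤ 1) (sym (#free-indep (indep w∈S u∈S) σ x)) (All.lookup a w∈S))
      bound : ∀ σ → h σ * ∏ S (λ u → #free [] u σ) ≤ 1
      bound σ with All.all? (frozen? σ) S
      ... | no _  = z≤n
      ... | yes a = ≤-trans (≤-reflexive (*-identityˡ _)) (≤-trans (∏-mono-∈ S (All.lookup a))
                      (≤-reflexive (trans (∏-const 1 S) (^-zeroˡ (length S)))))

-- Non-backtracking walks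

-- The j-th elementary symmetric polynomial of the families, with concatenation as product and union
-- as sum. The families will be the leaf sets of the children, and j the number of stuck ones.
pick : {A : Set} → ℕ → List (List (List A)) → List (List A)
pick zero    _        = [] ∷ []
pick (suc j) []       = []
pick (suc j) (F ∷ Fs) = cartesianProductWith _++_ F (pick j Fs) ++ pick (suc j) Fs

length-cartesianProductWith : {A B C : Set} (f : A → B → C) (xs : List A) (ys : List B) →
  length (cartesianProductWith f xs ys) ≡ length xs * length ys
length-cartesianProductWith f []       ys = refl
length-cartesianProductWith f (x ∷ xs) ys = trans (length-++ (map (f x) ys))
  (cong₂ _+_ (length-map (f x) ys) (length-cartesianProductWith f xs ys))

-- For f = 1 this is (m choose j) ≤ D ^ j * (1 + 1/D) ^ m, where m = length Fs.
length-pick : {A : Set} (D f j : ℕ) (Fs : List (List (List A))) → All (λ F → length F ≤ f) Fs →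
  length (pick j Fs) * D ^ length Fs ≤ (f * D) ^ j * suc D ^ length Fs
length-pick D f zero Fs _ = *-monoʳ-≤ 1 (^-monoˡ-≤ (length Fs) (n≤1+n D))
length-pick D f (suc j) [] _ = z≤n
length-pick D f (suc j) (F ∷ Fs) (F≤f ∷ Fs≤f) = begin
  length (cartesianProductWith _++_ F P ++ Q) * (D * d)
    ≡⟨ cong (_* (D * d)) (trans (length-++ (cartesianProductWith _++_ F P))
         (cong (_+ length Q) (length-cartesianProductWith _++_ F P))) ⟩
  (length F * length P + length Q) * (D * d)          ≡⟨ e₁ (length F) (length P) (length Q) D d ⟩
  length F * (D * (length P * d)) + D * (length Q * d)
    ≤⟨ +-mono-≤ (*-mono-≤ F≤f (*-monoʳ-≤ D (length-pick D f j Fs Fs≤f))) (*-monoʳ-≤ D (length-pick D f (suc j) Fs Fs≤f)) ⟩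
  f * (D * ((f * D) ^ j * s)) + D * (f * D * (f * D) ^ j * s)  ≡⟨ e₂ f D ((f * D) ^ j) s ⟩
  f * D * (f * D) ^ j * (suc D * s) ∎
  where
  open ≤-Reasoning
  P = pick j Fs
  Q = pick (suc j) Fs
  d = D ^ length Fs
  s = suc D ^ length Fs
  e₁ : ∀ a b c D d → (a * b + c) * (D * d) ≡ a * (D * (b * d)) + D * (c * d)
  e₁ = solve-∀
  e₂ : ∀ f D x s → f * (D * (x * s)) + D * (f * D * x * s) ≡ f * D * x * (suc D * s)
  e₂ = solve-∀

pick-any : {A : Set} {Q : A → Set} {B : Set} (F : B → List (List A)) (F? : ∀ w → Dec (Any (All Q) (F w))) →
  ∀ j (ws : List B) → j ≤ length (filter F? ws) → Any (All Q) (pick j (map F ws))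
pick-any F F? zero    ws       _ = here []
pick-any F F? (suc j) (w ∷ ws) j≤ with F? w
... | yes q = Any.++⁺ˡ (Any.cartesianProductWith⁺ _++_ All.++⁺ q (pick-any F F? j ws (≤-pred j≤)))
... | no ¬q = Any.++⁺ʳ (cartesianProductWith _++_ (F w) _) (pick-any F F? (suc j) ws j≤)

-- Short lists of excluded colours and of changed vertices.

module _ {n : ℕ} where

  open import Data.List.Membership.DecPropositional (_≟ᶠ_ {n}) using (_∈?_)

  ∑-∈ : ∀ (xs : List (Fin n)) → ∑ (allFin n) (λ x → 𝟙 (x ∈? xs)) ≤ length xs
  ∑-∈ [] = ≤-reflexive (trans (∑-const 0 (allFin n)) (*-zeroʳ (length (allFin n))))
  ∑-∈ (y ∷ ys) = begin
    ∑ (allFin n) (λ x → 𝟙 (x ∈? (y ∷ ys)))                                ≤⟨ ∑-mono (allFin n) union ⟩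
    ∑ (allFin n) (λ x → 1 * 𝟙 (x ≟ᶠ y) + 𝟙 (x ∈? ys))                     ≡⟨ ∑-distrib-+ (allFin n) _ _ ⟩
    ∑ (allFin n) (λ x → 1 * 𝟙 (x ≟ᶠ y)) + ∑ (allFin n) (λ x → 𝟙 (x ∈? ys)) ≤⟨ +-mono-≤ (≤-reflexive (∑-single y (λ _ → 1))) (∑-∈ ys) ⟩
    suc (length ys) ∎
    where
    open ≤-Reasoning
    union : ∀ x → 𝟙 (x ∈? (y ∷ ys)) ≤ 1 * 𝟙 (x ≟ᶠ y) + 𝟙 (x ∈? ys)
    union x with x ≟ᶠ y | x ∈? ys
    ... | yes _ | yes _ = s≤s z≤n
    ... | yes _ | no  _ = s≤s z≤n
    ... | no  _ | yes _ = s≤s z≤n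
    ... | no  _ | no  _ = z≤n

  outside : ∀ (xs : List (Fin n)) → length xs < n → ∃ (_∉ xs)
  outside xs xs<n with any? (λ c → ¬? (c ∈? xs))
  ... | yes c∉ = c∉
  ... | no ∄   = contradiction (begin-strict
    length xs                              <⟨ xs<n ⟩
    n                                      ≡⟨ length-allFin n ⟨
    length (allFin n)                      ≡⟨ *-identityʳ _ ⟨
    length (allFin n) * 1                  ≡⟨ ∑-const 1 (allFin n) ⟨
    ∑ (allFin n) (λ _ → 1)                 ≡⟨ ∑-cong (allFin n) (λ c → sym (𝟙-yes (c ∈? xs) (covered c))) ⟩
    ∑ (allFin n) (λ c → 𝟙 (c ∈? xs))       ≤⟨ ∑-∈ xs ⟩
    length xs                              ∎) (<-irrefl refl)
    where
    open ≤-Reasoning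
    covered : ∀ c → c ∈ xs
    covered c with c ∈? xs
    ... | yes c∈ = c∈
    ... | no c∉  = contradiction (c , c∉) ∄

  dist≤length : ∀ {k} {σ τ : Colouring n k} (xs : List (Fin n)) →
    (∀ x → x ∉ xs → lookup τ x ≡ lookup σ x) → dist σ τ ≤ length xs
  dist≤length {k} {σ} {τ} xs same = ≤-trans (∑-mono (allFin n) differ) (∑-∈ xs)
    where
    differ : ∀ i → (if does (lookup σ i ≟ᶠ lookup τ i) then 0 else 1) ≤ 𝟙 (i ∈? xs)
    differ i with lookup σ i ≟ᶠ lookup τ i | i ∈? xs
    ... | yes _ | _       = z≤n
    ... | no _  | yes _   = s≤s z≤n
    ... | no σ≢τ | no i∉  = contradiction (sym (same i i∉)) σ≢τ

module Walks {n : ℕ} (k : ℕ) (G : Graph n) (M : ℕ) (girth : ∀ c → IsCycle G c → M < length c) where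

  open Counting k G

  -- Walks rather than paths: prolonging one requires only a look at its first vertices, and the
  -- girth enters once, through `nonBacktracking-unique`.
  data NonBacktracking : List (Fin n) → Set where
    edge : ∀ {x y} → Edge G x y → NonBacktracking (x ∷ y ∷ [])
    cons : ∀ {x y z l} → Edge G x y → x ≢ z → NonBacktracking (y ∷ z ∷ l) → NonBacktracking (x ∷ y ∷ z ∷ l)

  before : ∀ {x : Fin n} {ys} → x ∈ ys → List (Fin n)
  before (here _)          = []
  before (there {x = y} p) = y ∷ before p

  before-⊆ : ∀ {x : Fin n} {ys} (p : x ∈ ys) {P : Fin n → Set} → All P ys → All P (before p)
  before-⊆ (here _)  _        = []
  before-⊆ (there p) (q ∷ qs) = q ∷ before-⊆ p qs

  before-unique : ∀ {x : Fin n} {ys} (p : x ∈ ys) → Unique ys → Unique (before p)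
  before-unique (here _)  _        = []
  before-unique (there p) (q ∷ qs) = before-⊆ p q ∷ before-unique p qs

  before-≢ : ∀ {x : Fin n} {ys} (p : x ∈ ys) → Unique ys → All (x ≢_) (before p)
  before-≢ (here _)  _        = []
  before-≢ (there p) (q ∷ qs) = (λ x≡y → All.lookup q p (sym x≡y)) ∷ before-≢ p qs

  before-length : ∀ {x : Fin n} {ys} (p : x ∈ ys) → length (before p) < length ys
  before-length (here _)  = s≤s z≤n
  before-length (there p) = s≤s (before-length p)

  before-linked : ∀ {x z ys} (p : x ∈ ys) → NonBacktracking (z ∷ ys) → Linked (Edge G) (z ∷ before p ++ [ x ])
  before-linked (here refl)         (edge e)     = e ∷ [-]
  before-linked (here refl)         (cons e _ _) = e ∷ [-]
  before-linked (there p@(here _))  (cons e _ w) = e ∷ before-linked p w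
  before-linked (there p@(there _)) (cons e _ w) = e ∷ before-linked p w

  -- The tail is repetition-free by induction, so a first vertex that recurs would close a cycle
  -- with the stretch before its recurrence. This has at least three vertices, since the walk
  -- neither stays nor turns back, and at most M.
  nonBacktracking-unique : ∀ {xs} → NonBacktracking xs → length xs ≤ M → Unique xs
  nonBacktracking-unique (edge e) _ = ((λ { refl → Edge-irrefl e }) ∷ []) ∷ [] ∷ []
  nonBacktracking-unique {x ∷ xs@(y ∷ z ∷ l)} w@(cons e x≢z w′) len = All.tabulate (λ { p refl → no-return p }) ∷ uxs
    where
    uxs : Unique xs
    uxs = nonBacktracking-unique w′ (<⇒≤ len)
    3≤ : (p : x ∈ xs) → 3 ≤ length (x ∷ before p)
    3≤ (here refl)         = contradiction e Edge-irrefl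
    3≤ (there (here x≡z))  = contradiction x≡z x≢z
    3≤ (there (there p))   = s≤s (s≤s (s≤s z≤n))
    no-return : ¬ x ∈ xs
    no-return p = <⇒≱ (girth (x ∷ before p) (3≤ p , before-≢ p uxs ∷ before-unique p uxs , before-linked p w))
      (≤-trans (s≤s (<⇒≤ (before-length p))) len)

  data Reach : ℕ → Fin n → Fin n → Fin n → Set where
    stop : ∀ {p u} → Reach zero p u u
    step : ∀ {d p u w x} → Edge G u w → w ≢ p → Reach d u w x → Reach (suc d) p u x

  forward : ∀ {d p u x} → Edge G p u → Reach d p u x →
    ∃ λ l → NonBacktracking (p ∷ u ∷ l) × x ∈ u ∷ l × length l ≡ d
  forward e stop = [] , edge e , here refl , refl
  forward e (step e′ w≢p r) with forward e′ r
  ... | l , nb , x∈ , len = _ , cons e (≢-sym w≢p) nb , there x∈ , cong suc len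

  backward : ∀ {d u w x} tail → Reach d u w x → NonBacktracking (w ∷ u ∷ tail) →
    ∃₂ λ s l → NonBacktracking (x ∷ s ∷ l) × (∀ {y} → y ∈ tail → y ∈ l) × length l ≡ d + length tail
  backward {u = u} tail stop nb = u , tail , nb , (λ y∈ → y∈) , refl
  backward {suc d} {u} tail (step e w≢p r) nb with backward (u ∷ tail) r (cons (Edge-sym e) w≢p nb)
  ... | s , l , nb′ , ⊆ , len = s , l , nb′ , ⊆ ∘ there , trans len (+-suc d (length tail))

  Apart : Fin n → Fin n → Set
  Apart x y = x ≢ y × ¬ Edge G x y

  -- The walk from x up to u and down to y does not turn back at u, as w₁ ≠ w₂, so it has no
  -- repetition. An edge between x and y would prolong it by a second y at the front, to d + e + 4
  -- vertices in all.
  branches-apart : ∀ {d e u w₁ w₂ x y} → Edge G u w₁ → Edge G u w₂ → w₁ ≢ w₂ →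
    Reach d u w₁ x → Reach e u w₂ y → d + e + 4 ≤ M → Apart x y
  branches-apart {d} {e} {x = x} {y = y} e₁ e₂ w₁≢w₂ r₁ r₂ small with forward e₂ r₂
  ... | l , nb , y∈ , len with backward _ r₁ (cons (Edge-sym e₁) w₁≢w₂ nb)
  ...   | s , l′ , nb′ , ⊆ , len′ = x≢y , ¬xy
    where
    |l′| : suc (suc (suc (length l′))) ≡ d + e + 4
    |l′| = trans (cong (3 +_) (trans len′ (cong (λ z → d + suc z) len))) (eq d e)
      where
      eq : ∀ d e → 3 + (d + suc e) ≡ d + e + 4
      eq = solve-∀
    len≤ : length (x ∷ s ∷ l′) ≤ M
    len≤ = ≤-trans (n≤1+n _) (≤-trans (≤-reflexive |l′|) small)
    unique : Unique (x ∷ s ∷ l′)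
    unique = nonBacktracking-unique nb′ len≤
    y∈l′ = ⊆ y∈
    x≢y : x ≢ y
    x≢y refl = Unique.Unique[x∷xs]⇒x∉xs unique (there y∈l′)
    ¬xy : ¬ Edge G x y
    ¬xy exy = Unique.Unique[x∷xs]⇒x∉xs
      (nonBacktracking-unique (cons (Edge-sym exy) y≢s nb′) (≤-trans (≤-reflexive |l′|) small))
      (there (there y∈l′))
      where
      y≢s : y ≢ s
      y≢s refl = Unique.Unique[x∷xs]⇒x∉xs (AllPairs.tail unique) y∈l′

  leaves-root : ∀ {d u w x} → Edge G u w → Reach d u w x → d + 2 ≤ M → x ≢ u
  leaves-root {d} e r small x≡u with forward e r
  ... | l , nb , x∈ , len = All.lookup (AllPairs.head (nonBacktracking-unique nb
    (≤-trans (≤-reflexive (trans (cong (2 +_) len) (+-comm 2 d))) small))) x∈ (sym x≡u)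

-- Recolouring along trees

module Trees {n : ℕ} (k : ℕ) (G : Graph n) (M : ℕ) (girth : ∀ c → IsCycle G c → M < length c) (b : ℕ) where

  open Counting k G public
  open Walks k G M girth public

  children : Fin n → Fin n → List (Fin n)
  children p u = filter (λ w → ¬? (w ≟ᶠ p)) (nbrs u)

  ∈-children⁻ : ∀ {p u w} → w ∈ children p u → Edge G u w × w ≢ p
  ∈-children⁻ {p} {u} w∈ with ∈-filter⁻ (λ w → ¬? (w ≟ᶠ p)) {xs = nbrs u} w∈
  ... | w∈nbrs , w≢p = ∈-nbrs⁻ w∈nbrs , w≢p

  ∈-children⁺ : ∀ {p u w} → Edge G u w → w ≢ p → w ∈ children p u
  ∈-children⁺ {p} e w≢p = ∈-filter⁺ (λ w → ¬? (w ≟ᶠ p)) (∈-nbrs⁺ e) w≢p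

  children-unique : ∀ p u → Unique (children p u)
  children-unique p u = Unique.filter⁺ (λ w → ¬? (w ≟ᶠ p)) (nbrs-unique u)

  -- The leaf sets of the b-ary subtrees of depth d below u, seen from its parent p.
  leafSets : ℕ → Fin n → Fin n → List (List (Fin n))
  leafSets zero    p u = [ [ u ] ]
  leafSets (suc d) p u = pick b (map (leafSets d u) (children p u))

  IsLeafSet : ℕ → Fin n → Fin n → List (Fin n) → Set
  IsLeafSet d p u S = All (Reach d p u) S × length S ≡ b ^ d × AllPairs Apart S

  pick-leafSets : ∀ {d u} → d + d + 4 ≤ M → (∀ {w S} → S ∈ leafSets d u w → IsLeafSet d u w S) →
    ∀ ws → Unique ws → All (Edge G u) ws → ∀ j {S} → S ∈ pick j (map (leafSets d u) ws) →
    All (λ x → ∃ λ w → w ∈ ws × Reach d u w x) S × length S ≡ j * b ^ d × AllPairs Apart S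
  pick-leafSets small IH ws _ _ zero (here refl) = [] , refl , []
  pick-leafSets {d} {u} small IH (w ∷ ws) (w∉ws ∷ uws) (e ∷ es) (suc j) S∈
    with ∈-++⁻ (cartesianProductWith _++_ (leafSets d u w) (pick j (map (leafSets d u) ws))) S∈
  ... | inj₂ S∈′ with pick-leafSets small IH ws uws es (suc j) S∈′
  ...   | r , len , ap = All.map (λ (w , w∈ , r) → w , there w∈ , r) r , len , ap
  pick-leafSets {d} {u} small IH (w ∷ ws) (w∉ws ∷ uws) (e ∷ es) (suc j) S∈ | inj₁ S∈′
    with ∈-cartesianProductWith⁻ _++_ (leafSets d u w) (pick j (map (leafSets d u) ws)) S∈′
  ... | S₁ , S₂ , S₁∈ , S₂∈ , refl with IH S₁∈ | pick-leafSets small IH ws uws es j S₂∈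
  ...   | r₁ , len₁ , ap₁ | r₂ , len₂ , ap₂ =
    All.++⁺ (All.map (λ r → w , here refl , r) r₁) (All.map (λ (w , w∈ , r) → w , there w∈ , r) r₂) ,
    trans (length-++ S₁) (cong₂ _+_ len₁ len₂) ,
    AllPairs.++⁺ ap₁ ap₂ (All.map (λ r → All.map (λ (w′ , w′∈ , r′) →
      branches-apart e (All.lookup es w′∈) (All.lookup w∉ws w′∈) r r′ small) r₂) r₁)

  leafSets-sound : ∀ d {p u S} → d + d + 4 ≤ M → S ∈ leafSets d p u → IsLeafSet d p u S
  leafSets-sound zero    small (here refl) = (stop ∷ []) , refl , ([] ∷ [])
  leafSets-sound (suc d) {p} {u} small S∈
    with pick-leafSets small′ (leafSets-sound d small′) (children p u) (children-unique p u)
           (All.tabulate (proj₁ ∘ ∈-children⁻)) b S∈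
    where
    small′ : d + d + 4 ≤ M
    small′ = ≤-trans (+-monoˡ-≤ 4 (+-mono-≤ (n≤1+n d) (n≤1+n d))) small
  ... | r , len , ap = All.map (λ (w , w∈ , r) → step (proj₁ (∈-children⁻ w∈)) (proj₂ (∈-children⁻ w∈)) r) r , len , ap

  -- A witness of being stuck that ranges over a finite list fixed before σ, as the union bound
  -- requires.
  Blocked : ℕ → Fin n → Fin n → Colouring n k → Set
  Blocked d p u σ = Any (All (Frozen σ)) (leafSets d p u)

  blocked? : ∀ d p u σ → Dec (Blocked d p u σ)
  blocked? d p u σ = Any.any? (All.all? (frozen? σ)) (leafSets d p u)

  ball : ℕ → Fin n → Fin n → List (Fin n)
  ball zero    p u = [ u ]
  ball (suc d) p u = u ∷ concatMap (ball d u) (children p u)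

  centre∈ball : ∀ d {p u} → u ∈ ball d p u
  centre∈ball zero    = here refl
  centre∈ball (suc d) = here refl

  ball⇒Reach : ∀ d {p u x} → x ∈ ball d p u → ∃ λ i → i ≤ d × Reach i p u x
  ball⇒Reach zero    (here refl) = zero , z≤n , stop
  ball⇒Reach (suc d) (here refl) = zero , z≤n , stop
  ball⇒Reach (suc d) {p} {u} (there x∈) with find (∈-concatMap⁻ (ball d u) {xs = children p u} x∈)
  ... | w , w∈ , x∈w with ball⇒Reach d x∈w
  ...   | i , i≤d , r = suc i , s≤s i≤d , step (proj₁ (∈-children⁻ w∈)) (proj₂ (∈-children⁻ w∈)) r

  ball-⊆ : ∀ d {p u w x} → w ∈ children p u → x ∈ ball d u w → x ∈ ball (suc d) p u
  ball-⊆ d {u = u} w∈ x∈ = there (∈-concatMap⁺ (ball d u) (lose w∈ x∈))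

  record Moved (τ : Colouring n k) (xs : List (Fin n)) : Set where
    constructor moved
    field
      τ′     : Colouring n k
      proper : Proper G τ′
      path   : SameCluster G 1 τ τ′
      fixed  : ∀ x → x ∉ xs → lookup τ′ x ≡ lookup τ x
  open Moved

  recolour-proper : ∀ (τ : Colouring n k) {u c} → Proper G τ → (∀ w → Edge G u w → lookup τ w ≢ c) → Proper G (τ [ u ]≔ c)
  recolour-proper τ {u} {c} prop fr i j e eq with i ≟ᶠ u | j ≟ᶠ u
  ... | yes refl | yes refl = Edge-irrefl e
  ... | yes refl | no j≢u   = fr j e (trans (sym (lookup-update′ τ c j≢u)) (trans (sym eq) (lookup-update τ u c)))
  ... | no i≢u   | yes refl = fr i (Edge-sym e) (trans (sym (lookup-update′ τ c i≢u)) (trans eq (lookup-update τ u c)))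
  ... | no i≢u   | no j≢u   = prop i j e (trans (sym (lookup-update′ τ c i≢u)) (trans eq (lookup-update′ τ c j≢u)))

  recolour-step : ∀ {τ : Colouring n k} {u c} → Proper G τ → (∀ w → Edge G u w → lookup τ w ≢ c) → SameCluster G 1 τ (τ [ u ]≔ c)
  recolour-step {τ} {u} {c} prop fr with lookup τ u ≟ᶠ c
  ... | yes refl = subst (SameCluster G 1 τ) (sym ([]≔-lookup τ u)) done
  ... | no τu≢c = (prop , recolour-proper τ prop fr ,
        (λ eq → τu≢c (trans (cong (λ z → lookup z u) eq) (lookup-update τ u c))) ,
        dist≤length {σ = τ} {τ = τ [ u ]≔ c} (u ∷ []) (λ x x∉ → lookup-update′ τ c (λ x≡u → x∉ (here x≡u)))) ◅ done

  finish : ∀ {τ : Colouring n k} {xs} (m : Moved τ xs) {u c} → (∀ w → Edge G u w → lookup (τ′ m) w ≢ c) →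
    Σ (Moved τ (u ∷ xs)) λ m′ → lookup (τ′ m′) u ≡ c
  finish m {u} {c} fr = moved (τ′ m [ u ]≔ c) (recolour-proper (τ′ m) (proper m) fr) (path m ◅◅ recolour-step (proper m) fr)
      (λ x x∉ → trans (lookup-update′ (τ′ m) c (x∉ ∘ here)) (fixed m x (x∉ ∘ there)))
    , lookup-update (τ′ m) u c

  unfrozen : ∀ σ u a → ¬ Frozen σ u → ∃ λ c → c ≢ a × Free [] u c σ
  unfrozen σ u a ¬fr with any? (λ c → ¬? (c ≟ᶠ a) ×-dec free? [] u c σ)
  ... | yes r = r
  ... | no ∄  = contradiction (begin
    #free [] u σ                             ≤⟨ ∑-mono (allFin k) (λ c → 𝟙-mono (free? [] u c σ) (c ≟ᶠ a) (only c)) ⟩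
    ∑ (allFin k) (λ c → 𝟙 (c ≟ᶠ a))          ≡⟨ ∑-cong (allFin k) (λ c → sym (*-identityˡ _)) ⟩
    ∑ (allFin k) (λ c → 1 * 𝟙 (c ≟ᶠ a))      ≡⟨ ∑-single a (λ _ → 1) ⟩
    1                                        ∎) ¬fr
    where
    open ≤-Reasoning
    only : ∀ c → Free [] u c σ → c ≡ a
    only c f with c ≟ᶠ a
    ... | yes eq = eq
    ... | no c≢a = contradiction (c , c≢a , f) ∄

  module _ (b+2≤k : b + 2 ≤ k) (σ : Colouring n k) where

    -- `τ` must agree with `σ` one level deeper than it may change: a leaf takes a colour that is
    -- free in `σ`, which is usable only if its own children still have their colours from `σ`.
    -- Elsewhere `τ` may differ, since other branches may already have moved.
    move : ∀ d {p u τ} → d + d + 6 ≤ M → Edge G p u → ¬ Blocked d p u σ → Proper G τ →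
      lookup τ p ≡ lookup σ p → (∀ {x} → x ∈ ball (suc d) p u → lookup τ x ≡ lookup σ x) →
      Σ (Moved τ (ball d p u)) λ m → lookup (τ′ m) u ≢ lookup σ u

    -- Only the children coloured c move, one after another. The ball changed below one child is
    -- disjoint from the larger ball inspected below the next, so the hypotheses of `move` survive.
    moveAll : ∀ d {u c τ} ws → d + d + 6 ≤ M → Unique ws → All (Edge G u) ws →
      (∀ {w} → w ∈ ws → lookup σ w ≡ c → ¬ Blocked d u w σ) → Proper G τ →
      lookup τ u ≡ lookup σ u → (∀ {w x} → w ∈ ws → x ∈ ball (suc d) u w → lookup τ x ≡ lookup σ x) →
      Σ (Moved τ (concatMap (ball d u) ws)) λ m → ∀ {w} → w ∈ ws → lookup (τ′ m) w ≢ c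

    move zero {p} {u} {τ} small e ¬bl prop τp τball with unfrozen σ u (lookup σ u) (λ fr → ¬bl (here (fr ∷ [])))
    ... | c , c≢σu , free with finish (moved τ prop done (λ _ _ → refl)) {u} {c} avoid
      where
      avoid : ∀ w → Edge G u w → lookup τ w ≢ c
      avoid w e τw≡c with w ≟ᶠ p
      ... | yes refl = free w (λ ()) e (trans (sym τp) τw≡c)
      ... | no w≢p   = free w (λ ()) e (trans (sym (τball (ball-⊆ zero (∈-children⁺ e w≢p) (here refl)))) τw≡c)
    ...   | m , eq = m , λ eq′ → c≢σu (trans (sym eq) eq′)
    move (suc d) {p} {u} {τ} small e ¬bl prop τp τball = result
      where
      bl? : ∀ w → Dec (Blocked d u w σ)
      bl? w = blocked? d u w σ
      blockedChildren : List (Fin n)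
      blockedChildren = filter bl? (children p u)
      few : length blockedChildren < b
      few = ≰⇒> λ b≤ → ¬bl (pick-any (leafSets d u) bl? b (children p u) b≤)
      -- Parent, own colour and at most b - 1 blocked children exclude at most b + 1 < k colours.
      -- All children with the colour c left over are unblocked and can vacate it.
      forbidden : List (Fin k)
      forbidden = lookup σ p ∷ lookup σ u ∷ map (lookup σ) blockedChildren
      choice : ∃ (_∉ forbidden)
      choice = outside forbidden (≤-trans (s≤s (s≤s (s≤s (≤-reflexive (length-map (lookup σ) blockedChildren)))))
        (≤-trans (s≤s (s≤s few)) (≤-trans (≤-reflexive (+-comm 2 b)) b+2≤k)))
      c = proj₁ choice
      c∉ = proj₂ choice
      small′ : d + d + 6 ≤ M
      small′ = ≤-trans (+-monoˡ-≤ 6 (+-mono-≤ (n≤1+n d) (n≤1+n d))) small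
      τu : lookup τ u ≡ lookup σ u
      τu = τball (centre∈ball (suc (suc d)))
      all-moved : Σ (Moved τ (concatMap (ball d u) (children p u))) λ m → ∀ {w} → w ∈ children p u → lookup (τ′ m) w ≢ c
      all-moved = moveAll d (children p u) small′ (children-unique p u) (All.tabulate (proj₁ ∘ ∈-children⁻))
        (λ w∈ σw≡c bl → c∉ (there (there (subst (_∈ map (lookup σ) blockedChildren) σw≡c
          (∈-map⁺ (lookup σ) (∈-filter⁺ bl? w∈ bl))))))
        prop τu (λ w∈ x∈ → τball (ball-⊆ (suc d) w∈ x∈))
      -- The parent is itself a branch at u, of depth 0, hence outside the balls below the children.
      p∉ : p ∉ concatMap (ball d u) (children p u)
      p∉ p∈ with find (∈-concatMap⁻ (ball d u) {xs = children p u} p∈)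
      ... | w , w∈ , p∈w with ball⇒Reach d p∈w
      ...   | i , i≤d , r = proj₁ (branches-apart (proj₁ (∈-children⁻ w∈)) (Edge-sym e) (proj₂ (∈-children⁻ w∈)) r stop
                (≤-trans (+-mono-≤ (+-mono-≤ i≤d (z≤n {d})) (s≤s (s≤s (s≤s (s≤s (z≤n {2})))))) small′)) refl
      avoid : ∀ w → Edge G u w → lookup (τ′ (proj₁ all-moved)) w ≢ c
      avoid w e′ with w ≟ᶠ p
      ... | yes refl = λ eq → c∉ (here (trans (sym eq) (trans (fixed (proj₁ all-moved) p p∉) τp)))
      ... | no w≢p   = proj₂ all-moved (∈-children⁺ e′ w≢p)
      result : Σ (Moved τ (ball (suc d) p u)) λ m → lookup (τ′ m) u ≢ lookup σ u
      result with finish (proj₁ all-moved) avoid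
      ... | m , eq = m , λ eq′ → c∉ (there (here (trans (sym eq) eq′)))

    moveAll d {u} {c} {τ} [] small _ _ _ prop _ _ = moved τ prop done (λ _ _ → refl) , λ ()
    moveAll d {u} {c} {τ} (w ∷ ws) small (w∉ws ∷ uws) (e ∷ es) ok prop τu τballs = result
      where
      first : Σ (Moved τ (ball d u w)) λ m → lookup (τ′ m) w ≢ c
      first with lookup σ w ≟ᶠ c
      ... | no σw≢c = moved τ prop done (λ _ _ → refl) , λ eq → σw≢c (trans (sym (τballs (here refl) (here refl))) eq)
      ... | yes σw≡c with move d small e (ok (here refl) σw≡c) prop τu (τballs (here refl))
      ...   | m , ≢ = m , λ eq → ≢ (trans eq (sym σw≡c))
      m₁ = proj₁ first
      room : ∀ {i j} → i ≤ d → j ≤ suc d → i + j + 4 ≤ M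
      room i≤d j≤1+d = ≤-trans (+-monoˡ-≤ 4 (+-mono-≤ i≤d j≤1+d)) (≤-trans (m≤m+n _ 1) (≤-trans (≤-reflexive (eq d)) small))
        where
        eq : ∀ d → d + suc d + 4 + 1 ≡ d + d + 6
        eq = solve-∀
      separate : ∀ {w′ x} → w′ ∈ ws → x ∈ ball (suc d) u w′ → x ∉ ball d u w
      separate w′∈ x∈ x∈′ with ball⇒Reach (suc d) x∈ | ball⇒Reach d x∈′
      ... | j , j≤ , r | i , i≤ , r′ =
        proj₁ (branches-apart e (All.lookup es w′∈) (All.lookup w∉ws w′∈) r′ r (room i≤ j≤)) refl
      u∉ : u ∉ ball d u w
      u∉ u∈ with ball⇒Reach d u∈
      ... | i , i≤ , r = leaves-root e r (≤-trans (+-mono-≤ (≤-trans i≤ (m≤m+n d d)) (s≤s (s≤s (z≤n {4})))) small) refl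
      rest : Σ (Moved (τ′ m₁) (concatMap (ball d u) ws)) λ m → ∀ {w} → w ∈ ws → lookup (τ′ m) w ≢ c
      rest = moveAll d ws small uws es (ok ∘ there) (proper m₁) (trans (fixed m₁ u u∉) τu)
        (λ w′∈ x∈ → trans (fixed m₁ _ (separate w′∈ x∈)) (τballs (there w′∈) x∈))
      m₂ = proj₁ rest
      w∉ : w ∉ concatMap (ball d u) ws
      w∉ w∈ with find (∈-concatMap⁻ (ball d u) {xs = ws} w∈)
      ... | w′ , w′∈ , w∈′ with ball⇒Reach d w∈′
      ...   | j , j≤ , r = proj₁ (branches-apart e (All.lookup es w′∈) (All.lookup w∉ws w′∈) (stop {u} {w}) r (room z≤n (≤-trans j≤ (n≤1+n d)))) refl
      result : Σ (Moved τ (concatMap (ball d u) (w ∷ ws))) λ m → ∀ {w′} → w′ ∈ w ∷ ws → lookup (τ′ m) w′ ≢ c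
      result = moved (τ′ m₂) (proper m₂) (path m₁ ◅◅ path m₂)
          (λ x x∉ → trans (fixed m₂ x (x∉ ∘ ∈-++⁺ʳ (ball d u w))) (fixed m₁ x (x∉ ∘ ∈-++⁺ˡ)))
        , λ { (here refl) eq → proj₂ first (trans (sym (fixed m₂ w w∉)) eq)
            ; (there w′∈) → proj₂ rest w′∈ }

    -- At the root no parent has to be respected and no neighbour is blocked, so every target colour
    -- can be vacated.
    attain : ∀ d → d + d + 6 ≤ M → (∀ p u → ¬ Blocked d p u σ) → Proper G σ → ∀ v j →
      Σ (Moved σ (v ∷ concatMap (ball d v) (nbrs v))) λ m → lookup (τ′ m) v ≡ j
    attain d small good prop v j
      with moveAll d {c = j} (nbrs v) small (nbrs-unique v) (All.tabulate ∈-nbrs⁻) (λ _ _ → good v _) prop refl (λ _ _ → refl)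
    ... | m , avoid = finish m (λ w e → avoid (∈-nbrs⁺ e))

-- Probabilities

allColourings-unique : ∀ n k → Unique (allColourings n k)
allColourings-unique zero    k = [] ∷ []
allColourings-unique (suc n) k = Unique.concat⁺
  (All.map⁺ (All.tabulate λ _ → Unique.map⁺ (proj₂ ∘ ∷-injective) (allColourings-unique n k)))
  (AllPairs.map⁺ (AllPairs.map disjoint (Unique.allFin⁺ k)))
  where
  disjoint : ∀ {c c′ : Fin k} → c ≢ c′ → ∀ {v} →
    ¬ (v ∈ map (c Vec.∷_) (allColourings n k) × v ∈ map (c′ Vec.∷_) (allColourings n k))
  disjoint {c} {c′} c≢c′ (v∈ , v∈′) with ∈-map⁻ (c Vec.∷_) v∈ | ∈-map⁻ (c′ Vec.∷_) v∈′
  ... | _ , _ , refl | _ , _ , eq = c≢c′ (proj₁ (∷-injective eq))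

and-map⁺ : ∀ {A : Set} (f : A → Bool) xs → (∀ x → f x ≡ true) → and (map f xs) ≡ true
and-map⁺ f []       h = refl
and-map⁺ f (x ∷ xs) h rewrite h x = and-map⁺ f xs h

and-map⁻ : ∀ {A : Set} (f : A → Bool) xs → and (map f xs) ≡ true → ∀ {x} → x ∈ xs → f x ≡ true
and-map⁻ f (x ∷ xs) eq p with f x in fx
and-map⁻ f (x ∷ xs) eq (here refl) | true = fx
and-map⁻ f (x ∷ xs) eq (there p)   | true = and-map⁻ f xs eq p

length-filterᵇ : ∀ {A : Set} (f : A → Bool) (g : A → ℕ) xs → (∀ x → (if f x then 1 else 0) ≡ g x) → length (filterᵇ f xs) ≡ ∑ xs g
length-filterᵇ f g []       h = refl
length-filterᵇ f g (x ∷ xs) h with f x | h x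
... | true  | eq = cong₂ _+_ eq (length-filterᵇ f g xs h)
... | false | eq = cong₂ _+_ eq (length-filterᵇ f g xs h)

module _ {n : ℕ} (k : ℕ) (G : Graph n) where

  open Counting k G

  properᵇ⇒Proper : (σ : Colouring n k) → properᵇ G σ ≡ true → Proper G σ
  properᵇ⇒Proper σ eq i j e with adj G i j | lookup σ i ≟ᶠ lookup σ j
                            | and-map⁻ _ (allFin n) (and-map⁻ _ (allFin n) eq (∈-allFin i)) (∈-allFin j)
  ... | true | no ≢ | _ = ≢

  Proper⇒properᵇ : (σ : Colouring n k) → Proper G σ → properᵇ G σ ≡ true
  Proper⇒properᵇ σ prop = and-map⁺ _ (allFin n) λ i → and-map⁺ _ (allFin n) λ j → go i j
    where
    go : ∀ i j → not (adj G i j ∧ does (lookup σ i ≟ᶠ lookup σ j)) ≡ true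
    go i j with adj G i j in e | lookup σ i ≟ᶠ lookup σ j
    ... | false | _      = refl
    ... | true  | no _   = refl
    ... | true  | yes eq = contradiction eq (prop i j e)

  numProper≡#proper : numProper G k ≡ #proper []
  numProper≡#proper = length-filterᵇ (properᵇ G) _ Cols indicator
    where
    indicator : ∀ σ → (if properᵇ G σ then 1 else 0) ≡ 𝟙 (properOff? [] σ)
    indicator σ with properᵇ G σ in eq
    ... | true  = sym (𝟙-yes (properOff? [] σ) (λ i j _ _ → properᵇ⇒Proper σ eq i j))
    ... | false = sym (𝟙-no (properOff? [] σ) λ p → contradiction (trans (sym eq) (Proper⇒properᵇ σ (λ i j → p i j (λ ()) (λ ())))) λ ())

  degree≡length-nbrs : ∀ v → degree G v ≡ length (nbrs v)
  degree≡length-nbrs v = sym (trans (length-filter-𝟙 (edge? v) (allFin n)) (∑-cong (allFin n) indicator))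
    where
    indicator : ∀ w → 𝟙 (edge? v w) ≡ (if adj G v w then 1 else 0)
    indicator w with adj G v w
    ... | true  = refl
    ... | false = refl

length-concatMap≤ : ∀ {A B : Set} (f : A → List B) c xs → (∀ x → length (f x) ≤ c) → length (concatMap f xs) ≤ length xs * c
length-concatMap≤ f c []       h = z≤n
length-concatMap≤ f c (x ∷ xs) h = ≤-trans (≤-reflexive (length-++ (f x))) (+-mono-≤ (h x) (length-concatMap≤ f c xs h))

leafBound : (D b d : ℕ) → ℕ
leafBound D b zero    = 1
leafBound D b (suc d) = (16 * (leafBound D b d * D)) ^ b

-- The extra factor a = (16 D)² makes the induction close: one more level raises 16 D times the
-- bound to the power b, and a ≤ (16 D)^b because b ≥ 2.
leafBound≤ : ∀ {D b} → 0 < D → 2 ≤ b → ∀ d → let a = 16 * D * (16 * D) in a * leafBound D b d ≤ a ^ (b ^ d)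
leafBound≤ {D} {b} D>0 2≤b zero    = ≤-refl
leafBound≤ {D} {b} D>0 2≤b (suc d) = begin
  a * (16 * (f * D)) ^ b           ≡⟨ cong (λ z → a * z ^ b) (e₁ f D) ⟩
  a * (c * f) ^ b                  ≡⟨ cong (a *_) (^-distribʳ-* c f b) ⟩
  a * (c ^ b * f ^ b)              ≤⟨ *-monoˡ-≤ (c ^ b * f ^ b) a≤c^b ⟩
  c ^ b * (c ^ b * f ^ b)          ≡⟨ *-assoc (c ^ b) _ _ ⟨
  c ^ b * c ^ b * f ^ b            ≡⟨ cong (_* f ^ b) (^-distribʳ-* c c b) ⟨
  a ^ b * f ^ b                    ≡⟨ ^-distribʳ-* a f b ⟨
  (a * f) ^ b                      ≤⟨ ^-monoˡ-≤ b (leafBound≤ D>0 2≤b d) ⟩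
  (a ^ (b ^ d)) ^ b                ≡⟨ ^-*-assoc a (b ^ d) b ⟩
  a ^ (b ^ d * b)                  ≡⟨ cong (a ^_) (*-comm (b ^ d) b) ⟩
  a ^ (b * b ^ d)                  ∎
  where
  open ≤-Reasoning
  c = 16 * D
  a = c * c
  f = leafBound D b d
  e₁ : ∀ f D → 16 * (f * D) ≡ 16 * D * f
  e₁ = solve-∀
  a≤c^b : a ≤ c ^ b
  a≤c^b = ≤-trans (≤-reflexive (cong (c *_) (sym (*-identityʳ c))))
    (^-monoʳ-≤ c {{m*n≢0 16 D {{_}} {{>-nonZero D>0}}}} 2≤b)

module Probability {n : ℕ} (k : ℕ) (G : Graph n) (M : ℕ) (girth : ∀ c → IsCycle G c → M < length c)
  {Δ ℓ t′ b₀ D b : ℕ} (par : Parameters k Δ ℓ t′ b₀)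
  (deg≤Δ : ∀ v → degree G v ≤ Δ)
  (D>0 : 0 < D) (2≤b : 2 ≤ b) (b+2≤k : b + 2 ≤ k)
  (binomial : ∀ m → m ≤ Δ → suc D ^ m ≤ 16 ^ b * D ^ m)
  (2a≤ℓ : 2 * (16 * D * (16 * D)) ≤ ℓ)
  (d : ℕ) (short : d + d + 6 ≤ M) where

  open Trees k G M girth b

  private
    a : ℕ
    a = 16 * D * (16 * D)

    nbrs≤Δ : ∀ v → length (nbrs v) ≤ Δ
    nbrs≤Δ v = subst (_≤ Δ) (degree≡length-nbrs k G v) (deg≤Δ v)

    children≤Δ : ∀ p u → length (children p u) ≤ Δ
    children≤Δ p u = ≤-trans (length-filter (λ w → ¬? (w ≟ᶠ p)) (nbrs u)) (nbrs≤Δ u)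

  triangle-free : ∀ {v u w} → Edge G v u → Edge G v w → ¬ Edge G u w
  triangle-free {v} {u} {w} e e′ with u ≟ᶠ w
  ... | yes refl = Edge-irrefl
  ... | no u≢w   = proj₂ (branches-apart e e′ u≢w stop stop
    (≤-trans (m≤m+n 4 2) (≤-trans (m≤n+m 6 (d + d)) short)))

  length-leafSets : ∀ d p u → length (leafSets d p u) ≤ leafBound D b d
  length-leafSets zero    p u = ≤-refl
  length-leafSets (suc d) p u = *-cancelʳ-≤ _ _ (D ^ m) {{m^n≢0 D m {{>-nonZero D>0}}}} (begin
    length (pick b Fs) * D ^ m             ≤⟨ length-pick D f b Fs (All.map⁺ (All.tabulate λ {w} _ → length-leafSets d u w)) ⟩
    (f * D) ^ b * suc D ^ m                ≤⟨ *-monoʳ-≤ ((f * D) ^ b) (binomial m m≤Δ) ⟩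
    (f * D) ^ b * (16 ^ b * D ^ m)         ≡⟨ e ((f * D) ^ b) (16 ^ b) (D ^ m) ⟩
    16 ^ b * (f * D) ^ b * D ^ m           ≡⟨ cong (_* D ^ m) (^-distribʳ-* 16 (f * D) b) ⟨
    (16 * (f * D)) ^ b * D ^ m             ∎)
    where
    open ≤-Reasoning
    Fs = map (leafSets d u) (children p u)
    m = length Fs
    f = leafBound D b d
    m≤Δ : m ≤ Δ
    m≤Δ = ≤-trans (≤-reflexive (length-map (leafSets d u) (children p u))) (children≤Δ p u)
    e : ∀ x y z → x * (y * z) ≡ y * x * z
    e = solve-∀

  #blocked : Fin n → Fin n → ℕ
  #blocked p u = ∑ Cols (λ σ → 𝟙 (properOff? [] σ) * 𝟙 (blocked? d p u σ))

  -- Union bound over at most a^X leaf sets with X = b^d leaves each: every one is entirely frozen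
  -- with probability at most ℓ^(-X) ≤ (2 a)^(-X), which leaves 2^(-X).
  blocked-rare : ∀ p u → 2 ^ (b ^ d) * #blocked p u ≤ #proper []
  blocked-rare p u = *-cancelˡ-≤ (a ^ X) {{m^n≢0 a X {{a≢0}}}} (begin
    a ^ X * (2 ^ X * #blocked p u)              ≡⟨ e (a ^ X) (2 ^ X) _ ⟩
    2 ^ X * a ^ X * #blocked p u                ≡⟨ cong (_* #blocked p u) (^-distribʳ-* 2 a X) ⟨
    (2 * a) ^ X * #blocked p u                  ≤⟨ *-mono-≤ (^-monoˡ-≤ X 2a≤ℓ) union ⟩
    ℓ ^ X * ∑ (leafSets d p u) F                ≡⟨ *-distribˡ-∑ (ℓ ^ X) (leafSets d p u) F ⟩
    ∑ (leafSets d p u) (λ S → ℓ ^ X * F S)      ≤⟨ ∑-bound (leafSets d p u) _ (#proper []) each ⟩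
    length (leafSets d p u) * #proper []        ≤⟨ *-monoˡ-≤ (#proper []) (≤-trans (length-leafSets d p u)
                                                     (≤-trans (m≤n*m _ a {{a≢0}}) (leafBound≤ D>0 2≤b d))) ⟩
    a ^ X * #proper []                          ∎)
    where
    open ≤-Reasoning
    X = b ^ d
    a≢0 : NonZero a
    a≢0 = m*n≢0 (16 * D) (16 * D) {{m*n≢0 16 D {{_}} {{>-nonZero D>0}}}} {{m*n≢0 16 D {{_}} {{>-nonZero D>0}}}}
    e : ∀ x y z → x * (y * z) ≡ y * x * z
    e = solve-∀
    F : List (Fin n) → ℕ
    F S = ∑ Cols (λ σ → 𝟙 (properOff? [] σ) * 𝟙 (All.all? (frozen? σ) S))
    union : #blocked p u ≤ ∑ (leafSets d p u) F
    union = ≤-trans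
      (∑-mono Cols λ σ → ≤-trans (*-monoʳ-≤ (𝟙 (properOff? [] σ)) (𝟙-any (All.all? (frozen? σ)) (leafSets d p u)))
        (≤-reflexive (*-distribˡ-∑ (𝟙 (properOff? [] σ)) (leafSets d p u) _)))
      (≤-reflexive (∑-swap Cols (leafSets d p u) _))
    each : ∀ {S} → S ∈ leafSets d p u → ℓ ^ X * F S ≤ #proper []
    each {S} S∈ with leafSets-sound d (≤-trans (+-monoʳ-≤ (d + d) (m≤m+n 4 2)) short) S∈
    ... | _ , len , apart = subst (λ z → ℓ ^ z * F S ≤ #proper []) len
      (frozen-set par nbrs≤Δ triangle-free S (AllPairs.map proj₁ apart) independent)
      where
      separated : ∀ {S} → AllPairs Apart S → ∀ {u w} → u ∈ S → w ∈ S → ¬ Edge G u w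
      separated (_ ∷ _)  (here refl) (here refl) = Edge-irrefl
      separated (p ∷ _)  (here refl) (there w∈)  = proj₂ (All.lookup p w∈)
      separated (p ∷ _)  (there u∈)  (here refl) = proj₂ (All.lookup p u∈) ∘ Edge-sym
      separated (_ ∷ ps) (there u∈)  (there w∈)  = separated ps u∈ w∈
      independent : ∀ {u w} → u ∈ S → w ∈ S → ¬ Edge G u w
      independent = separated apart

  Unblocked : Colouring n k → Set
  Unblocked σ = ∀ p u → ¬ Blocked d p u σ

  unblocked? : ∀ σ → Dec (Unblocked σ)
  unblocked? σ = all? λ p → all? λ u → ¬? (blocked? d p u σ)

  #unblocked : ℕ
  #unblocked = ∑ Cols (λ σ → 𝟙 (properOff? [] σ) * 𝟙 (unblocked? σ))

  cover : ∀ σ → 1 ≤ 𝟙 (unblocked? σ) + ∑ (allFin n) (λ p → ∑ (allFin n) (λ u → 𝟙 (blocked? d p u σ)))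
  cover σ with any? (λ p → any? (λ u → blocked? d p u σ))
  ... | yes (p , u , bl) = ≤-trans (≤-reflexive (sym (𝟙-yes (blocked? d p u σ) bl)))
          (≤-trans (term≤∑ (λ u → 𝟙 (blocked? d p u σ)) (∈-allFin u))
            (≤-trans (term≤∑ (λ p → ∑ (allFin n) (λ u → 𝟙 (blocked? d p u σ))) (∈-allFin p)) (m≤n+m _ _)))
  ... | no ∄ = ≤-trans (≤-reflexive (sym (𝟙-yes (unblocked? σ) (λ p u bl → ∄ (p , u , bl))))) (m≤m+n _ _)

  #proper≤ : #proper [] ≤ #unblocked + ∑ (allFin n) (λ p → ∑ (allFin n) (λ u → #blocked p u))
  #proper≤ = begin
    #proper []
      ≤⟨ ∑-mono Cols (λ σ → ≤-trans (≤-reflexive (sym (*-identityʳ (χ σ)))) (≤-trans (*-monoʳ-≤ (χ σ) (cover σ))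
           (≤-reflexive (trans (*-distribˡ-+ (χ σ) _ _) (cong (χ σ * 𝟙 (unblocked? σ) +_)
             (trans (*-distribˡ-∑ (χ σ) (allFin n) _) (∑-cong (allFin n) λ p → *-distribˡ-∑ (χ σ) (allFin n) _))))))) ⟩
    ∑ Cols (λ σ → χ σ * 𝟙 (unblocked? σ) + ∑ (allFin n) (λ p → ∑ (allFin n) (λ u → χ σ * 𝟙 (blocked? d p u σ))))
      ≡⟨ ∑-distrib-+ Cols _ _ ⟩
    #unblocked + ∑ Cols (λ σ → ∑ (allFin n) (λ p → ∑ (allFin n) (λ u → χ σ * 𝟙 (blocked? d p u σ))))
      ≡⟨ cong (#unblocked +_) (trans (∑-swap Cols (allFin n) _) (∑-cong (allFin n) λ p → ∑-swap Cols (allFin n) _)) ⟩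
    #unblocked + ∑ (allFin n) (λ p → ∑ (allFin n) (λ u → #blocked p u)) ∎
    where
    open ≤-Reasoning
    χ : Colouring n k → ℕ
    χ σ = 𝟙 (properOff? [] σ)

  -- Union bound over all n² ordered pairs (p, u), adjacent or not: failure has probability at most
  -- n² / 2^(b^d) ≤ 1 / (m + 1).
  unblocked-likely : ∀ m → suc m * (n * n) ≤ 2 ^ (b ^ d) → m * #proper [] ≤ suc m * #unblocked
  unblocked-likely m enough = +-cancelˡ-≤ P _ _ (begin
    suc m * P                     ≤⟨ *-monoʳ-≤ (suc m) #proper≤ ⟩
    suc m * (#unblocked + B)      ≡⟨ *-distribˡ-+ (suc m) #unblocked B ⟩
    suc m * #unblocked + suc m * B ≤⟨ +-monoʳ-≤ (suc m * #unblocked) rare ⟩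
    suc m * #unblocked + P        ≡⟨ +-comm _ P ⟩
    P + suc m * #unblocked        ∎)
    where
    open ≤-Reasoning
    P = #proper []
    B = ∑ (allFin n) (λ p → ∑ (allFin n) (λ u → #blocked p u))
    Y = 2 ^ (b ^ d)
    Y*B : Y * B ≤ n * n * P
    Y*B = begin
      Y * B
        ≡⟨ trans (*-distribˡ-∑ Y (allFin n) _) (∑-cong (allFin n) λ p → *-distribˡ-∑ Y (allFin n) _) ⟩
      ∑ (allFin n) (λ p → ∑ (allFin n) (λ u → Y * #blocked p u))
        ≤⟨ ∑-mono (allFin n) (λ p → ∑-mono (allFin n) (λ u → blocked-rare p u)) ⟩
      ∑ (allFin n) (λ p → ∑ (allFin n) (λ u → P))
        ≡⟨ trans (∑-cong (allFin n) (λ _ → ∑-const P (allFin n))) (∑-const _ (allFin n)) ⟩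
      length (allFin n) * (length (allFin n) * P)
        ≡⟨ cong (λ z → z * (z * P)) (length-allFin n) ⟩
      n * (n * P)     ≡⟨ *-assoc n n P ⟨
      n * n * P       ∎
    e : ∀ x y z → x * (y * z) ≡ y * (x * z)
    e = solve-∀
    rare : suc m * B ≤ P
    rare = *-cancelˡ-≤ Y {{m^n≢0 2 (b ^ d)}} (begin
      Y * (suc m * B)       ≡⟨ e Y (suc m) B ⟩
      suc m * (Y * B)       ≤⟨ *-monoʳ-≤ (suc m) Y*B ⟩
      suc m * (n * n * P)   ≡⟨ *-assoc (suc m) (n * n) P ⟨
      suc m * (n * n) * P   ≤⟨ *-monoˡ-≤ P enough ⟩
      Y * P                 ∎)

  length-ball : ∀ d p u → length (ball d p u) ≤ suc Δ ^ d
  length-ball zero    p u = ≤-refl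
  length-ball (suc d) p u = +-mono-≤ (m^n>0 (suc Δ) d)
    (≤-trans (length-concatMap≤ (ball d u) (suc Δ ^ d) (children p u) (length-ball d u)) (*-monoˡ-≤ (suc Δ ^ d) (children≤Δ p u)))

  length-rootBall : ∀ v → length (v ∷ concatMap (ball d v) (nbrs v)) ≤ suc Δ ^ suc d
  length-rootBall v = +-mono-≤ (m^n>0 (suc Δ) d)
    (≤-trans (length-concatMap≤ (ball d v) (suc Δ ^ d) (nbrs v) (length-ball d v)) (*-monoˡ-≤ (suc Δ ^ d) (nbrs≤Δ v)))

  -- The outer `suc` leaves room for one isolated vertex in addition to a ball around another
  -- vertex, as needed in `unblocked⇒loose`.
  radius : ℕ
  radius = suc (suc Δ ^ suc d)

  open Moved

  unblocked⇒thawed : ∀ {σ} → Proper G σ → Unblocked σ → ∀ v → Thawed G 1 σ v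
  unblocked⇒thawed {σ} prop good v j with attain b+2≤k σ d short good prop v j
  ... | m , eq = τ′ m , path m , eq

  -- `HAdj` demands a different colouring even if v has colour j already. In that case a neighbour
  -- of v is moved, with v as its parent, so that v keeps its colour.
  unblocked⇒loose : 1 < n → ∀ {σ} → Proper G σ → Unblocked σ → ∀ v → Loose G radius σ v
  unblocked⇒loose 1<n {σ} prop good v j with lookup σ v ≟ᶠ j
  ... | no σv≢j with attain b+2≤k σ d short good prop v j
  ...   | m , eq = τ′ m , (prop , proper m , (λ σ≡τ → σv≢j (trans (cong (λ z → lookup z v) σ≡τ) eq)) ,
          ≤-trans (dist≤length {σ = σ} {τ = τ′ m} _ (fixed m)) (≤-trans (length-rootBall v) (n≤1+n _))) , eq
  unblocked⇒loose 1<n {σ} prop good v j | yes refl with any? (edge? v)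
  ... | yes (u , e) with move b+2≤k σ d {τ = σ} short e (good v u) prop refl (λ _ → refl)
  ...   | m , τu≢σu = τ′ m , (prop , proper m , (λ σ≡τ → τu≢σu (cong (λ z → lookup z u) (sym σ≡τ))) ,
          ≤-trans (dist≤length {σ = σ} {τ = τ′ m} _ (fixed m)) (≤-trans (length-ball d v u)
            (≤-trans (^-monoʳ-≤ (suc Δ) (n≤1+n d)) (n≤1+n _)))) , fixed m v v∉
    where
    v∉ : v ∉ ball d v u
    v∉ v∈ with ball⇒Reach d v∈
    ... | i , i≤ , r = leaves-root e r (≤-trans (+-mono-≤ (≤-trans i≤ (m≤m+n d d)) (m≤m+n 2 4)) short) refl
  -- An isolated v keeps its colour while some other vertex w changes.
  unblocked⇒loose 1<n {σ} prop good v j | yes refl | no isolated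
    with outside (v ∷ []) 1<n
  ... | w , w∉ with outside (lookup σ w ∷ []) (≤-trans (m≤n+m 2 b) b+2≤k)
  ...   | c , c∉ with attain b+2≤k σ d short good prop w c
  ...     | m , eq = τ″ , (prop , recolour-proper (τ′ m) (proper m) (λ x e → contradiction (x , e) isolated) , differ ,
              ≤-trans (dist≤length {σ = σ} {τ = τ″} (v ∷ _) same) (s≤s (length-rootBall w))) , lookup-update (τ′ m) v (lookup σ v)
    where
    τ″ : Colouring n k
    τ″ = τ′ m [ v ]≔ lookup σ v
    τ″w : lookup τ″ w ≡ c
    τ″w = trans (lookup-update′ (τ′ m) (lookup σ v) (w∉ ∘ here)) eq
    differ : σ ≢ τ″
    differ σ≡τ = c∉ (here (trans (sym τ″w) (cong (λ z → lookup z w) (sym σ≡τ))))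
    same : ∀ x → x ∉ v ∷ w ∷ concatMap (ball d w) (nbrs w) → lookup τ″ x ≡ lookup σ x
    same x x∉ = trans (lookup-update′ (τ′ m) (lookup σ v) (x∉ ∘ here)) (fixed m x (x∉ ∘ there))

  likely : 1 < n → ∀ m → suc m * (n * n) ≤ 2 ^ (b ^ d) →
    ProbAtLeast G k m (λ σ → ∀ v → Loose G radius σ v × Thawed G 1 σ v)
  likely 1<n m enough = filter P? Cols , Unique.filter⁺ P? (allColourings-unique n k) ,
    All.map (λ {σ} (p , good) → let prop = λ i j → p i j (λ ()) (λ ()) in
      prop , λ v → unblocked⇒loose 1<n prop good v , unblocked⇒thawed prop good v) (All.all-filter P? Cols) ,
    subst₂ (λ x y → m * x ≤ suc m * y) (sym (numProper≡#proper k G))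
      (sym (trans (length-filter-𝟙 P? Cols) (∑-cong Cols λ σ → 𝟙-× (properOff? [] σ) (unblocked? σ))))
      (unblocked-likely m enough)
    where
    P? : ∀ σ → Dec (ProperOff [] σ × Unblocked σ)
    P? σ = properOff? [] σ ×-dec unblocked? σ

-- Choice of constants

n<[1+n/m]*m : ∀ n m .{{_ : NonZero m}} → n < suc (n / m) * m
n<[1+n/m]*m n m = ≤-trans (s≤s (≤-reflexive (m≡m%n+[m/n]*n n m))) (+-monoˡ-≤ (n / m * m) (m%n<n n m))

-- With x = ⌊L / 2m⌋ the left side is at most Z (x + 1)^m. Half of the exponent 2 x m ≤ L pays for
-- (x + 1)^m, since x + 1 ≤ 2^x; the other half pays for Z ≤ x.
polynomial≤exponential : ∀ A m .{{_ : NonZero m}} → ∃[ L₀ ] ∀ L → L₀ ≤ L → A * suc L ^ m ≤ 2 ^ L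
polynomial≤exponential A m = Z * c , bound
  where
  open ≤-Reasoning
  c = 2 * m
  instance
    c≢0 : NonZero c
    c≢0 = m*n≢0 2 m
  Z = A * c ^ m
  e : ∀ A s t → A * (s * t) ≡ A * t * s
  e = solve-∀
  bound : ∀ L → Z * c ≤ L → A * suc L ^ m ≤ 2 ^ L
  bound L Zc≤L = begin
    A * suc L ^ m                 ≤⟨ *-monoʳ-≤ A (^-monoˡ-≤ m (n<[1+n/m]*m L c)) ⟩
    A * (suc x * c) ^ m           ≡⟨ cong (A *_) (^-distribʳ-* (suc x) c m) ⟩
    A * (suc x ^ m * c ^ m)       ≡⟨ e A (suc x ^ m) (c ^ m) ⟩
    Z * suc x ^ m                 ≤⟨ *-mono-≤ Z≤ (≤-trans (^-monoˡ-≤ m (n<2^n x)) (≤-reflexive (^-*-assoc 2 x m))) ⟩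
    2 ^ (x * m) * 2 ^ (x * m)     ≡⟨ ^-distribˡ-+-* 2 (x * m) (x * m) ⟨
    2 ^ (x * m + x * m)           ≤⟨ ^-monoʳ-≤ 2 (≤-trans (≤-reflexive (e′ x m)) (m/n*n≤m L c)) ⟩
    2 ^ L                         ∎
    where
    x = L / c
    e′ : ∀ x m → x * m + x * m ≡ x * (2 * m)
    e′ = solve-∀
    Z≤x : Z ≤ x
    Z≤x = ≤-trans (≤-reflexive (sym (m*n/n≡m Z c))) (/-monoˡ-≤ c Zc≤L)
    Z≤ : Z ≤ 2 ^ (x * m)
    Z≤ = ≤-trans (≤-trans Z≤x (m≤m*n x m)) (≤-trans (n≤1+n (x * m)) (n<2^n (x * m)))

polylog≤ : ∀ A m .{{_ : NonZero m}} → ∃[ k₀ ] ∀ k → k₀ ≤ k → ∀ δ → 2 ^ δ ≤ k → A * suc δ ^ m ≤ k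
polylog≤ A m with polynomial≤exponential A m
... | L₀ , bound = A * suc L₀ ^ m , λ k k₀≤k δ 2^δ≤k → go k k₀≤k δ 2^δ≤k (≤-total δ L₀)
  where
  go : ∀ k → A * suc L₀ ^ m ≤ k → ∀ δ → 2 ^ δ ≤ k → _ → A * suc δ ^ m ≤ k
  go k k₀≤k δ 2^δ≤k (inj₁ δ≤L₀) = ≤-trans (*-monoʳ-≤ A (^-monoˡ-≤ m (s≤s δ≤L₀))) k₀≤k
  go k k₀≤k δ 2^δ≤k (inj₂ L₀≤δ) = ≤-trans (bound δ L₀≤δ) 2^δ≤k

power-between : ∀ b → 2 ≤ b → ∀ X → ∃[ d ] (suc X ≤ b ^ d × b ^ d ≤ b * suc X)
power-between b 2≤b zero = 0 , ≤-refl , ≤-trans (<⇒≤ 2≤b) (≤-reflexive (sym (*-identityʳ b)))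
power-between b 2≤b (suc X) with power-between b 2≤b X
... | d , lo , hi with suc (suc X) ≤? b ^ d
...   | yes lo′ = d , lo′ , ≤-trans hi (*-monoʳ-≤ b (n≤1+n (suc X)))
...   | no ¬lo′ = suc d , ≤-trans (≤-trans (s≤s (m≤m+n (suc X) X)) (≤-trans (≤-reflexive (e X)) (*-monoˡ-≤ (suc X) 2≤b))) (*-monoʳ-≤ b lo)
                , *-monoʳ-≤ b (≤-trans (s≤s⁻¹ (≰⇒> ¬lo′)) (n≤1+n (suc X)))
  where
  e : ∀ X → suc (suc X + X) ≡ 2 * suc X
  e = solve-∀

-- The choice of constants: 1/p ≤ ε, t = p² and ℓ = C D² where D - 1 ≤ Δ/k < D.
module Constants (p′ p r τ C : ℕ) .{{_ : NonZero τ}} (p≡1+p′ : p ≡ suc p′) (r≡1+p : r ≡ suc p)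
  (t≡p² : suc τ ≡ p * p) (τ≡p′r : τ ≡ p′ * r) (512≤C : 512 ≤ C) (8t²r≤C : 8 * (suc τ * suc τ) * r ≤ C)
  (2τ^τ≤t^τ : 2 * τ ^ τ ≤ suc τ ^ τ) (t^t≤4τ^t : suc τ ^ suc τ ≤ 4 * τ ^ suc τ) where

  -- With b₀ = k / c, neighbours with short lists spoil at most a fraction t / c = 1 / (2 r) of the
  -- colours. A fraction e / (2 r) remains, as e = 2 r - 1. `A` is the part of 16^r (4 ℓ)^e that
  -- does not depend on D.
  t c A e : ℕ
  t  = suc τ
  c  = 2 * t * r
  e  = suc (2 * p)
  A  = 16 ^ r * (4 * C) ^ e

  instance
    r≢0 : NonZero r
    r≢0 = >-nonZero (≤-trans (s≤s z≤n) (≤-reflexive (sym r≡1+p)))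

    c≢0 : NonZero c
    c≢0 = m*n≢0 (2 * t) r

    C≢0 : NonZero C
    C≢0 = >-nonZero (≤-trans (s≤s z≤n) 512≤C)

  threshold : ∃[ k₀ ] ∀ k → k₀ ≤ k → ∀ δ → 2 ^ δ ≤ k → A * suc δ ^ (2 * e) ≤ k
  threshold = polylog≤ A (2 * e)

  module _ {k : ℕ} (Δ : ℕ) .{{_ : NonZero k}} (c≤k : c ≤ k) (large : ∀ δ → 2 ^ δ ≤ k → A * suc δ ^ (2 * e) ≤ k)
    (H : ∀ s → s * (p′ * k) ≤ p * (Δ * τ) → t ^ s ≤ k * τ ^ s) where

    δ D ℓ b₀ : ℕ
    δ  = Δ / k
    D  = suc δ
    ℓ  = C * (D * D)
    b₀ = k / c

    δk≤Δ : δ * k ≤ Δ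
    δk≤Δ = m/n*n≤m Δ k

    Δ≤Dk : Δ ≤ D * k
    Δ≤Dk = <⇒≤ (n<[1+n/m]*m Δ k)

    -- (1 + 1/τ)^τ ≥ 2, so `H` at s = τ δ makes δ at most logarithmic in k, and ℓ polylogarithmic.
    2^δ≤k : 2 ^ δ ≤ k
    2^δ≤k = *-cancelʳ-≤ (2 ^ δ) k (τ ^ (τ * δ)) {{m^n≢0 τ (τ * δ)}} (begin
      2 ^ δ * τ ^ (τ * δ)     ≡⟨ cong (2 ^ δ *_) (^-*-assoc τ τ δ) ⟨
      2 ^ δ * (τ ^ τ) ^ δ     ≡⟨ ^-distribʳ-* 2 (τ ^ τ) δ ⟨
      (2 * τ ^ τ) ^ δ         ≤⟨ ^-monoˡ-≤ δ 2τ^τ≤t^τ ⟩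
      (t ^ τ) ^ δ             ≡⟨ ^-*-assoc t τ δ ⟩
      t ^ (τ * δ)             ≤⟨ H (τ * δ) hyp ⟩
      k * τ ^ (τ * δ)         ∎)
      where
      open ≤-Reasoning
      eq₁ : ∀ τ δ p k → τ * δ * (p * k) ≡ p * (δ * k * τ)
      eq₁ = solve-∀
      hyp : τ * δ * (p′ * k) ≤ p * (Δ * τ)
      hyp = ≤-trans (≤-reflexive (eq₁ τ δ p′ k)) (*-mono-≤ (≤-trans (n≤1+n p′) (≤-reflexive (sym p≡1+p′))) (*-monoˡ-≤ τ δk≤Δ))

    -- All of this has to fit into the single factor k by which k^e exceeds k^(2 p).
    key : 16 ^ r * (4 * ℓ) ^ e ≤ k
    key = ≤-trans (≤-reflexive eq) (large δ 2^δ≤k)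
      where
      open ≡-Reasoning
      eq : 16 ^ r * (4 * ℓ) ^ e ≡ A * D ^ (2 * e)
      eq = begin
        16 ^ r * (4 * ℓ) ^ e                      ≡⟨ cong (λ z → 16 ^ r * z ^ e) (*-assoc 4 C (D * D)) ⟨
        16 ^ r * (4 * C * (D * D)) ^ e            ≡⟨ cong (16 ^ r *_) (^-distribʳ-* (4 * C) (D * D) e) ⟩
        16 ^ r * ((4 * C) ^ e * (D * D) ^ e)      ≡⟨ *-assoc (16 ^ r) _ _ ⟨
        A * (D * D) ^ e                               ≡⟨ cong (λ z → A * (D * z) ^ e) (*-identityʳ D) ⟨
        A * (D ^ 2) ^ e                               ≡⟨ cong (A *_) (^-*-assoc D 2 e) ⟩
        A * D ^ (2 * e)                               ∎

    4ℓ>0 : NonZero (4 * ℓ)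
    4ℓ>0 = m*n≢0 4 ℓ {{_}} {{m*n≢0 C (D * D)}}

    4ℓ≤k : 4 * ℓ ≤ k
    4ℓ≤k = ≤-trans (≤-trans (≤-reflexive (sym (^-identityʳ (4 * ℓ)))) (^-monoʳ-≤ (4 * ℓ) {{4ℓ>0}} (s≤s (z≤n {2 * p}))))
      (≤-trans (m≤n*m ((4 * ℓ) ^ e) (16 ^ r) {{m^n≢0 16 (r)}}) key)

    2048D≤k : 2048 * D ≤ k
    2048D≤k = ≤-trans (≤-trans (≤-reflexive (*-assoc 4 512 D)) (*-monoʳ-≤ 4 (*-mono-≤ 512≤C (m≤m*n D D)))) 4ℓ≤k

    E : ℕ
    E = t * D * r

    -- This is where ε is turned into a gain: (t/τ)^(t δ) ≤ k^(p/r) with p/r < 1. `H` admits s = p r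
    -- δ because τ = (p - 1) r, and t = p² gives t δ r = s p. Rounding Δ/k up to D = δ + 1 costs
    -- ((t/τ)^t)^r ≤ 4^r.
    ratio : t ^ E ≤ 4 ^ r * k ^ p * τ ^ E
    ratio = begin
      t ^ (t * D * r)                                ≡⟨ cong (t ^_) split ⟩
      t ^ (t * r + s * p)                            ≡⟨ ^-distribˡ-+-* t (t * r) (s * p) ⟩
      t ^ (t * r) * t ^ (s * p)                      ≡⟨ cong₂ _*_ (^-*-assoc t t (r)) (^-*-assoc t s p) ⟨
      (t ^ t) ^ r * (t ^ s) ^ p                      ≤⟨ *-mono-≤ (^-monoˡ-≤ (r) t^t≤4τ^t) (^-monoˡ-≤ p (H s hyp)) ⟩
      (4 * τ ^ t) ^ r * (k * τ ^ s) ^ p              ≡⟨ cong₂ _*_ (^-distribʳ-* 4 (τ ^ t) (r)) (^-distribʳ-* k (τ ^ s) p) ⟩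
      4 ^ r * (τ ^ t) ^ r * (k ^ p * (τ ^ s) ^ p) ≡⟨ cong₂ (λ x y → 4 ^ r * x * (k ^ p * y)) (^-*-assoc τ t (r)) (^-*-assoc τ s p) ⟩
      4 ^ r * τ ^ (t * r) * (k ^ p * τ ^ (s * p)) ≡⟨ swap (4 ^ r) _ (k ^ p) _ ⟩
      4 ^ r * k ^ p * (τ ^ (t * r) * τ ^ (s * p)) ≡⟨ cong (4 ^ r * k ^ p *_) (^-distribˡ-+-* τ (t * r) (s * p)) ⟨
      4 ^ r * k ^ p * τ ^ (t * r + s * p)        ≡⟨ cong (λ z → 4 ^ r * k ^ p * τ ^ z) split ⟨
      4 ^ r * k ^ p * τ ^ (t * D * r)            ∎
      where
      open ≤-Reasoning
      s = p * (r * δ)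
      swap : ∀ x y z w → x * y * (z * w) ≡ x * z * (y * w)
      swap = solve-∀
      eq₁ : ∀ t δ r → t * suc δ * r ≡ t * r + t * (r * δ)
      eq₁ = solve-∀
      eq₂ : ∀ p r → p * p * r ≡ p * r * p
      eq₂ = solve-∀
      split : t * D * r ≡ t * r + s * p
      split = trans (eq₁ t δ (r)) (cong (t * r +_) (trans (cong (_* (r * δ)) t≡p²) (eq₂ p (r * δ))))
      eq₃ : ∀ p r δ p′ k → p * (r * δ) * (p′ * k) ≡ p * (δ * k * (p′ * r))
      eq₃ = solve-∀
      hyp : s * (p′ * k) ≤ p * (Δ * τ)
      hyp = ≤-trans (≤-reflexive (eq₃ p (r) δ p′ k)) (*-monoʳ-≤ p (≤-trans (≤-reflexive (cong (δ * k *_) (sym τ≡p′r))) (*-monoˡ-≤ τ δk≤Δ)))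

    module _ (K : ℕ) (many : k ≤ K + t * b₀) where

      f M : ℕ
      f = 2 * r
      M = K * f

      instance
        f≢0 : NonZero f
        f≢0 = m*n≢0 2 r

      ek≤M : e * k ≤ M
      ek≤M = +-cancelʳ-≤ k (e * k) M (begin
        e * k + k                     ≡⟨ trans (eq₁ p k) (cong (λ z → k * (2 * z)) (sym r≡1+p)) ⟩
        k * f                         ≤⟨ *-monoˡ-≤ f many ⟩
        (K + t * b₀) * f              ≡⟨ eq₂ K t b₀ (r) ⟩
        M + b₀ * c                    ≤⟨ +-monoʳ-≤ M (m/n*n≤m k c) ⟩
        M + k                         ∎)
        where
        open ≤-Reasoning
        eq₁ : ∀ p k → suc (2 * p) * k + k ≡ k * (2 * suc p)
        eq₁ = solve-∀
        eq₂ : ∀ K t b r → (K + t * b) * (2 * r) ≡ K * (2 * r) + b * (2 * t * r)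
        eq₂ = solve-∀

      k≤2K : k ≤ 2 * K
      k≤2K = *-cancelˡ-≤ f (begin
        f * k            ≤⟨ *-monoˡ-≤ k (≤-trans (m≤m+n f (2 * p)) (≤-reflexive (trans (cong (λ z → 2 * z + 2 * p) r≡1+p) (eq₁ p)))) ⟩
        2 * e * k        ≡⟨ *-assoc 2 e k ⟩
        2 * (e * k)      ≤⟨ *-monoʳ-≤ 2 ek≤M ⟩
        2 * (K * f)      ≡⟨ eq₂ K f ⟩
        f * (2 * K)      ∎)
        where
        open ≤-Reasoning
        eq₁ : ∀ p → 2 * suc p + 2 * p ≡ 2 * suc (2 * p)
        eq₁ = solve-∀
        eq₂ : ∀ K f → 2 * (K * f) ≡ f * (2 * K)
        eq₂ = solve-∀

      -- Of the M factors k on the right, e k form k blocks, each paying for 16^r k^(2 p) (4 ℓ)^e by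
      -- `key`; each of the other o factors pays for one 4 ℓ.
      W≤ : (4 ^ r * k ^ p) ^ (2 * k) * (4 * ℓ) ^ M ≤ k ^ M
      W≤ with m≤n⇒∃[o]m+o≡n ek≤M
      ... | o , ek+o≡M = begin
        (4 ^ r * k ^ p) ^ (2 * k) * (4 * ℓ) ^ M
          ≡⟨ cong₂ _*_ (^-*-assoc (4 ^ r * k ^ p) 2 k) (cong ((4 * ℓ) ^_) ek+o≡M) ⟨
        ((4 ^ r * k ^ p) ^ 2) ^ k * (4 * ℓ) ^ (e * k + o)
          ≡⟨ cong₂ (λ x y → x ^ k * y) square (trans (^-distribˡ-+-* (4 * ℓ) (e * k) o) (cong (_* (4 * ℓ) ^ o) (sym (^-*-assoc (4 * ℓ) e k)))) ⟩
        (16 ^ r * k ^ (2 * p)) ^ k * (((4 * ℓ) ^ e) ^ k * (4 * ℓ) ^ o)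
          ≡⟨ *-assoc ((16 ^ r * k ^ (2 * p)) ^ k) _ _ ⟨
        (16 ^ r * k ^ (2 * p)) ^ k * ((4 * ℓ) ^ e) ^ k * (4 * ℓ) ^ o
          ≡⟨ cong (_* (4 * ℓ) ^ o) (^-distribʳ-* (16 ^ r * k ^ (2 * p)) _ k) ⟨
        (16 ^ r * k ^ (2 * p) * (4 * ℓ) ^ e) ^ k * (4 * ℓ) ^ o
          ≤⟨ *-mono-≤ (^-monoˡ-≤ k inner) (^-monoˡ-≤ o 4ℓ≤k) ⟩
        (k ^ e) ^ k * k ^ o
          ≡⟨ cong (_* k ^ o) (^-*-assoc k e k) ⟩
        k ^ (e * k) * k ^ o
          ≡⟨ ^-distribˡ-+-* k (e * k) o ⟨
        k ^ (e * k + o)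
          ≡⟨ cong (k ^_) ek+o≡M ⟩
        k ^ M ∎
        where
        open ≤-Reasoning
        eq₁ : ∀ a b → a * b * (a * b * 1) ≡ a * a * (b * b)
        eq₁ = solve-∀
        square : (4 ^ r * k ^ p) ^ 2 ≡ 16 ^ r * k ^ (2 * p)
        square = trans (eq₁ (4 ^ r) (k ^ p)) (cong₂ _*_ (sym (^-distribʳ-* 4 4 (r)))
          (trans (sym (^-distribˡ-+-* k p p)) (cong (λ z → k ^ (p + z)) (sym (+-identityʳ p)))))
        eq₂ : ∀ a b c → a * b * c ≡ a * c * b
        eq₂ = solve-∀
        inner : 16 ^ r * k ^ (2 * p) * (4 * ℓ) ^ e ≤ k ^ e
        inner = ≤-trans (≤-reflexive (eq₂ (16 ^ r) (k ^ (2 * p)) ((4 * ℓ) ^ e))) (*-monoˡ-≤ (k ^ (2 * p)) key)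

      -- Half of each 4 ℓ is spent on replacing k by K ≥ k / 2.
      V≤ : (4 ^ r * k ^ p) ^ (2 * k) * (2 * ℓ) ^ M ≤ K ^ M
      V≤ = *-cancelˡ-≤ (2 ^ M) {{m^n≢0 2 M}} (begin
        2 ^ M * (v * (2 * ℓ) ^ M)       ≡⟨ eq₁ (2 ^ M) v _ ⟩
        v * (2 ^ M * (2 * ℓ) ^ M)       ≡⟨ cong (v *_) (^-distribʳ-* 2 (2 * ℓ) M) ⟨
        v * (2 * (2 * ℓ)) ^ M           ≡⟨ cong (λ z → v * z ^ M) (*-assoc 2 2 ℓ) ⟨
        v * (4 * ℓ) ^ M                 ≤⟨ W≤ ⟩
        k ^ M                           ≤⟨ ^-monoˡ-≤ M k≤2K ⟩
        (2 * K) ^ M                     ≡⟨ ^-distribʳ-* 2 K M ⟩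
        2 ^ M * K ^ M                   ∎)
        where
        open ≤-Reasoning
        v = (4 ^ r * k ^ p) ^ (2 * k)
        eq₁ : ∀ a b c → a * (b * c) ≡ b * (a * c)
        eq₁ = solve-∀

      G : ℕ
      G = t * (D * k)

      -- The case m = D k of the spread condition. Raised to the power f = 2 r, its exponents become
      -- multiples of those in `ratio`, so no fractional powers of k arise.
      full : t ^ G * (2 * ℓ) ^ K ≤ K ^ K * τ ^ G
      full = ^-cancelʳ-≤ f (begin
        (t ^ G * (2 * ℓ) ^ K) ^ f                      ≡⟨ ^-distribʳ-* (t ^ G) _ f ⟩
        (t ^ G) ^ f * ((2 * ℓ) ^ K) ^ f                ≡⟨ cong₂ _*_ (regroup t) (^-*-assoc (2 * ℓ) K f) ⟩
        (t ^ E) ^ (2 * k) * (2 * ℓ) ^ M                ≤⟨ *-monoˡ-≤ ((2 * ℓ) ^ M) (^-monoˡ-≤ (2 * k) ratio) ⟩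
        (4 ^ r * k ^ p * τ ^ E) ^ (2 * k) * (2 * ℓ) ^ M
          ≡⟨ cong (_* (2 * ℓ) ^ M) (^-distribʳ-* (4 ^ r * k ^ p) (τ ^ E) (2 * k)) ⟩
        v * (τ ^ E) ^ (2 * k) * (2 * ℓ) ^ M            ≡⟨ eq₁ v _ _ ⟩
        v * (2 * ℓ) ^ M * (τ ^ E) ^ (2 * k)            ≤⟨ *-monoˡ-≤ ((τ ^ E) ^ (2 * k)) V≤ ⟩
        K ^ M * (τ ^ E) ^ (2 * k)                      ≡⟨ cong₂ _*_ (^-*-assoc K K f) (regroup τ) ⟨
        (K ^ K) ^ f * (τ ^ G) ^ f                      ≡⟨ ^-distribʳ-* (K ^ K) _ f ⟨
        (K ^ K * τ ^ G) ^ f                            ∎)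
        where
        open ≤-Reasoning
        v = (4 ^ r * k ^ p) ^ (2 * k)
        eq₁ : ∀ a b c → a * b * c ≡ a * c * b
        eq₁ = solve-∀
        eq₂ : ∀ t D k r → t * (D * k) * (2 * r) ≡ t * D * r * (2 * k)
        eq₂ = solve-∀
        regroup : ∀ x → (x ^ G) ^ f ≡ (x ^ E) ^ (2 * k)
        regroup x = trans (^-*-assoc x G f) (trans (cong (x ^_) (eq₂ t D k (r))) (sym (^-*-assoc x E (2 * k))))

      spread′ : ∀ m → m ≤ Δ → t ^ (t * m) * (2 * ℓ) ^ K ≤ K ^ K * τ ^ (t * m)
      spread′ m m≤Δ with m≤n⇒∃[o]m+o≡n (≤-trans m≤Δ Δ≤Dk)
      ... | o , m+o≡Dk = *-cancelʳ-≤ _ _ (τ ^ (t * o)) {{m^n≢0 τ (t * o)}} (begin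
        t ^ (t * m) * (2 * ℓ) ^ K * τ ^ (t * o)      ≤⟨ *-monoʳ-≤ (t ^ (t * m) * (2 * ℓ) ^ K) (^-monoˡ-≤ (t * o) (n≤1+n τ)) ⟩
        t ^ (t * m) * (2 * ℓ) ^ K * t ^ (t * o)      ≡⟨ eq₁ (t ^ (t * m)) _ _ ⟩
        t ^ (t * m) * t ^ (t * o) * (2 * ℓ) ^ K      ≡⟨ cong (_* (2 * ℓ) ^ K) (join t) ⟩
        t ^ G * (2 * ℓ) ^ K                          ≤⟨ full ⟩
        K ^ K * τ ^ G                                ≡⟨ cong (K ^ K *_) (join τ) ⟨
        K ^ K * (τ ^ (t * m) * τ ^ (t * o))          ≡⟨ *-assoc (K ^ K) _ _ ⟨
        K ^ K * τ ^ (t * m) * τ ^ (t * o)            ∎)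
        where
        open ≤-Reasoning
        eq₁ : ∀ a b c → a * b * c ≡ a * c * b
        eq₁ = solve-∀
        join : ∀ x → x ^ (t * m) * x ^ (t * o) ≡ x ^ G
        join x = trans (sym (^-distribˡ-+-* x (t * m) (t * o))) (cong (x ^_) (trans (sym (*-distribˡ-+ t m o)) (cong (t *_) m+o≡Dk)))

    b₀≥1 : 0 < b₀
    b₀≥1 = ≤-trans (≤-reflexive (sym (trans (cong (_/ c) (sym (*-identityˡ c))) (m*n/n≡m 1 c)))) (/-monoˡ-≤ c c≤k)

    parameters : Parameters k Δ ℓ τ b₀
    parameters = record
      { t′>0    = >-nonZero⁻¹ τ
      ; b₀>0    = b₀≥1
      ; tb₀<k   = tb₀<k′
      ; 2Δt≤ℓb₀ = enough
      ; spread  = λ m K m≤Δ many _ → spread′ K many m m≤Δ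
      }
      where
      open ≤-Reasoning
      eq₁ : ∀ t b p → t * b + (2 * p + 1) * (t * b) ≡ b * (2 * t * suc p)
      eq₁ = solve-∀
      tb₀<k′ : t * b₀ < k
      tb₀<k′ = begin-strict
        t * b₀                               <⟨ m<m+n (t * b₀) (*-mono-≤ {1} {2 * p + 1} (m≤n+m 1 (2 * p)) (*-mono-≤ {1} {t} (s≤s z≤n) b₀≥1)) ⟩
        t * b₀ + (2 * p + 1) * (t * b₀)      ≡⟨ trans (eq₁ t b₀ p) (cong (λ z → b₀ * (2 * t * z)) (sym r≡1+p)) ⟩
        b₀ * c                               ≤⟨ m/n*n≤m k c ⟩
        k                                    ∎
      eq₂ : ∀ D b t r → 2 * (D * ((b + b) * (2 * t * r)) * t) ≡ 8 * (t * t) * r * D * b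
      eq₂ = solve-∀
      -- As b₀ ≥ 1, rounding gives k ≤ 2 b₀ c; with c = 2 t r the constants multiply to 8 t² r ≤ C.
      enough : 2 * (Δ * t) ≤ ℓ * b₀
      enough = begin
        2 * (Δ * t)                          ≤⟨ *-monoʳ-≤ 2 (*-monoˡ-≤ t Δ≤Dk) ⟩
        2 * (D * k * t)                      ≤⟨ *-monoʳ-≤ 2 (*-monoˡ-≤ t (*-monoʳ-≤ D (≤-trans (<⇒≤ (n<[1+n/m]*m k c)) (*-monoˡ-≤ c (+-monoˡ-≤ b₀ b₀≥1))))) ⟩
        2 * (D * ((b₀ + b₀) * c) * t)        ≡⟨ eq₂ D b₀ t (r) ⟩
        8 * (t * t) * r * D * b₀         ≤⟨ *-monoˡ-≤ b₀ (*-mono-≤ 8t²r≤C (m≤m*n D D)) ⟩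
        ℓ * b₀                               ∎

    2a≤ℓ : 2 * (16 * D * (16 * D)) ≤ ℓ
    2a≤ℓ = ≤-trans (≤-reflexive (eq D)) (*-monoˡ-≤ (D * D) 512≤C)
      where
      eq : ∀ D → 2 * (16 * D * (16 * D)) ≡ 512 * (D * D)
      eq = solve-∀

    module _ {b : ℕ} (k≡b+2 : k ≡ b + 2) where

      2046≤b : 2046 ≤ b
      2046≤b = +-cancelʳ-≤ 2 2046 b (≤-trans (≤-trans (m≤m*n 2048 D) 2048D≤k) (≤-reflexive k≡b+2))

      2≤b : 2 ≤ b
      2≤b = ≤-trans (m≤m+n 2 2044) 2046≤b

      -- (1 + 1/D)^D ≤ 4 and Δ ≤ D k give 4^k, and k = b + 2 ≤ 2 b.
      binomial : ∀ m → m ≤ Δ → suc D ^ m ≤ 16 ^ b * D ^ m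
      binomial m m≤Δ with m≤n⇒∃[o]m+o≡n (≤-trans m≤Δ Δ≤Dk)
      ... | o , m+o≡Dk = *-cancelʳ-≤ _ _ (D ^ o) {{m^n≢0 D o}} (begin
        suc D ^ m * D ^ o            ≤⟨ *-monoʳ-≤ (suc D ^ m) (^-monoˡ-≤ o (n≤1+n D)) ⟩
        suc D ^ m * suc D ^ o        ≡⟨ ^-distribˡ-+-* (suc D) m o ⟨
        suc D ^ (m + o)              ≡⟨ cong (suc D ^_) m+o≡Dk ⟩
        suc D ^ (D * k)              ≡⟨ ^-*-assoc (suc D) D k ⟨
        (suc D ^ D) ^ k              ≤⟨ ^-monoˡ-≤ k fourfold ⟩
        (4 * D ^ D) ^ k              ≡⟨ trans (^-distribʳ-* 4 (D ^ D) k) (cong (4 ^ k *_) (^-*-assoc D D k)) ⟩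
        4 ^ k * D ^ (D * k)          ≤⟨ *-monoˡ-≤ (D ^ (D * k)) (≤-trans (^-monoʳ-≤ 4 k≤2b) (≤-reflexive (sym (^-*-assoc 4 2 b)))) ⟩
        16 ^ b * D ^ (D * k)         ≡⟨ cong (λ z → 16 ^ b * D ^ z) m+o≡Dk ⟨
        16 ^ b * D ^ (m + o)         ≡⟨ cong (16 ^ b *_) (^-distribˡ-+-* D m o) ⟩
        16 ^ b * (D ^ m * D ^ o)     ≡⟨ *-assoc (16 ^ b) _ _ ⟨
        16 ^ b * D ^ m * D ^ o       ∎)
        where
        open ≤-Reasoning
        k≤2b : k ≤ 2 * b
        k≤2b = ≤-trans (≤-reflexive k≡b+2) (≤-trans (+-monoʳ-≤ b 2≤b) (≤-reflexive (cong (b +_) (sym (+-identityʳ b)))))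
        eq : ∀ x y → 4 * (x * y) ≡ x * (4 * y)
        eq = solve-∀
        fourfold : suc D ^ D ≤ 4 * D ^ D
        fourfold = *-cancelˡ-≤ (suc D) (≤-trans ([1+1/l]^[1+l]≤4 δ)
          (≤-trans (≤-reflexive (eq D (D ^ D))) (*-monoˡ-≤ (4 * D ^ D) (n≤1+n D))))

      -- D ≤ k / 2048 makes D k a small part of k². This is the source of the exponent 2 in the
      -- radius: (1 + Δ)^d ≤ (b^d)², and b^d is of order log n.
      1+Δ≤b² : suc Δ ≤ b * b
      1+Δ≤b² = *-cancelˡ-≤ 4 (begin
        4 * suc Δ                        ≤⟨ *-monoʳ-≤ 4 (s≤s Δ≤Dk) ⟩
        4 * suc (D * k)                  ≡⟨ eq₁ D k ⟩
        4 * D * k + 4                    ≤⟨ +-mono-≤ (*-monoˡ-≤ k (≤-trans (*-monoˡ-≤ D (m≤m+n 4 2044)) 2048D≤k)) (*-mono-≤ {1} {4} (s≤s z≤n) (m≤m+n 4 k)) ⟩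
        k * k + 4 * (4 + k)              ≤⟨ m≤m+n _ (4 * k) ⟩
        k * k + 4 * (4 + k) + 4 * k      ≡⟨ eq₂ k ⟩
        (k + 4) * (k + 4)                ≤⟨ *-mono-≤ k+4≤2b k+4≤2b ⟩
        2 * b * (2 * b)                  ≡⟨ eq₃ b ⟩
        4 * (b * b)                      ∎)
        where
        open ≤-Reasoning
        eq₁ : ∀ D k → 4 * suc (D * k) ≡ 4 * D * k + 4
        eq₁ = solve-∀
        eq₂ : ∀ k → k * k + 4 * (4 + k) + 4 * k ≡ (k + 4) * (k + 4)
        eq₂ = solve-∀
        eq₃ : ∀ b → 2 * b * (2 * b) ≡ 4 * (b * b)
        eq₃ = solve-∀
        k+4≤2b : k + 4 ≤ 2 * b
        k+4≤2b = begin
          k + 4            ≡⟨ cong (_+ 4) k≡b+2 ⟩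
          b + 2 + 4        ≡⟨ +-assoc b 2 4 ⟩
          b + 6            ≤⟨ +-monoʳ-≤ b (≤-trans (m≤m+n 6 2040) 2046≤b) ⟩
          b + b            ≡⟨ cong (b +_) (+-identityʳ b) ⟨
          2 * b            ∎

-- Logarithms of n and the girth.

n<2^[1+log₂n] : ∀ n → n < 2 ^ suc ⌊log₂ n ⌋
n<2^[1+log₂n] n = ≰⇒> λ h → <-irrefl refl
  (≤-trans (≤-reflexive (sym (⌊log₂[2^n]⌋≡n (suc ⌊log₂ n ⌋)))) (⌊log₂⌋-mono-≤ h))

log₂≤ : ∀ {n x} → n ≤ 2 ^ x → ⌊log₂ n ⌋ ≤ x
log₂≤ {n} {x} h = ≤-trans (⌊log₂⌋-mono-≤ h) (≤-reflexive (⌊log₂[2^n]⌋≡n x))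

≤log₂ : ∀ {n x} → 2 ^ x ≤ n → x ≤ ⌊log₂ n ⌋
≤log₂ {n} {x} h = ≤-trans (≤-reflexive (sym (⌊log₂[2^n]⌋≡n x))) (⌊log₂⌋-mono-≤ h)

-- b^d is of order log n up to a factor b, while a cycle of length at most 2 d + 6 would bound log n
-- by a constant times 4^(2 d) = 16^d. As b ≥ 16², this is absurd for d ≥ 7, and b^6 ≤ log n forces
-- d ≥ 7.
cycles-long : ∀ {b d n l} → 256 ≤ b → b ^ 6 ≤ ⌊log₂ n ⌋ → 4 + 4 * ⌊log₂ n ⌋ ≤ b ^ d → b ^ d ≤ b * (4 + 4 * ⌊log₂ n ⌋) →
  LnLnLe n l → d + d + 6 < l
cycles-long {b} {d} {n} {l} 256≤b large lo hi lnln = ≰⇒> λ l≤ → absurd d lo hi l≤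
  where
  open ≤-Reasoning
  L = ⌊log₂ n ⌋
  instance
    b≢0 : NonZero b
    b≢0 = >-nonZero (≤-trans (s≤s z≤n) 256≤b)
  absurd : ∀ d → 4 + 4 * L ≤ b ^ d → b ^ d ≤ b * (4 + 4 * L) → ¬ (l ≤ d + d + 6)
  absurd d lo hi l≤ with 7 ≤? d
  ... | no d<7 = contradiction (begin-strict
    b ^ 6          ≤⟨ large ⟩
    L              <⟨ s≤s (m≤n+m L 3) ⟩
    4 + L          ≤⟨ +-monoʳ-≤ 4 (m≤n*m L 4) ⟩
    4 + 4 * L      ≤⟨ lo ⟩
    b ^ d          ≤⟨ ^-monoʳ-≤ b (s≤s⁻¹ (≰⇒> d<7)) ⟩
    b ^ 6          ∎) (<-irrefl refl)
  absurd (suc d′) lo hi l≤ | yes (s≤s 6≤d′) = contradiction (begin-strict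
    16 ^ (d′ + 5)              <⟨ ^-monoʳ-< 16 (s≤s (s≤s z≤n)) (+-monoʳ-< d′ 6≤d′) ⟩
    16 ^ (d′ + d′)             ≡⟨ cong (λ z → 16 ^ (d′ + z)) (+-identityʳ d′) ⟨
    16 ^ (2 * d′)              ≡⟨ ^-*-assoc 16 2 d′ ⟨
    256 ^ d′                   ≤⟨ ^-monoˡ-≤ d′ 256≤b ⟩
    b ^ d′                     ≤⟨ *-cancelˡ-≤ b hi ⟩
    4 + 4 * L                  ≤⟨ +-monoʳ-≤ 4 (*-monoʳ-≤ 4 (log₂≤ n≤)) ⟩
    4 + 4 * suc (2 * Q)        ≡⟨ e₁ Q ⟩
    8 * 1 + 8 * Q              ≤⟨ +-monoˡ-≤ (8 * Q) (*-monoʳ-≤ 8 (m^n>0 16 (d′ + 4))) ⟩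
    8 * Q + 8 * Q              ≡⟨ e₂ Q ⟩
    16 * Q                     ≡⟨ cong (16 ^_) (+-suc d′ 4) ⟨
    16 ^ (d′ + 5)              ∎) (<-irrefl refl)
    where
    Q = 16 ^ (d′ + 4)
    e₁ : ∀ Q → 4 + 4 * suc (2 * Q) ≡ 8 * 1 + 8 * Q
    e₁ = solve-∀
    e₂ : ∀ Q → 8 * Q + 8 * Q ≡ 16 * Q
    e₂ = solve-∀
    e₃ : ∀ d → suc d + suc d + 6 ≡ 2 * (d + 4)
    e₃ = solve-∀
    n≤ : n ≤ 2 ^ suc (2 * Q)
    n≤ = begin
      n                              ≤⟨ LnLnLe⇒ {n} {l} lnln ⟩
      suc (4 ^ (4 ^ l))              ≤⟨ s≤s (^-monoʳ-≤ 4 (^-monoʳ-≤ 4 l≤)) ⟩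
      suc (4 ^ (4 ^ (suc d′ + suc d′ + 6))) ≡⟨ cong (λ z → suc (4 ^ z)) (trans (cong (4 ^_) (e₃ d′)) (sym (^-*-assoc 4 2 (d′ + 4)))) ⟩
      suc (4 ^ Q)                    ≤⟨ +-monoˡ-≤ (4 ^ Q) (m^n>0 4 Q) ⟩
      4 ^ Q + 4 ^ Q                  ≡⟨ cong (4 ^ Q +_) (+-identityʳ (4 ^ Q)) ⟨
      2 * 4 ^ Q                      ≡⟨ cong (2 *_) (^-*-assoc 2 2 Q) ⟩
      2 ^ suc (2 * Q)                ∎

-- Radius and probability for fixed k and Δ as n grows.

module Main (p′ p r τ C : ℕ) .{{_ : NonZero τ}} (p≡1+p′ : p ≡ suc p′) (r≡1+p : r ≡ suc p)
  (t≡p² : suc τ ≡ p * p) (τ≡p′r : τ ≡ p′ * r) (512≤C : 512 ≤ C) (8t²r≤C : 8 * (suc τ * suc τ) * r ≤ C)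
  (2τ^τ≤t^τ : 2 * τ ^ τ ≤ suc τ ^ τ) (t^t≤4τ^t : suc τ ^ suc τ ≤ 4 * τ ^ suc τ) where

  open Constants p′ p r τ C p≡1+p′ r≡1+p t≡p² τ≡p′r 512≤C 8t²r≤C 2τ^τ≤t^τ t^t≤4τ^t

  k₀ : ℕ
  k₀ = proj₁ threshold + (c + 2)

  module _ (k : ℕ) (k₀≤k : k₀ ≤ k) (Δ : ℕ) (H : ∀ s → s * (p′ * k) ≤ p * (Δ * τ) → t ^ s ≤ k * τ ^ s) where

    private
      c+2≤k : c + 2 ≤ k
      c+2≤k = ≤-trans (m≤n+m (c + 2) (proj₁ threshold)) k₀≤k

      c≤k : c ≤ k
      c≤k = ≤-trans (m≤m+n c 2) c+2≤k

      2≤k : 2 ≤ k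
      2≤k = ≤-trans (m≤n+m 2 c) c+2≤k

      instance
        k≢0 : NonZero k
        k≢0 = >-nonZero (<⇒≤ 2≤k)

      large : ∀ δ → 2 ^ δ ≤ k → A * suc δ ^ (2 * e) ≤ k
      large = proj₂ threshold k (≤-trans (m≤m+n (proj₁ threshold) (c + 2)) k₀≤k)

      b : ℕ
      b = k ∸ 2

      k≡b+2 : k ≡ b + 2
      k≡b+2 = sym (m∸n+n≡m 2≤k)

      2≤b′ : 2 ≤ b
      2≤b′ = 2≤b Δ c≤k large H k≡b+2

      256≤b : 256 ≤ b
      256≤b = ≤-trans (m≤m+n 256 1790) (2046≤b Δ c≤k large H k≡b+2)

      -- 4 + 4 L makes 2^(b^d) at least n^4, which exceeds the (m + 1) n² of the union bound once n
      -- > m.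
      between : ∀ n → ∃[ d ] (4 + 4 * ⌊log₂ n ⌋ ≤ b ^ d × b ^ d ≤ b * (4 + 4 * ⌊log₂ n ⌋))
      between n = power-between b 2≤b′ (3 + 4 * ⌊log₂ n ⌋)

      depth : ℕ → ℕ
      depth n = proj₁ (between n)

    r′ : ℕ → ℕ
    r′ n = suc (suc Δ ^ suc (depth n))

    r′-bound : Σ[ C ∈ ℕ ] Σ[ n₁ ∈ ℕ ] ∀ n → n₁ ≤ n → r′ n ≤ C * (⌊log₂ n ⌋ ^ 2)
    r′-bound = suc (suc Δ * (8 * b * (8 * b))) , 2 , bound
      where
      open ≤-Reasoning
      e₁ : ∀ b L → b * (8 * L) * (b * (8 * L)) ≡ 8 * b * (8 * b) * (L * (L * 1))
      e₁ = solve-∀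
      e₂ : ∀ L → 4 * L + 4 * L ≡ 8 * L
      e₂ = solve-∀
      bound : ∀ n → 2 ≤ n → r′ n ≤ suc (suc Δ * (8 * b * (8 * b))) * (⌊log₂ n ⌋ ^ 2)
      bound n 2≤n = begin
        suc (suc Δ * suc Δ ^ d)                     ≤⟨ s≤s (*-monoʳ-≤ (suc Δ) small) ⟩
        suc (suc Δ * (8 * b * (8 * b) * L ^ 2))     ≡⟨ cong suc (*-assoc (suc Δ) (8 * b * (8 * b)) (L ^ 2)) ⟨
        suc (suc Δ * (8 * b * (8 * b)) * L ^ 2)     ≤⟨ +-monoˡ-≤ _ (^-monoˡ-≤ 2 1≤L) ⟩
        suc (suc Δ * (8 * b * (8 * b))) * L ^ 2     ∎
        where
        d = depth n
        L = ⌊log₂ n ⌋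
        1≤L : 1 ≤ L
        1≤L = ≤log₂ {n} {1} 2≤n
        8L : 4 + 4 * L ≤ 8 * L
        8L = ≤-trans (+-monoˡ-≤ (4 * L) (*-monoʳ-≤ 4 1≤L)) (≤-reflexive (e₂ L))
        b^d≤ : b ^ d ≤ b * (8 * L)
        b^d≤ = ≤-trans (proj₂ (proj₂ (between n))) (*-monoʳ-≤ b 8L)
        small : suc Δ ^ d ≤ 8 * b * (8 * b) * L ^ 2
        small = begin
          suc Δ ^ d                       ≤⟨ ^-monoˡ-≤ d (1+Δ≤b² Δ c≤k large H k≡b+2) ⟩
          (b * b) ^ d                     ≡⟨ ^-distribʳ-* b b d ⟩
          b ^ d * b ^ d                   ≤⟨ *-mono-≤ b^d≤ b^d≤ ⟩
          b * (8 * L) * (b * (8 * L))     ≡⟨ e₁ b L ⟩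
          8 * b * (8 * b) * L ^ 2         ∎

    eventually : ∀ m → Σ[ n₀ ∈ ℕ ] ∀ n → n₀ ≤ n → (G : Graph n) → MaxDegree G Δ → GirthAtLeastLnLn G →
      ProbAtLeast G k m (λ σ → ∀ (v : Fin n) → Loose G (r′ n) σ v × Thawed G 1 σ v)
    -- 2^(b^6) gives b^6 ≤ log n for `cycles-long`; the rest gives m < n and 1 < n.
    eventually m = 2 ^ (b ^ 6) + (suc m + 2) , go
      where
      go : ∀ n → 2 ^ (b ^ 6) + (suc m + 2) ≤ n → (G : Graph n) → MaxDegree G Δ → GirthAtLeastLnLn G →
        ProbAtLeast G k m (λ σ → ∀ (v : Fin n) → Loose G (r′ n) σ v × Thawed G 1 σ v)
      go n n₀≤n G (deg≤Δ , _) girth = Probability.likely k G (d + d + 6)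
        (λ cy isCycle → cycles-long {d = d} {n} 256≤b b⁶≤L lo hi (girth cy isCycle))
        (parameters Δ c≤k large H) deg≤Δ (s≤s z≤n) 2≤b′ (≤-reflexive (sym k≡b+2)) (binomial Δ c≤k large H k≡b+2)
        (2a≤ℓ Δ c≤k large H) d ≤-refl 2≤n m enough
        where
        open ≤-Reasoning
        d = depth n
        L = ⌊log₂ n ⌋
        lo = proj₁ (proj₂ (between n))
        hi = proj₂ (proj₂ (between n))
        rest≤n : suc m + 2 ≤ n
        rest≤n = ≤-trans (m≤n+m (suc m + 2) (2 ^ (b ^ 6))) n₀≤n
        2≤n : 2 ≤ n
        2≤n = ≤-trans (m≤n+m 2 (suc m)) rest≤n
        m<n : suc m ≤ n
        m<n = ≤-trans (m≤m+n (suc m) 2) rest≤n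
        b⁶≤L : b ^ 6 ≤ L
        b⁶≤L = ≤log₂ (≤-trans (m≤m+n (2 ^ (b ^ 6)) (suc m + 2)) n₀≤n)
        n≤z : n ≤ 2 ^ suc L
        n≤z = <⇒≤ (n<2^[1+log₂n] n)
        e₁ : ∀ L → suc L + (suc L + suc L) + suc L ≡ 4 + 4 * L
        e₁ = solve-∀
        enough : suc m * (n * n) ≤ 2 ^ (b ^ d)
        enough = begin
          suc m * (n * n)                            ≤⟨ *-mono-≤ (≤-trans m<n n≤z) (*-mono-≤ n≤z n≤z) ⟩
          2 ^ suc L * (2 ^ suc L * 2 ^ suc L)        ≡⟨ cong (2 ^ suc L *_) (^-distribˡ-+-* 2 (suc L) (suc L)) ⟨
          2 ^ suc L * 2 ^ (suc L + suc L)            ≡⟨ ^-distribˡ-+-* 2 (suc L) (suc L + suc L) ⟨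
          2 ^ (suc L + (suc L + suc L))              ≤⟨ ^-monoʳ-≤ 2 (≤-trans (m≤m+n _ (suc L)) (≤-trans (≤-reflexive (e₁ L)) lo)) ⟩
          2 ^ (b ^ d)                                ∎

theorem-with-constants : ∀ q τ C → suc τ ≡ suc q * suc (suc (suc q)) → 512 ≤ C → 8 * (suc (suc τ) * suc (suc τ)) * suc (suc (suc q)) ≤ C →
    ∀ ε → recip (suc q) ℚ.≤ ε →
    Σ[ k₀ ∈ ℕ ] ∀ (k : ℕ) → k₀ ≤ k → ∀ (Δ : ℕ) → DeltaBound ε k Δ →
    Σ[ r ∈ (ℕ → ℕ) ] ((Σ[ C ∈ ℕ ] Σ[ n₁ ∈ ℕ ] ∀ (n : ℕ) → n₁ ≤ n → r n ≤ C * (⌊log₂ n ⌋ ^ 2))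
    × (∀ (m : ℕ) → Σ[ n₀ ∈ ℕ ] ∀ (n : ℕ) → n₀ ≤ n → ∀ (G : Graph n) →
    MaxDegree G Δ → GirthAtLeastLnLn G →
    ProbAtLeast G k m (λ σ → ∀ (v : Fin n) → Loose G (r n) σ v × Thawed G 1 σ v)))
theorem-with-constants q τ C τ≡ 512≤C ≤C ε 1/p≤ε = k₀ , λ k k₀≤k Δ bound →
  let H = λ s → DeltaBound⇒ {ε} {k} {Δ} (suc q) 1/p≤ε bound s τ in
  r′ k k₀≤k Δ H , r′-bound k k₀≤k Δ H , eventually k k₀≤k Δ H
  where
  p²-1 : ∀ q → suc (suc q * suc (suc (suc q))) ≡ suc (suc q) * suc (suc q)
  p²-1 = solve-∀
  open Main (suc q) (suc (suc q)) (suc (suc (suc q))) (suc τ) C refl refl (trans (cong suc τ≡) (p²-1 q)) τ≡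
    512≤C ≤C (2l^l≤[1+l]^l τ) ([1+1/l]^[1+l]≤4 τ)

theorem2p9 : ∀ (ε : ℚ) → 0ℚ ℚ.< ε → ε ℚ.< 1ℚ →
    Σ[ k₀ ∈ ℕ ] ∀ (k : ℕ) → k₀ ≤ k → ∀ (Δ : ℕ) → DeltaBound ε k Δ →
    Σ[ r ∈ (ℕ → ℕ) ] ((Σ[ C ∈ ℕ ] Σ[ n₁ ∈ ℕ ] ∀ (n : ℕ) → n₁ ≤ n → r n ≤ C * (⌊log₂ n ⌋ ^ 2))
    × (∀ (m : ℕ) → Σ[ n₀ ∈ ℕ ] ∀ (n : ℕ) → n₀ ≤ n → ∀ (G : Graph n) →
    MaxDegree G Δ → GirthAtLeastLnLn G →
    ProbAtLeast G k m (λ σ → ∀ (v : Fin n) → Loose G (r n) σ v × Thawed G 1 σ v)))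
theorem2p9 ε 0<ε _ with recip≤ ε 0<ε
-- Here p = q + 2, r = p + 1, t = p² and C = 512 + 8 t² r.
... | q , 1/p≤ε = theorem-with-constants q _ _ refl (m≤m+n 512 _) (m≤n+m _ 512) ε 1/p≤ε
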